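{- Let $s\ge 1$ be an integer. The sum of the sizes of all $(s,s+1)$-cores equals $$\frac{s(s-1)}{12}\binom{2s}{s}.$$ Equivalently, since there are $C_s=\frac{1}{s+1}\binom{2s}{s}$ such cores, the average size of an $(s,s+1)$-core is $\frac{(2s+2)(s-1)s}{24}=\frac{1}{2}\binom{s+1}{3}$.
   Context: A partition $\lambda=(\lambda_1,\dots,\lambda_m)$ is a weakly decreasing sequence of positive integers. Its size is $\lambda_1+\dots+\lambda_m$. The hook length of a cell $B$ of the Young diagram is the number of cells directly to the right of $B$ in its row or directly below $B$ in its column, including $B$ itself. $\lambda$ is an $s$-core if no cell has hook length equal to $s$. An $(s,t)$-core is a partition that is both an $s$-core and a $t$-core. -}

module Defs where

open import Data.Integer using (+_)
open import Data.List using (List; []; _∷_; _++_; filter; length; map; upTo)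
open import Data.List.Membership.Propositional using (_∈_)
open import Data.List.Relation.Unary.All using (All)
open import Data.List.Relation.Unary.Linked using (Linked)
open import Data.List.Relation.Unary.Unique.Propositional using (Unique)
open import Data.Nat using (ℕ; suc; _≤_; _≥_; _<_; _≟_; _≤?_; NonZero)
open import Data.Nat.ListAction using (sum)
open import Data.Product using (_×_; _,_; map₁)
open import Data.Rational using (ℚ; _/_)
open import Data.Sum using (_⊎_)
open import Function.Bundles using (_⇔_)
open import Relation.Binary.PropositionalEquality using (_≡_; _≢_)
open import Relation.Nullary.Decidable using (Dec; _×-dec_; _⊎-dec_)

record IsPartition (p : List ℕ) : Set where
  constructor isPartition
  field
    positive : All (0 <_) p
    weaklyDecreasing : Linked _≥_ p

size : List ℕ → ℕ
size = sum

-- A cell is a pair (row , column), both numbered from 0, rows from top to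
-- bottom and columns from left to right.
Cell : Set
Cell = ℕ × ℕ

cells : List ℕ → List Cell
cells []       = []
cells (r ∷ rs) = map (0 ,_) (upTo r) ++ map (map₁ suc) (cells rs)

-- C is B itself, or directly to the right of B, or directly below B.
InHook : Cell → Cell → Set
InHook (i , j) (i′ , j′) = (i′ ≡ i × j ≤ j′) ⊎ (j′ ≡ j × i ≤ i′)

inHook? : (B C : Cell) → Dec (InHook B C)
inHook? (i , j) (i′ , j′) =
  ((i′ ≟ i) ×-dec (j ≤? j′)) ⊎-dec ((j′ ≟ j) ×-dec (i ≤? i′))

hookLength : List ℕ → Cell → ℕ
hookLength p B = length (filter (inHook? B) (cells p))

HasNoHook : ℕ → List ℕ → Set
HasNoHook s p = All (λ B → hookLength p B ≢ s) (cells p)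

IsCore : ℕ → List ℕ → Set
IsCore s p = IsPartition p × HasNoHook s p

IsCore₂ : ℕ → ℕ → List ℕ → Set
IsCore₂ s t p = IsCore s p × IsCore t p

-- The list contains every element satisfying P exactly once, and nothing else;
-- in particular only finitely many elements satisfy P.
record Enumerates {A : Set} (P : A → Set) (xs : List A) : Set where
  constructor enumerates
  field
    unique  : Unique xs
    members : ∀ x → x ∈ xs ⇔ P x

totalSize : List (List ℕ) → ℕ
totalSize ps = sum (map size ps)

averageSize : (ps : List (List ℕ)) → .{{NonZero (length ps)}} → ℚ
averageSize ps = + totalSize ps / length ps

fromℕ : ℕ → ℚ
fromℕ n = + n / 1

{-# OPTIONS --safe #-}
module Submission where

-- A partition is determined by its set of first-column hook lengths, and it is an s-core iff that
-- set is closed under subtracting s. For an (s, s+1)-core the set is {r + q s : r < s, q < a r} with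
-- a 0 = 0 and a (r + 1) ≤ a r + 1. Writing a r = r - (z₁ + … + z_r) turns a into a weak composition z
-- of s + 1 into s parts whose proper partial sums satisfy z₁ + … + z_r ≤ r. By the cycle lemma every
-- weak composition of s + 1 into s parts has exactly one rotation with this property, and twice the
-- size of the core is a quadratic function of z which is invariant under rotation. So s times the sum
-- over cores is a sum over all weak compositions, which is evaluated by a Pascal-type recursion.

open import Defs
open import Data.Bool using (if_then_else_)
open import Data.Integer using (ℤ; +_; 0ℤ; 1ℤ; -1ℤ) renaming (_+_ to _+ᶻ_; _*_ to _*ᶻ_; _-_ to _-ᶻ_)
import Data.Integer.Properties as ℤₚ
open import Data.Integer.Tactic.RingSolver using (solve-∀)
open import Data.List using
  (List; []; _∷_; _++_; length; map; take; drop; filter; upTo; downFrom; initLast; _∷ʳ′_)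
open import Data.List.Membership.Propositional using (_∈_; _∉_)
open import Data.List.Membership.Propositional.Properties using
  (∈-map⁺; ∈-map⁻; ∈-++⁺ˡ; ∈-++⁺ʳ; ∈-filter⁺; ∈-filter⁻; ∈-downFrom⁺)
open import Data.List.Membership.Propositional.Properties.WithK using (unique∧set⇒bag)
open import Data.List.Properties using
  (∷-injective; ∷-injectiveʳ; ∷ʳ-injective; ++-assoc; ++-identityʳ; applyUpTo-∷ʳ; filter-++
  ; filter-accept; filter-reject; filter-all; filter-none; filter-≐; length-++; length-map
  ; length-take; length-drop; length-filter; take-all; take++drop≡id)
open import Data.List.Relation.Binary.BagAndSetEquality using (∼bag⇒↭)
open import Data.List.Relation.Binary.Permutation.Propositional as Perm using (_↭_)
open import Data.List.Relation.Unary.All as All using (All; []; _∷_)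
import Data.List.Relation.Unary.All.Properties as All
open import Data.List.Relation.Unary.AllPairs using (AllPairs; []; _∷_)
import Data.List.Relation.Unary.AllPairs.Properties as AllPairs
open import Data.List.Relation.Unary.Any using (here; there)
open import Data.List.Relation.Unary.Linked using (Linked; []; [-]; _∷_)
open import Data.List.Relation.Unary.Linked.Properties using (Linked⇒AllPairs)
open import Data.List.Relation.Unary.Unique.Propositional using (Unique)
import Data.List.Relation.Unary.Unique.Propositional.Properties as Unique
open import Data.Nat using
  (ℕ; zero; suc; _+_; _*_; _∸_; _≤_; _≥_; _<_; _>_; _≤?_; _<?_; _≟_; z≤n; s≤s; NonZero)
open import Data.Nat.Combinatorics using (_C_; nCn≡1; nC1≡n; nCk+nC[k+1]≡[n+1]C[k+1])
open import Data.Nat.Divisibility using (n∣m*n)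
open import Data.Nat.DivMod using
  (_%_; [m+kn]%n≡m%n; m<n⇒m%n≡m; m<n⇒m/n≡0; +-distrib-/-∣ʳ; m*n/n≡m; m≡m%n+[m/n]*n; m%n<n)
  renaming (_/_ to _/ℕ_)
open import Data.Nat.ListAction using (sum)
open import Data.Nat.ListAction.Properties using (sum-++)
import Data.Nat.Properties as ℕₚ
open import Data.Nat.Tactic.RingSolver renaming (solve-∀ to solveℕ)
open import Data.Product using (Σ; _×_; _,_; proj₁; proj₂; ∃; ∃₂; map₁)
open import Data.Rational using (ℚ; _/_; ½; toℚᵘ) renaming (_*_ to _*ℚ_)
import Data.Rational.Properties as ℚₚ
open import Data.Rational.Unnormalised as ℚᵘ using (mkℚᵘ; *≡*)
import Data.Rational.Unnormalised.Properties as ℚᵘₚ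
open import Data.Sum using (_⊎_; inj₁; inj₂)
open import Function using (_∘_; id)
open import Function.Bundles using (_⇔_; mk⇔; Equivalence)
open import Relation.Binary.PropositionalEquality using
  (_≡_; _≢_; refl; cong; cong₂; sym; trans; subst; subst₂; module ≡-Reasoning)
open import Relation.Nullary.Decidable using (Dec; yes; no; does; map′)
open import Relation.Nullary.Negation using (¬_; contradiction)
open import Relation.Unary using (Decidable)
open import Data.List.Membership.DecPropositional _≟_ using (_∈?_)

-- The rotation invariance comes from beads on the integers. Let `q` in `{r + q s : q < a r}` run
-- over all integers: the result is a bead set containing every sufficiently negative integer, and
-- its partition depends on it only up to translation. Since `(r + s) + q s` is `r + (q + 1) s`, the
-- sequence continues past `s` by `a (r + s) = a r - 1`; this is why the parts of `z` sum to
-- `s + 1`. Dropping the first step of the sequence translates the beads by `-1`, and renormalising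
-- it to start at 0 translates them by a multiple of `s`. So all rotations of `z` describe one core,
-- and the condition on partial sums only selects the translate whose least non-bead is 0. The gain
-- is a sum over compositions without side condition, of a polynomial of degree two in the partial
-- sums. Only first and second moments are needed, and each is the number of compositions times a
-- polynomial. Heights go below zero on every rotation but one, hence the arithmetic over the
-- integers.

-- Finite sums over initial segments and over lists

∑ : ℕ → (ℕ → ℤ) → ℤ
∑ zero    f = 0ℤ
∑ (suc n) f = f 0 +ᶻ ∑ n (λ i → f (suc i))

∑-cong : ∀ n {f g : ℕ → ℤ} → (∀ i → i < n → f i ≡ g i) → ∑ n f ≡ ∑ n g
∑-cong zero    eq = refl
∑-cong (suc n) eq = cong₂ _+ᶻ_ (eq 0 (s≤s z≤n)) (∑-cong n λ i i<n → eq (suc i) (s≤s i<n))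

interchange : ∀ a b c d → a +ᶻ b +ᶻ (c +ᶻ d) ≡ a +ᶻ c +ᶻ (b +ᶻ d)
interchange = solve-∀

∑-+ : ∀ n (f g : ℕ → ℤ) → ∑ n (λ i → f i +ᶻ g i) ≡ ∑ n f +ᶻ ∑ n g
∑-+ zero    f g = refl
∑-+ (suc n) f g =
  trans (cong (f 0 +ᶻ g 0 +ᶻ_) (∑-+ n (f ∘ suc) (g ∘ suc)))
        (interchange (f 0) (g 0) (∑ n (f ∘ suc)) (∑ n (g ∘ suc)))

∑-- : ∀ n (f g : ℕ → ℤ) → ∑ n (λ i → f i -ᶻ g i) ≡ ∑ n f -ᶻ ∑ n g
∑-- zero    f g = refl
∑-- (suc n) f g = trans (cong (f 0 -ᶻ g 0 +ᶻ_) (∑-- n (f ∘ suc) (g ∘ suc)))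
                        (lemma (f 0) (g 0) (∑ n (f ∘ suc)) (∑ n (g ∘ suc)))
  where
  lemma : ∀ a b c d → a -ᶻ b +ᶻ (c -ᶻ d) ≡ a +ᶻ c -ᶻ (b +ᶻ d)
  lemma = solve-∀

∑-*ˡ : ∀ n c (f : ℕ → ℤ) → ∑ n (λ i → c *ᶻ f i) ≡ c *ᶻ ∑ n f
∑-*ˡ zero    c f = sym (ℤₚ.*-zeroʳ c)
∑-*ˡ (suc n) c f =
  trans (cong (c *ᶻ f 0 +ᶻ_) (∑-*ˡ n c (f ∘ suc))) (sym (ℤₚ.*-distribˡ-+ c (f 0) _))

∑-const : ∀ n c → ∑ n (λ _ → c) ≡ + n *ᶻ c
∑-const zero    c = refl
∑-const (suc n) c = trans (cong (c +ᶻ_) (∑-const n c)) (lemma c (+ n))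
  where
  lemma : ∀ c n → c +ᶻ n *ᶻ c ≡ (1ℤ +ᶻ n) *ᶻ c
  lemma = solve-∀

-- Changes between counting from 0 and counting from 1 pass through this identity; its two boundary
-- terms are where the end values of a height sequence enter.
∑-shift : ∀ n (f : ℕ → ℤ) → ∑ n (f ∘ suc) ≡ ∑ n f -ᶻ f 0 +ᶻ f n
∑-shift zero    f = lemma (f 0)
  where
  lemma : ∀ a → 0ℤ ≡ 0ℤ -ᶻ a +ᶻ a
  lemma = solve-∀
∑-shift (suc n) f =
  trans (cong (f 1 +ᶻ_) (∑-shift n (f ∘ suc))) (lemma (f 1) (∑ n (f ∘ suc)) (f (suc n)) (f 0))
  where
  lemma : ∀ a b c d → a +ᶻ (b -ᶻ a +ᶻ c) ≡ d +ᶻ b -ᶻ d +ᶻ c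
  lemma = solve-∀

∑-split : ∀ m n (f : ℕ → ℤ) → ∑ (m + n) f ≡ ∑ m f +ᶻ ∑ n (λ i → f (m + i))
∑-split zero    n f = sym (ℤₚ.+-identityˡ _)
∑-split (suc m) n f =
  trans (cong (f 0 +ᶻ_) (∑-split m n (f ∘ suc))) (sym (ℤₚ.+-assoc (f 0) _ _))

∑-swap : ∀ m n (f : ℕ → ℕ → ℤ) → ∑ m (λ i → ∑ n (f i)) ≡ ∑ n (λ j → ∑ m (λ i → f i j))
∑-swap zero    n f = sym (trans (∑-const n 0ℤ) (ℤₚ.*-zeroʳ (+ n)))
∑-swap (suc m) n f =
  trans (cong (∑ n (f 0) +ᶻ_) (∑-swap m n (f ∘ suc)))
        (sym (∑-+ n (f 0) (λ j → ∑ m (λ i → f (suc i) j))))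

∑∈ : {A : Set} → List A → (A → ℤ) → ℤ
∑∈ []       f = 0ℤ
∑∈ (x ∷ xs) f = f x +ᶻ ∑∈ xs f

module _ {A : Set} where

  ∑∈-cong : ∀ (xs : List A) {f g : A → ℤ} → (∀ {x} → x ∈ xs → f x ≡ g x) → ∑∈ xs f ≡ ∑∈ xs g
  ∑∈-cong []       eq = refl
  ∑∈-cong (x ∷ xs) eq = cong₂ _+ᶻ_ (eq (here refl)) (∑∈-cong xs (eq ∘ there))

  ∑∈-+ : ∀ (xs : List A) (f g : A → ℤ) → ∑∈ xs (λ x → f x +ᶻ g x) ≡ ∑∈ xs f +ᶻ ∑∈ xs g
  ∑∈-+ []       f g = refl
  ∑∈-+ (x ∷ xs) f g =
    trans (cong (f x +ᶻ g x +ᶻ_) (∑∈-+ xs f g)) (interchange (f x) (g x) (∑∈ xs f) (∑∈ xs g))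

  ∑∈-*ˡ : ∀ (xs : List A) c (f : A → ℤ) → ∑∈ xs (λ x → c *ᶻ f x) ≡ c *ᶻ ∑∈ xs f
  ∑∈-*ˡ []       c f = sym (ℤₚ.*-zeroʳ c)
  ∑∈-*ˡ (x ∷ xs) c f =
    trans (cong (c *ᶻ f x +ᶻ_) (∑∈-*ˡ xs c f)) (sym (ℤₚ.*-distribˡ-+ c (f x) _))

  ∑∈-++ : ∀ (xs ys : List A) (f : A → ℤ) → ∑∈ (xs ++ ys) f ≡ ∑∈ xs f +ᶻ ∑∈ ys f
  ∑∈-++ []       ys f = sym (ℤₚ.+-identityˡ _)
  ∑∈-++ (x ∷ xs) ys f = trans (cong (f x +ᶻ_) (∑∈-++ xs ys f)) (sym (ℤₚ.+-assoc (f x) _ _))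

  ∑∈-map : ∀ {B : Set} (g : B → A) (xs : List B) (f : A → ℤ) → ∑∈ (map g xs) f ≡ ∑∈ xs (f ∘ g)
  ∑∈-map g []       f = refl
  ∑∈-map g (x ∷ xs) f = cong (f (g x) +ᶻ_) (∑∈-map g xs f)

  length-∑∈ : ∀ (xs : List A) → + length xs ≡ ∑∈ xs (λ _ → 1ℤ)
  length-∑∈ []       = refl
  length-∑∈ (x ∷ xs) = cong (1ℤ +ᶻ_) (length-∑∈ xs)

-- Weak compositions

incHead : List ℕ → List ℕ
incHead []       = []
incHead (x ∷ xs) = suc x ∷ xs

-- Generated by the two moves behind Pascal's rule because both act simply on partial sums: a new
-- head 0 inserts a partial sum 0 and moves the others by one position, and an increment of the head
-- adds 1 to all of them.
compositions : ℕ → ℕ → List (List ℕ)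
compositions zero    zero    = [] ∷ []
compositions zero    (suc t) = []
compositions (suc k) zero    = map (0 ∷_) (compositions k zero)
compositions (suc k) (suc t) =
  map (0 ∷_) (compositions k (suc t)) ++ map incHead (compositions (suc k) t)

compositions-sound : ∀ k t → All (λ z → length z ≡ k × sum z ≡ t) (compositions k t)
compositions-sound zero    zero    = (refl , refl) ∷ []
compositions-sound zero    (suc t) = []
compositions-sound (suc k) zero    =
  All.map⁺ (All.map (map₁ (cong suc)) (compositions-sound k zero))
compositions-sound (suc k) (suc t) =
  All.++⁺ (All.map⁺ (All.map (map₁ (cong suc)) (compositions-sound k (suc t))))
          (All.map⁺ (All.map (λ {z} → incHead-sound z) (compositions-sound (suc k) t)))
  where
  incHead-sound : ∀ z → length z ≡ suc k × sum z ≡ t →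
    length (incHead z) ≡ suc k × sum (incHead z) ≡ suc t
  incHead-sound (_ ∷ _) (lz , sz) = lz , cong suc sz

∈-compositions⁻ : ∀ k t {z} → z ∈ compositions k t → length z ≡ k × sum z ≡ t
∈-compositions⁻ k t = All.lookup (compositions-sound k t)

∈-compositions⁺ : ∀ k t {z} → length z ≡ k → sum z ≡ t → z ∈ compositions k t
∈-compositions⁺ zero    t       {[]}         refl refl = here refl
∈-compositions⁺ (suc k) zero    {zero ∷ z}   lz   sz   =
  ∈-map⁺ (0 ∷_) (∈-compositions⁺ k zero (ℕₚ.suc-injective lz) sz)
∈-compositions⁺ (suc k) (suc t) {zero ∷ z}   lz   sz   =
  ∈-++⁺ˡ (∈-map⁺ (0 ∷_) (∈-compositions⁺ k (suc t) (ℕₚ.suc-injective lz) sz))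
∈-compositions⁺ (suc k) (suc t) {suc x ∷ z}  lz   sz   =
  ∈-++⁺ʳ (map (0 ∷_) (compositions k (suc t)))
    (∈-map⁺ incHead (∈-compositions⁺ (suc k) t {x ∷ z} lz (ℕₚ.suc-injective sz)))

incHead-injective : ∀ {y z} → incHead y ≡ incHead z → y ≡ z
incHead-injective {[]}    {[]}    eq = refl
incHead-injective {_ ∷ _} {_ ∷ _} eq with ∷-injective eq
... | eq₁ , eq₂ = cong₂ _∷_ (ℕₚ.suc-injective eq₁) eq₂

compositions-unique : ∀ k t → Unique (compositions k t)
compositions-unique zero    zero    = [] ∷ []
compositions-unique zero    (suc t) = []
compositions-unique (suc k) zero    = Unique.map⁺ ∷-injectiveʳ (compositions-unique k zero)
compositions-unique (suc k) (suc t) =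
  Unique.++⁺ (Unique.map⁺ ∷-injectiveʳ (compositions-unique k (suc t)))
             (Unique.map⁺ incHead-injective (compositions-unique (suc k) t))
             disjoint
  where
  disjoint : ∀ {z} → z ∈ map (0 ∷_) (compositions k (suc t))
                     × z ∈ map incHead (compositions (suc k) t) → _
  disjoint (z∈₁ , z∈₂) with ∈-map⁻ (0 ∷_) z∈₁ | ∈-map⁻ incHead z∈₂
  ... | _ , _ , refl | [] , _ , ()
  ... | _ , _ , refl | _ ∷ _ , _ , ()

-- Statistics of partial sums and their recursion

partialSum : List ℕ → ℕ → ℕ
partialSum z r = sum (take r z)

-- Index 0 is the partial sum of one part, so `k` consecutive terms omit the empty sum and include
-- the full one. This suits the recursion; heights start with the empty sum instead.
σ : List ℕ → ℕ → ℤ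
σ z r = + partialSum z (suc r)

total : (ℕ → List ℕ → ℤ) → ℕ → ℕ → ℤ
total F k t = ∑∈ (compositions k t) (F k)

total-suc-zero : ∀ F G k → (∀ z → F (suc k) (0 ∷ z) ≡ G k z) → total F (suc k) 0 ≡ total G k 0
total-suc-zero F G k eq =
  trans (∑∈-map (0 ∷_) (compositions k 0) (F (suc k))) (∑∈-cong (compositions k 0) λ {z} _ → eq z)

-- `G` and `H` may differ from `F` because the two moves turn a statistic into a combination of
-- statistics. The condition on `H` concerns nonempty lists only, which is all that `incHead` meets
-- here.
total-suc-suc : ∀ F G H k t → (∀ z → F (suc k) (0 ∷ z) ≡ G k z) →
  (∀ x z → F (suc k) (suc x ∷ z) ≡ H (suc k) (x ∷ z)) →
  total F (suc k) (suc t) ≡ total G k (suc t) +ᶻ total H (suc k) t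
total-suc-suc F G H k t eq₀ eq₁ =
  trans (∑∈-++ (map (0 ∷_) (compositions k (suc t))) _ (F (suc k)))
    (cong₂ _+ᶻ_
      (trans (∑∈-map (0 ∷_) (compositions k (suc t)) (F (suc k)))
             (∑∈-cong (compositions k (suc t)) λ {z} _ → eq₀ z))
      (trans (∑∈-map incHead (compositions (suc k) t) (F (suc k)))
             (∑∈-cong (compositions (suc k) t) nonempty)))
  where
  nonempty : ∀ {z} → z ∈ compositions (suc k) t → F (suc k) (incHead z) ≡ H (suc k) z
  nonempty {[]}    z∈ with () , _ ← ∈-compositions⁻ (suc k) t z∈
  nonempty {x ∷ z} z∈ = eq₁ x z

-- Power sums of the partial sums; Sʷ is weighted by position.
ones S S² Sʷ SS : ℕ → List ℕ → ℤ
ones k z = 1ℤ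
S  k z = ∑ k (σ z)
S² k z = ∑ k (λ i → σ z i *ᶻ σ z i)
Sʷ k z = ∑ k (λ i → + suc i *ᶻ σ z i)
SS k z = S k z *ᶻ S k z

Δ : ℕ → ℤ
Δ n = ∑ n (λ i → + i)

□ : ℕ → ℤ
□ n = ∑ n (λ i → + i *ᶻ + i)

∑-snoc : ∀ n (f : ℕ → ℤ) → ∑ (suc n) f ≡ ∑ n f +ᶻ f n
∑-snoc n f = trans (cong (f 0 +ᶻ_) (∑-shift n f)) (lemma (f 0) (∑ n f) (f n))
  where
  lemma : ∀ a b c → a +ᶻ (b -ᶻ a +ᶻ c) ≡ b +ᶻ c
  lemma = solve-∀

2Δ : ∀ n → + 2 *ᶻ Δ n ≡ + n *ᶻ (+ n -ᶻ 1ℤ)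
2Δ zero    = refl
2Δ (suc n) = begin
  + 2 *ᶻ Δ (suc n)                       ≡⟨ cong (+ 2 *ᶻ_) (∑-snoc n (λ i → + i)) ⟩
  + 2 *ᶻ (Δ n +ᶻ + n)                    ≡⟨ ℤₚ.*-distribˡ-+ (+ 2) (Δ n) (+ n) ⟩
  + 2 *ᶻ Δ n +ᶻ + 2 *ᶻ + n               ≡⟨ cong (_+ᶻ + 2 *ᶻ + n) (2Δ n) ⟩
  + n *ᶻ (+ n -ᶻ 1ℤ) +ᶻ + 2 *ᶻ + n       ≡⟨ lemma (+ n) ⟩
  + suc n *ᶻ (+ suc n -ᶻ 1ℤ)             ∎
  where
  open ≡-Reasoning
  lemma : ∀ n → n *ᶻ (n -ᶻ 1ℤ) +ᶻ + 2 *ᶻ n ≡ (1ℤ +ᶻ n) *ᶻ (1ℤ +ᶻ n -ᶻ 1ℤ)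
  lemma = solve-∀

6□ : ∀ n → + 6 *ᶻ □ n ≡ + n *ᶻ (+ n -ᶻ 1ℤ) *ᶻ (+ 2 *ᶻ + n -ᶻ 1ℤ)
6□ zero    = refl
6□ (suc n) = begin
  + 6 *ᶻ □ (suc n)                       ≡⟨ cong (+ 6 *ᶻ_) (∑-snoc n (λ i → + i *ᶻ + i)) ⟩
  + 6 *ᶻ (□ n +ᶻ + n *ᶻ + n)             ≡⟨ ℤₚ.*-distribˡ-+ (+ 6) (□ n) (+ n *ᶻ + n) ⟩
  + 6 *ᶻ □ n +ᶻ + 6 *ᶻ (+ n *ᶻ + n)      ≡⟨ cong (_+ᶻ + 6 *ᶻ (+ n *ᶻ + n)) (6□ n) ⟩
  + n *ᶻ (+ n -ᶻ 1ℤ) *ᶻ (+ 2 *ᶻ + n -ᶻ 1ℤ) +ᶻ + 6 *ᶻ (+ n *ᶻ + n)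
                                         ≡⟨ lemma (+ n) ⟩
  + suc n *ᶻ (+ suc n -ᶻ 1ℤ) *ᶻ (+ 2 *ᶻ + suc n -ᶻ 1ℤ) ∎
  where
  open ≡-Reasoning
  lemma : ∀ n → n *ᶻ (n -ᶻ 1ℤ) *ᶻ (+ 2 *ᶻ n -ᶻ 1ℤ) +ᶻ + 6 *ᶻ (n *ᶻ n)
              ≡ (1ℤ +ᶻ n) *ᶻ (1ℤ +ᶻ n -ᶻ 1ℤ) *ᶻ (+ 2 *ᶻ (1ℤ +ᶻ n) -ᶻ 1ℤ)
  lemma = solve-∀

S-0∷ : ∀ k z → S (suc k) (0 ∷ z) ≡ S k z
S-0∷ k z = ℤₚ.+-identityˡ _

S²-0∷ : ∀ k z → S² (suc k) (0 ∷ z) ≡ S² k z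
S²-0∷ k z = ℤₚ.+-identityˡ _

Sʷ-0∷ : ∀ k z → Sʷ (suc k) (0 ∷ z) ≡ Sʷ k z +ᶻ S k z
Sʷ-0∷ k z = begin
  0ℤ +ᶻ ∑ k (λ i → + suc (suc i) *ᶻ σ z i)          ≡⟨ ℤₚ.+-identityˡ _ ⟩
  ∑ k (λ i → + suc (suc i) *ᶻ σ z i)                ≡⟨ ∑-cong k (λ i _ → lemma (+ suc i) (σ z i)) ⟩
  ∑ k (λ i → + suc i *ᶻ σ z i +ᶻ σ z i)             ≡⟨ ∑-+ k _ (σ z) ⟩
  Sʷ k z +ᶻ S k z                                   ∎
  where
  open ≡-Reasoning
  lemma : ∀ a b → (1ℤ +ᶻ a) *ᶻ b ≡ a *ᶻ b +ᶻ b
  lemma = solve-∀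

S-suc : ∀ k x z → S k (suc x ∷ z) ≡ S k (x ∷ z) +ᶻ + k *ᶻ 1ℤ
S-suc k x z = begin
  ∑ k (λ i → 1ℤ +ᶻ σ (x ∷ z) i)               ≡⟨ ∑-+ k (λ _ → 1ℤ) (σ (x ∷ z)) ⟩
  ∑ k (λ _ → 1ℤ) +ᶻ S k (x ∷ z)               ≡⟨ ℤₚ.+-comm (∑ k (λ _ → 1ℤ)) (S k (x ∷ z)) ⟩
  S k (x ∷ z) +ᶻ ∑ k (λ _ → 1ℤ)               ≡⟨ cong (S k (x ∷ z) +ᶻ_) (∑-const k 1ℤ) ⟩
  S k (x ∷ z) +ᶻ + k *ᶻ 1ℤ                    ∎
  where open ≡-Reasoning

S²-suc : ∀ k x z → S² k (suc x ∷ z) ≡ S² k (x ∷ z) +ᶻ (+ 2 *ᶻ S k (x ∷ z) +ᶻ + k *ᶻ 1ℤ)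
S²-suc k x z = begin
  ∑ k (λ i → (1ℤ +ᶻ s i) *ᶻ (1ℤ +ᶻ s i))
    ≡⟨ ∑-cong k (λ i _ → lemma (s i)) ⟩
  ∑ k (λ i → s i *ᶻ s i +ᶻ (+ 2 *ᶻ s i +ᶻ 1ℤ))
    ≡⟨ ∑-+ k (λ i → s i *ᶻ s i) (λ i → + 2 *ᶻ s i +ᶻ 1ℤ) ⟩
  S² k (x ∷ z) +ᶻ ∑ k (λ i → + 2 *ᶻ s i +ᶻ 1ℤ)
    ≡⟨ cong (S² k (x ∷ z) +ᶻ_) (∑-+ k (λ i → + 2 *ᶻ s i) (λ _ → 1ℤ)) ⟩
  S² k (x ∷ z) +ᶻ (∑ k (λ i → + 2 *ᶻ s i) +ᶻ ∑ k (λ _ → 1ℤ))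
    ≡⟨ cong (S² k (x ∷ z) +ᶻ_) (cong₂ _+ᶻ_ (∑-*ˡ k (+ 2) s) (∑-const k 1ℤ)) ⟩
  S² k (x ∷ z) +ᶻ (+ 2 *ᶻ S k (x ∷ z) +ᶻ + k *ᶻ 1ℤ) ∎
  where
  open ≡-Reasoning
  s = σ (x ∷ z)
  lemma : ∀ a → (1ℤ +ᶻ a) *ᶻ (1ℤ +ᶻ a) ≡ a *ᶻ a +ᶻ (+ 2 *ᶻ a +ᶻ 1ℤ)
  lemma = solve-∀

Sʷ-suc : ∀ k x z → Sʷ k (suc x ∷ z) ≡ Sʷ k (x ∷ z) +ᶻ Δ (suc k) *ᶻ 1ℤ
Sʷ-suc k x z = begin
  ∑ k (λ i → + suc i *ᶻ (1ℤ +ᶻ s i))              ≡⟨ ∑-cong k (λ i _ → lem₁ (+ suc i) (s i)) ⟩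
  ∑ k (λ i → + suc i *ᶻ s i +ᶻ + suc i)           ≡⟨ ∑-+ k (λ i → + suc i *ᶻ s i) (λ i → + suc i) ⟩
  Sʷ k (x ∷ z) +ᶻ ∑ k (λ i → + suc i)             ≡⟨ cong (Sʷ k (x ∷ z) +ᶻ_) (lem₂ (∑ k (λ i → + suc i))) ⟩
  Sʷ k (x ∷ z) +ᶻ Δ (suc k) *ᶻ 1ℤ                 ∎
  where
  open ≡-Reasoning
  s = σ (x ∷ z)
  lem₁ : ∀ a b → a *ᶻ (1ℤ +ᶻ b) ≡ a *ᶻ b +ᶻ a
  lem₁ = solve-∀
  lem₂ : ∀ a → a ≡ (0ℤ +ᶻ a) *ᶻ 1ℤ
  lem₂ = solve-∀

SS-0∷ : ∀ k z → SS (suc k) (0 ∷ z) ≡ SS k z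
SS-0∷ k z = cong₂ _*ᶻ_ (S-0∷ k z) (S-0∷ k z)

SS-suc : ∀ k x z → SS k (suc x ∷ z)
  ≡ SS k (x ∷ z) +ᶻ (+ 2 *ᶻ + k *ᶻ S k (x ∷ z) +ᶻ + k *ᶻ + k *ᶻ 1ℤ)
SS-suc k x z = trans (cong₂ _*ᶻ_ (S-suc k x z) (S-suc k x z)) (lemma (S k (x ∷ z)) (+ k))
  where
  lemma : ∀ a k → (a +ᶻ k *ᶻ 1ℤ) *ᶻ (a +ᶻ k *ᶻ 1ℤ)
    ≡ a *ᶻ a +ᶻ (+ 2 *ᶻ k *ᶻ a +ᶻ k *ᶻ k *ᶻ 1ℤ)
  lemma = solve-∀

-- Counting weak compositions and computing moments

N : ℕ → ℕ → ℤ
N = total ones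

N-suc-suc : ∀ k t → N (suc k) (suc t) ≡ N k (suc t) +ᶻ N (suc k) t
N-suc-suc k t = total-suc-suc ones ones ones k t (λ _ → refl) (λ _ _ → refl)

N-suc-0 : ∀ k → N (suc k) 0 ≡ 1ℤ
N-suc-0 zero    = refl
N-suc-0 (suc k) = trans (total-suc-zero ones ones (suc k) (λ _ → refl)) (N-suc-0 k)

mutual
  -- The ratio of neighbouring binomial coefficients, in a form free of division. The moments use no
  -- other fact about `N` beyond Pascal's rule. The mutual induction descends on `k + t`, with
  -- `N-ratio′` comparing neighbours in the other direction.
  N-ratio : ∀ k t → + suc t *ᶻ N k (suc t) ≡ + k *ᶻ N (suc k) t
  N-ratio zero    t    = ℤₚ.*-zeroʳ (+ suc t)
  N-ratio (suc k) zero = begin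
    1ℤ *ᶻ N (suc k) 1                  ≡⟨ N-ratio′ k zero ⟩
    (+ k +ᶻ 0ℤ +ᶻ 1ℤ) *ᶻ N (suc k) 0   ≡⟨ cong₂ _*ᶻ_ (lemma (+ k)) (trans (N-suc-0 k) (sym (N-suc-0 (suc k)))) ⟩
    + suc k *ᶻ N (suc (suc k)) 0       ∎
    where
    open ≡-Reasoning
    lemma : ∀ a → a +ᶻ 0ℤ +ᶻ 1ℤ ≡ 1ℤ +ᶻ a
    lemma = solve-∀
  N-ratio (suc k) (suc t) = begin
    + suc (suc t) *ᶻ N (suc k) (suc (suc t))             ≡⟨ N-ratio′ k (suc t) ⟩
    (+ k +ᶻ + suc t +ᶻ 1ℤ) *ᶻ N (suc k) (suc t)          ≡⟨ lem₁ (+ k) (+ t) (N (suc k) (suc t)) ⟩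
    + suc k *ᶻ N (suc k) (suc t) +ᶻ + suc t *ᶻ N (suc k) (suc t)
                                                         ≡⟨ cong (+ suc k *ᶻ N (suc k) (suc t) +ᶻ_) (N-ratio (suc k) t) ⟩
    + suc k *ᶻ N (suc k) (suc t) +ᶻ + suc k *ᶻ N (suc (suc k)) t
                                                         ≡⟨ sym (ℤₚ.*-distribˡ-+ (+ suc k) (N (suc k) (suc t)) (N (suc (suc k)) t)) ⟩
    + suc k *ᶻ (N (suc k) (suc t) +ᶻ N (suc (suc k)) t)  ≡⟨ cong (+ suc k *ᶻ_) (sym (N-suc-suc (suc k) t)) ⟩
    + suc k *ᶻ N (suc (suc k)) (suc t)                   ∎
    where
    open ≡-Reasoning
    lem₁ : ∀ k t n → (k +ᶻ (1ℤ +ᶻ t) +ᶻ 1ℤ) *ᶻ n ≡ (1ℤ +ᶻ k) *ᶻ n +ᶻ (1ℤ +ᶻ t) *ᶻ n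
    lem₁ = solve-∀

  N-ratio′ : ∀ k t → + suc t *ᶻ N (suc k) (suc t) ≡ (+ k +ᶻ + t +ᶻ 1ℤ) *ᶻ N (suc k) t
  N-ratio′ k t = begin
    + suc t *ᶻ N (suc k) (suc t)                              ≡⟨ cong (+ suc t *ᶻ_) (N-suc-suc k t) ⟩
    + suc t *ᶻ (N k (suc t) +ᶻ N (suc k) t)                 
      ≡⟨ ℤₚ.*-distribˡ-+ (+ suc t) (N k (suc t)) _ ⟩
    + suc t *ᶻ N k (suc t) +ᶻ + suc t *ᶻ N (suc k) t        
      ≡⟨ cong (_+ᶻ + suc t *ᶻ N (suc k) t) (N-ratio k t) ⟩
    + k *ᶻ N (suc k) t +ᶻ + suc t *ᶻ N (suc k) t              ≡⟨ lemma (+ k) (+ t) (N (suc k) t) ⟩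
    (+ k +ᶻ + t +ᶻ 1ℤ) *ᶻ N (suc k) t                         ∎
    where
    open ≡-Reasoning
    lemma : ∀ k t n → k *ᶻ n +ᶻ (1ℤ +ᶻ t) *ᶻ n ≡ (k +ᶻ t +ᶻ 1ℤ) *ᶻ n
    lemma = solve-∀

-- The ring solver does not unfold these, so they are written out in the identities passed to it.
polyS polyS² polySʷ polySS : ℤ → ℤ → ℤ
polyS  k t = t *ᶻ (k +ᶻ 1ℤ)
polyS² k t = t *ᶻ (+ 2 *ᶻ (t -ᶻ 1ℤ) *ᶻ (k +ᶻ + 2) +ᶻ + 3 *ᶻ (k +ᶻ 1ℤ))
polySʷ k t = t *ᶻ ((k +ᶻ 1ℤ) *ᶻ (+ 2 *ᶻ k +ᶻ 1ℤ))
polySS k t = t *ᶻ (+ 3 *ᶻ (t -ᶻ 1ℤ) *ᶻ k *ᶻ (k +ᶻ 1ℤ) +ᶻ + 2 *ᶻ (t -ᶻ 1ℤ) *ᶻ (+ 2 *ᶻ k +ᶻ 1ℤ)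
                    +ᶻ + 2 *ᶻ (k +ᶻ 1ℤ) *ᶻ (+ 2 *ᶻ k +ᶻ 1ℤ))

total-+* : ∀ F G (c : ℕ → ℤ) k t →
  total (λ k z → F k z +ᶻ c k *ᶻ G k z) k t ≡ total F k t +ᶻ c k *ᶻ total G k t
total-+* F G c k t =
  trans (∑∈-+ (compositions k t) (F k) (λ z → c k *ᶻ G k z))
        (cong (total F k t +ᶻ_) (∑∈-*ˡ (compositions k t) (c k) (G k)))

total-+** : ∀ F G H (c d : ℕ → ℤ) k t →
  total (λ k z → F k z +ᶻ (c k *ᶻ G k z +ᶻ d k *ᶻ H k z)) k t
    ≡ total F k t +ᶻ (c k *ᶻ total G k t +ᶻ d k *ᶻ total H k t)
total-+** F G H c d k t =
  trans (∑∈-+ (compositions k t) (F k) (λ z → c k *ᶻ G k z +ᶻ d k *ᶻ H k z))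
    (cong (total F k t +ᶻ_)
      (trans (∑∈-+ (compositions k t) (λ z → c k *ᶻ G k z) (λ z → d k *ᶻ H k z))
        (cong₂ _+ᶻ_ (∑∈-*ˡ (compositions k t) (c k) (G k)) (∑∈-*ˡ (compositions k t) (d k) (H k)))))

total-S-0 : ∀ k → total S k 0 ≡ 0ℤ
total-S-0 zero    = refl
total-S-0 (suc k) = trans (total-suc-zero S S k (S-0∷ k)) (total-S-0 k)

total-S²-0 : ∀ k → total S² k 0 ≡ 0ℤ
total-S²-0 zero    = refl
total-S²-0 (suc k) = trans (total-suc-zero S² S² k (S²-0∷ k)) (total-S²-0 k)

total-Sʷ-0 : ∀ k → total Sʷ k 0 ≡ 0ℤ
total-Sʷ-0 zero    = refl
total-Sʷ-0 (suc k) =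
  trans (total-suc-zero Sʷ (λ k z → Sʷ k z +ᶻ S k z) k (Sʷ-0∷ k))
    (trans (∑∈-+ (compositions k 0) (Sʷ k) (S k)) (cong₂ _+ᶻ_ (total-Sʷ-0 k) (total-S-0 k)))

total-SS-0 : ∀ k → total SS k 0 ≡ 0ℤ
total-SS-0 zero    = refl
total-SS-0 (suc k) = trans (total-suc-zero SS SS k (SS-0∷ k)) (total-SS-0 k)

total-S-suc : ∀ k t →
  total S (suc k) (suc t) ≡ total S k (suc t) +ᶻ (total S (suc k) t +ᶻ + suc k *ᶻ N (suc k) t)
total-S-suc k t =
  trans (total-suc-suc S S (λ k z → S k z +ᶻ + k *ᶻ ones k z) k t (S-0∷ k) (S-suc (suc k)))
        (cong (total S k (suc t) +ᶻ_) (total-+* S ones +_ (suc k) t))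

total-S²-suc : ∀ k t → total S² (suc k) (suc t)
  ≡ total S² k (suc t) +ᶻ (total S² (suc k) t +ᶻ (+ 2 *ᶻ total S (suc k) t +ᶻ + suc k *ᶻ N (suc k) t))
total-S²-suc k t =
  trans (total-suc-suc S² S² (λ k z → S² k z +ᶻ (+ 2 *ᶻ S k z +ᶻ + k *ᶻ ones k z)) k t
          (S²-0∷ k) (S²-suc (suc k)))
        (cong (total S² k (suc t) +ᶻ_) (total-+** S² S ones (λ _ → + 2) +_ (suc k) t))

total-Sʷ-suc : ∀ k t → total Sʷ (suc k) (suc t)
  ≡ total Sʷ k (suc t) +ᶻ total S k (suc t) +ᶻ (total Sʷ (suc k) t +ᶻ Δ (suc (suc k)) *ᶻ N (suc k) t)
total-Sʷ-suc k t =
  trans (total-suc-suc Sʷ (λ k z → Sʷ k z +ᶻ S k z) (λ k z → Sʷ k z +ᶻ Δ (suc k) *ᶻ ones k z) k t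
          (Sʷ-0∷ k) (Sʷ-suc (suc k)))
        (cong₂ _+ᶻ_ (∑∈-+ (compositions k (suc t)) (Sʷ k) (S k))
                    (total-+* Sʷ ones (λ k → Δ (suc k)) (suc k) t))

total-SS-suc : ∀ k t → total SS (suc k) (suc t)
  ≡ total SS k (suc t) +ᶻ (total SS (suc k) t
      +ᶻ (+ 2 *ᶻ + suc k *ᶻ total S (suc k) t +ᶻ + suc k *ᶻ + suc k *ᶻ N (suc k) t))
total-SS-suc k t =
  trans (total-suc-suc SS SS (λ k z → SS k z +ᶻ (+ 2 *ᶻ + k *ᶻ S k z +ᶻ + k *ᶻ + k *ᶻ ones k z)) k t
          (SS-0∷ k) (SS-suc (suc k)))
        (cong (total SS k (suc t) +ᶻ_)
              (total-+** SS S ones (λ k → + 2 *ᶻ + k) (λ k → + k *ᶻ + k) (suc k) t))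

-- With `N k (suc t)` and `N (suc k) t` as independent variables the inductive steps for the moments
-- are false as polynomial identities. They hold modulo the relation `N-ratio`; `q` is the multiple
-- of it that has to be added, found by comparing the coefficients of either variable.
balance : ∀ k t q p →
  (N k (suc t) +ᶻ N (suc k) t) *ᶻ p +ᶻ q *ᶻ (+ k *ᶻ N (suc k) t -ᶻ + suc t *ᶻ N k (suc t))
    ≡ N (suc k) (suc t) *ᶻ p
balance k t q p = begin
  (N k (suc t) +ᶻ N (suc k) t) *ᶻ p +ᶻ q *ᶻ (+ k *ᶻ N (suc k) t -ᶻ + suc t *ᶻ N k (suc t))
    ≡⟨ cong₂ (λ a b → a *ᶻ p +ᶻ q *ᶻ (+ k *ᶻ N (suc k) t -ᶻ b)) (sym (N-suc-suc k t)) (N-ratio k t) ⟩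
  N (suc k) (suc t) *ᶻ p +ᶻ q *ᶻ (+ k *ᶻ N (suc k) t -ᶻ + k *ᶻ N (suc k) t)
    ≡⟨ lemma (N (suc k) (suc t) *ᶻ p) q (+ k *ᶻ N (suc k) t) ⟩
  N (suc k) (suc t) *ᶻ p ∎
  where
  open ≡-Reasoning
  lemma : ∀ a q b → a +ᶻ q *ᶻ (b -ᶻ b) ≡ a
  lemma = solve-∀

-- By symmetry of the parts, the sum of the first `i` of them has mean `i t / k`; summing over `i`
-- gives the mean `t (k + 1) / 2`.
moment-S : ∀ k t → + 2 *ᶻ total S k t ≡ N k t *ᶻ polyS (+ k) (+ t)
moment-S k       zero    = trans (cong (+ 2 *ᶻ_) (total-S-0 k)) (sym (ℤₚ.*-zeroʳ (N k 0)))
moment-S zero    (suc t) = refl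
moment-S (suc k) (suc t) = begin
  + 2 *ᶻ total S (suc k) (suc t)
    ≡⟨ cong (+ 2 *ᶻ_) (total-S-suc k t) ⟩
  + 2 *ᶻ (total S k (suc t) +ᶻ (total S (suc k) t +ᶻ + suc k *ᶻ n₁))
    ≡⟨ lem₁ (total S k (suc t)) (total S (suc k) t) (+ k) n₁ ⟩
  + 2 *ᶻ total S k (suc t) +ᶻ + 2 *ᶻ total S (suc k) t +ᶻ + 2 *ᶻ (+ suc k *ᶻ n₁)
    ≡⟨ cong₂ (λ a b → a +ᶻ b +ᶻ + 2 *ᶻ (+ suc k *ᶻ n₁)) (moment-S k (suc t)) (moment-S (suc k) t) ⟩
  n₀ *ᶻ polyS (+ k) (+ suc t) +ᶻ n₁ *ᶻ polyS (+ suc k) (+ t) +ᶻ + 2 *ᶻ (+ suc k *ᶻ n₁)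
    ≡⟨ lem₂ (+ k) (+ t) n₀ n₁ ⟩
  (n₀ +ᶻ n₁) *ᶻ polyS (+ suc k) (+ suc t) +ᶻ 1ℤ *ᶻ (+ k *ᶻ n₁ -ᶻ + suc t *ᶻ n₀)
    ≡⟨ balance k t 1ℤ (polyS (+ suc k) (+ suc t)) ⟩
  N (suc k) (suc t) *ᶻ polyS (+ suc k) (+ suc t) ∎
  where
  open ≡-Reasoning
  n₀ = N k (suc t)
  n₁ = N (suc k) t
  lem₁ : ∀ a b k n → + 2 *ᶻ (a +ᶻ (b +ᶻ (1ℤ +ᶻ k) *ᶻ n)) ≡ + 2 *ᶻ a +ᶻ + 2 *ᶻ b +ᶻ + 2 *ᶻ ((1ℤ +ᶻ k) *ᶻ n)
  lem₁ = solve-∀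
  lem₂ : ∀ k t n₀ n₁ →
    n₀ *ᶻ ((1ℤ +ᶻ t) *ᶻ (k +ᶻ 1ℤ)) +ᶻ n₁ *ᶻ (t *ᶻ ((1ℤ +ᶻ k) +ᶻ 1ℤ)) +ᶻ + 2 *ᶻ ((1ℤ +ᶻ k) *ᶻ n₁)
      ≡ (n₀ +ᶻ n₁) *ᶻ ((1ℤ +ᶻ t) *ᶻ ((1ℤ +ᶻ k) +ᶻ 1ℤ)) +ᶻ 1ℤ *ᶻ (k *ᶻ n₁ -ᶻ (1ℤ +ᶻ t) *ᶻ n₀)
  lem₂ = solve-∀

-- If `x` is the sum of the first `i` parts, then `x (x - 1)` has mean
-- `t (t - 1) i (i + 1) / (k (k + 1))`. Summed over `i` this is `t (t - 1) (k + 2) / 3`, and adding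
-- the mean of `S` gives the polynomial. The induction only verifies it.
moment-S² : ∀ k t → + 6 *ᶻ total S² k t ≡ N k t *ᶻ polyS² (+ k) (+ t)
moment-S² k       zero    = trans (cong (+ 6 *ᶻ_) (total-S²-0 k)) (sym (ℤₚ.*-zeroʳ (N k 0)))
moment-S² zero    (suc t) = refl
moment-S² (suc k) (suc t) = begin
  + 6 *ᶻ total S² (suc k) (suc t)
    ≡⟨ cong (+ 6 *ᶻ_) (total-S²-suc k t) ⟩
  + 6 *ᶻ (total S² k (suc t) +ᶻ (total S² (suc k) t +ᶻ (+ 2 *ᶻ total S (suc k) t +ᶻ + suc k *ᶻ n₁)))
    ≡⟨ lem₁ (total S² k (suc t)) (total S² (suc k) t) (total S (suc k) t) (+ suc k *ᶻ n₁) ⟩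
  + 6 *ᶻ total S² k (suc t) +ᶻ + 6 *ᶻ total S² (suc k) t
    +ᶻ (+ 6 *ᶻ (+ 2 *ᶻ total S (suc k) t) +ᶻ + 6 *ᶻ (+ suc k *ᶻ n₁))
    ≡⟨ cong₂ (λ a b → a +ᶻ (+ 6 *ᶻ b +ᶻ + 6 *ᶻ (+ suc k *ᶻ n₁)))
         (cong₂ _+ᶻ_ (moment-S² k (suc t)) (moment-S² (suc k) t)) (moment-S (suc k) t) ⟩
  n₀ *ᶻ polyS² (+ k) (+ suc t) +ᶻ n₁ *ᶻ polyS² (+ suc k) (+ t)
    +ᶻ (+ 6 *ᶻ (n₁ *ᶻ polyS (+ suc k) (+ t)) +ᶻ + 6 *ᶻ (+ suc k *ᶻ n₁))
    ≡⟨ lem₂ (+ k) (+ t) n₀ n₁ ⟩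
  (n₀ +ᶻ n₁) *ᶻ polyS² (+ suc k) (+ suc t)
    +ᶻ (+ 2 *ᶻ + t +ᶻ + 3) *ᶻ (+ k *ᶻ n₁ -ᶻ + suc t *ᶻ n₀)
    ≡⟨ balance k t (+ 2 *ᶻ + t +ᶻ + 3) (polyS² (+ suc k) (+ suc t)) ⟩
  N (suc k) (suc t) *ᶻ polyS² (+ suc k) (+ suc t) ∎
  where
  open ≡-Reasoning
  n₀ = N k (suc t)
  n₁ = N (suc k) t
  lem₁ : ∀ a b c d → + 6 *ᶻ (a +ᶻ (b +ᶻ (+ 2 *ᶻ c +ᶻ d)))
    ≡ + 6 *ᶻ a +ᶻ + 6 *ᶻ b +ᶻ (+ 6 *ᶻ (+ 2 *ᶻ c) +ᶻ + 6 *ᶻ d)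
  lem₁ = solve-∀
  lem₂ : ∀ k t n₀ n₁ →
    n₀ *ᶻ ((1ℤ +ᶻ t) *ᶻ (+ 2 *ᶻ ((1ℤ +ᶻ t) -ᶻ 1ℤ) *ᶻ (k +ᶻ + 2) +ᶻ + 3 *ᶻ (k +ᶻ 1ℤ)))
      +ᶻ n₁ *ᶻ (t *ᶻ (+ 2 *ᶻ (t -ᶻ 1ℤ) *ᶻ ((1ℤ +ᶻ k) +ᶻ + 2) +ᶻ + 3 *ᶻ ((1ℤ +ᶻ k) +ᶻ 1ℤ)))
      +ᶻ (+ 6 *ᶻ (n₁ *ᶻ (t *ᶻ ((1ℤ +ᶻ k) +ᶻ 1ℤ))) +ᶻ + 6 *ᶻ ((1ℤ +ᶻ k) *ᶻ n₁))
      ≡ (n₀ +ᶻ n₁) *ᶻ ((1ℤ +ᶻ t) *ᶻ (+ 2 *ᶻ ((1ℤ +ᶻ t) -ᶻ 1ℤ) *ᶻ ((1ℤ +ᶻ k) +ᶻ + 2)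
            +ᶻ + 3 *ᶻ ((1ℤ +ᶻ k) +ᶻ 1ℤ)))
        +ᶻ (+ 2 *ᶻ t +ᶻ + 3) *ᶻ (k *ᶻ n₁ -ᶻ (1ℤ +ᶻ t) *ᶻ n₀)
  lem₂ = solve-∀

-- The means `i t / k` weighted by `i` lead to the sum of squares, hence the factor
-- `(k + 1) (2 k + 1)`.
moment-Sʷ : ∀ k t → + 6 *ᶻ total Sʷ k t ≡ N k t *ᶻ polySʷ (+ k) (+ t)
moment-Sʷ k       zero    = trans (cong (+ 6 *ᶻ_) (total-Sʷ-0 k)) (sym (ℤₚ.*-zeroʳ (N k 0)))
moment-Sʷ zero    (suc t) = refl
moment-Sʷ (suc k) (suc t) = begin
  + 6 *ᶻ total Sʷ (suc k) (suc t)
    ≡⟨ cong (+ 6 *ᶻ_) (total-Sʷ-suc k t) ⟩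
  + 6 *ᶻ (total Sʷ k (suc t) +ᶻ total S k (suc t) +ᶻ (total Sʷ (suc k) t +ᶻ Δ (suc (suc k)) *ᶻ n₁))
    ≡⟨ lem₁ (total Sʷ k (suc t)) (total S k (suc t)) (total Sʷ (suc k) t) (Δ (suc (suc k))) n₁ ⟩
  + 6 *ᶻ total Sʷ k (suc t) +ᶻ + 6 *ᶻ total Sʷ (suc k) t
    +ᶻ (+ 3 *ᶻ (+ 2 *ᶻ total S k (suc t)) +ᶻ + 3 *ᶻ (+ 2 *ᶻ Δ (suc (suc k)) *ᶻ n₁))
    ≡⟨ cong₂ _+ᶻ_ (cong₂ _+ᶻ_ (moment-Sʷ k (suc t)) (moment-Sʷ (suc k) t))
         (cong₂ (λ a b → + 3 *ᶻ a +ᶻ + 3 *ᶻ (b *ᶻ n₁)) (moment-S k (suc t)) (2Δ (suc (suc k)))) ⟩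
  n₀ *ᶻ polySʷ (+ k) (+ suc t) +ᶻ n₁ *ᶻ polySʷ (+ suc k) (+ t)
    +ᶻ (+ 3 *ᶻ (n₀ *ᶻ polyS (+ k) (+ suc t))
        +ᶻ + 3 *ᶻ (+ suc (suc k) *ᶻ (+ suc (suc k) -ᶻ 1ℤ) *ᶻ n₁))
    -- The cofactor equals `k + 2`. Its part `- 3 (k + 1)` offsets the extra summand
    -- `total S k (suc t)` of this recursion.
    ≡⟨ lem₂ (+ k) (+ t) n₀ n₁ ⟩
  (n₀ +ᶻ n₁) *ᶻ polySʷ (+ suc k) (+ suc t)
    +ᶻ (+ 4 *ᶻ + k +ᶻ + 5 -ᶻ + 3 *ᶻ (+ k +ᶻ 1ℤ)) *ᶻ (+ k *ᶻ n₁ -ᶻ + suc t *ᶻ n₀)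
    ≡⟨ balance k t (+ 4 *ᶻ + k +ᶻ + 5 -ᶻ + 3 *ᶻ (+ k +ᶻ 1ℤ)) (polySʷ (+ suc k) (+ suc t)) ⟩
  N (suc k) (suc t) *ᶻ polySʷ (+ suc k) (+ suc t) ∎
  where
  open ≡-Reasoning
  n₀ = N k (suc t)
  n₁ = N (suc k) t
  lem₁ : ∀ a b c d n → + 6 *ᶻ (a +ᶻ b +ᶻ (c +ᶻ d *ᶻ n))
    ≡ + 6 *ᶻ a +ᶻ + 6 *ᶻ c +ᶻ (+ 3 *ᶻ (+ 2 *ᶻ b) +ᶻ + 3 *ᶻ (+ 2 *ᶻ d *ᶻ n))
  lem₁ = solve-∀
  lem₂ : ∀ k t n₀ n₁ →
    n₀ *ᶻ ((1ℤ +ᶻ t) *ᶻ ((k +ᶻ 1ℤ) *ᶻ (+ 2 *ᶻ k +ᶻ 1ℤ)))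
      +ᶻ n₁ *ᶻ (t *ᶻ (((1ℤ +ᶻ k) +ᶻ 1ℤ) *ᶻ (+ 2 *ᶻ (1ℤ +ᶻ k) +ᶻ 1ℤ)))
      +ᶻ (+ 3 *ᶻ (n₀ *ᶻ ((1ℤ +ᶻ t) *ᶻ (k +ᶻ 1ℤ)))
          +ᶻ + 3 *ᶻ ((1ℤ +ᶻ (1ℤ +ᶻ k)) *ᶻ (1ℤ +ᶻ (1ℤ +ᶻ k) -ᶻ 1ℤ) *ᶻ n₁))
      ≡ (n₀ +ᶻ n₁) *ᶻ ((1ℤ +ᶻ t) *ᶻ (((1ℤ +ᶻ k) +ᶻ 1ℤ) *ᶻ (+ 2 *ᶻ (1ℤ +ᶻ k) +ᶻ 1ℤ)))
        +ᶻ (+ 4 *ᶻ k +ᶻ + 5 -ᶻ + 3 *ᶻ (k +ᶻ 1ℤ)) *ᶻ (k *ᶻ n₁ -ᶻ (1ℤ +ᶻ t) *ᶻ n₀)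
  lem₂ = solve-∀

-- `S` is the sum of the parts with weights `k, …, 1`. A product of two distinct parts has mean
-- `t (t - 1) / (k (k + 1))` and the square of a part has mean twice that plus `t / k`, so the mean
-- is assembled from the squared sum of the weights and the sum of their squares.
moment-SS : ∀ k t → + 12 *ᶻ total SS k t ≡ N k t *ᶻ polySS (+ k) (+ t)
moment-SS k       zero    = trans (cong (+ 12 *ᶻ_) (total-SS-0 k)) (sym (ℤₚ.*-zeroʳ (N k 0)))
moment-SS zero    (suc t) = refl
moment-SS (suc k) (suc t) = begin
  + 12 *ᶻ total SS (suc k) (suc t)
    ≡⟨ cong (+ 12 *ᶻ_) (total-SS-suc k t) ⟩
  + 12 *ᶻ (total SS k (suc t) +ᶻ (total SS (suc k) t
    +ᶻ (+ 2 *ᶻ + suc k *ᶻ total S (suc k) t +ᶻ + suc k *ᶻ + suc k *ᶻ n₁)))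
    ≡⟨ lem₁ (total SS k (suc t)) (total SS (suc k) t) (total S (suc k) t) (+ suc k) n₁ ⟩
  + 12 *ᶻ total SS k (suc t) +ᶻ + 12 *ᶻ total SS (suc k) t
    +ᶻ (+ 12 *ᶻ + suc k *ᶻ (+ 2 *ᶻ total S (suc k) t) +ᶻ + 12 *ᶻ (+ suc k *ᶻ + suc k *ᶻ n₁))
    ≡⟨ cong₂ (λ a b → a +ᶻ (+ 12 *ᶻ + suc k *ᶻ b +ᶻ + 12 *ᶻ (+ suc k *ᶻ + suc k *ᶻ n₁)))
         (cong₂ _+ᶻ_ (moment-SS k (suc t)) (moment-SS (suc k) t)) (moment-S (suc k) t) ⟩
  n₀ *ᶻ polySS (+ k) (+ suc t) +ᶻ n₁ *ᶻ polySS (+ suc k) (+ t)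
    +ᶻ (+ 12 *ᶻ + suc k *ᶻ (n₁ *ᶻ polyS (+ suc k) (+ t)) +ᶻ + 12 *ᶻ (+ suc k *ᶻ + suc k *ᶻ n₁))
    ≡⟨ lem₂ (+ k) (+ t) n₀ n₁ ⟩
  (n₀ +ᶻ n₁) *ᶻ polySS (+ suc k) (+ suc t)
    +ᶻ (+ 6 *ᶻ + t *ᶻ (+ k +ᶻ 1ℤ) +ᶻ + 4 *ᶻ + t +ᶻ + 8 *ᶻ + k +ᶻ + 10)
      *ᶻ (+ k *ᶻ n₁ -ᶻ + suc t *ᶻ n₀)
    ≡⟨ balance k t (+ 6 *ᶻ + t *ᶻ (+ k +ᶻ 1ℤ) +ᶻ + 4 *ᶻ + t +ᶻ + 8 *ᶻ + k +ᶻ + 10)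
         (polySS (+ suc k) (+ suc t)) ⟩
  N (suc k) (suc t) *ᶻ polySS (+ suc k) (+ suc t) ∎
  where
  open ≡-Reasoning
  n₀ = N k (suc t)
  n₁ = N (suc k) t
  lem₁ : ∀ a b c k n → + 12 *ᶻ (a +ᶻ (b +ᶻ (+ 2 *ᶻ k *ᶻ c +ᶻ k *ᶻ k *ᶻ n)))
    ≡ + 12 *ᶻ a +ᶻ + 12 *ᶻ b +ᶻ (+ 12 *ᶻ k *ᶻ (+ 2 *ᶻ c) +ᶻ + 12 *ᶻ (k *ᶻ k *ᶻ n))
  lem₁ = solve-∀
  lem₂ : ∀ k t n₀ n₁ →
    n₀ *ᶻ ((1ℤ +ᶻ t) *ᶻ (+ 3 *ᶻ ((1ℤ +ᶻ t) -ᶻ 1ℤ) *ᶻ k *ᶻ (k +ᶻ 1ℤ)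
          +ᶻ + 2 *ᶻ ((1ℤ +ᶻ t) -ᶻ 1ℤ) *ᶻ (+ 2 *ᶻ k +ᶻ 1ℤ)
          +ᶻ + 2 *ᶻ (k +ᶻ 1ℤ) *ᶻ (+ 2 *ᶻ k +ᶻ 1ℤ)))
      +ᶻ n₁ *ᶻ (t *ᶻ (+ 3 *ᶻ (t -ᶻ 1ℤ) *ᶻ (1ℤ +ᶻ k) *ᶻ ((1ℤ +ᶻ k) +ᶻ 1ℤ)
            +ᶻ + 2 *ᶻ (t -ᶻ 1ℤ) *ᶻ (+ 2 *ᶻ (1ℤ +ᶻ k) +ᶻ 1ℤ)
            +ᶻ + 2 *ᶻ ((1ℤ +ᶻ k) +ᶻ 1ℤ) *ᶻ (+ 2 *ᶻ (1ℤ +ᶻ k) +ᶻ 1ℤ)))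
      +ᶻ (+ 12 *ᶻ (1ℤ +ᶻ k) *ᶻ (n₁ *ᶻ (t *ᶻ ((1ℤ +ᶻ k) +ᶻ 1ℤ)))
          +ᶻ + 12 *ᶻ ((1ℤ +ᶻ k) *ᶻ (1ℤ +ᶻ k) *ᶻ n₁))
      ≡ (n₀ +ᶻ n₁) *ᶻ ((1ℤ +ᶻ t) *ᶻ (+ 3 *ᶻ ((1ℤ +ᶻ t) -ᶻ 1ℤ) *ᶻ (1ℤ +ᶻ k) *ᶻ ((1ℤ +ᶻ k) +ᶻ 1ℤ)
            +ᶻ + 2 *ᶻ ((1ℤ +ᶻ t) -ᶻ 1ℤ) *ᶻ (+ 2 *ᶻ (1ℤ +ᶻ k) +ᶻ 1ℤ)
            +ᶻ + 2 *ᶻ ((1ℤ +ᶻ k) +ᶻ 1ℤ) *ᶻ (+ 2 *ᶻ (1ℤ +ᶻ k) +ᶻ 1ℤ)))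
        +ᶻ (+ 6 *ᶻ t *ᶻ (k +ᶻ 1ℤ) +ᶻ + 4 *ᶻ t +ᶻ + 8 *ᶻ k +ᶻ + 10)
          *ᶻ (k *ᶻ n₁ -ᶻ (1ℤ +ᶻ t) *ᶻ n₀)
  lem₂ = solve-∀

-- Rotation invariance

-- The sequence `a` attached to `z`, with values in the integers so that it makes sense for every
-- rotation.
height : List ℕ → ℕ → ℤ
height z r = + r -ᶻ + partialSum z r

-- Twice the sum of the beads minus `m (m - 1)`, where `m = ∑ s a` is their number: the column of
-- residue `r` sums to `r a + s a (a - 1) / 2`. For negative `a r` this is the signed count relative
-- to the bead set of all negative integers.
twiceSize : ℕ → (ℕ → ℤ) → ℤ
twiceSize s a = + s *ᶻ ∑ s (λ r → a r *ᶻ a r -ᶻ a r) +ᶻ + 2 *ᶻ ∑ s (λ r → + r *ᶻ a r)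
                -ᶻ ∑ s a *ᶻ (∑ s a -ᶻ 1ℤ)

-- Passing from `a` to `a (r + 1) - c` translates the bead set by `-1 - c s`, and `a s = a 0 - 1`
-- makes the column that wraps around fit.
twiceSize-shift : ∀ s c (a : ℕ → ℤ) → a 0 ≡ 0ℤ → a s ≡ -1ℤ →
  twiceSize s (λ r → a (suc r) -ᶻ c) ≡ twiceSize s a
twiceSize-shift s c a a0≡0 as≡-1 = begin
  + s *ᶻ ∑ s (λ r → a′ r *ᶻ a′ r -ᶻ a′ r) +ᶻ + 2 *ᶻ ∑ s (λ r → + r *ᶻ a′ r) -ᶻ ∑ s a′ *ᶻ (∑ s a′ -ᶻ 1ℤ)
    ≡⟨ cong₂ (λ x y → + s *ᶻ x +ᶻ + 2 *ᶻ y -ᶻ ∑ s a′ *ᶻ (∑ s a′ -ᶻ 1ℤ)) eqB eqR ⟩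
  + s *ᶻ (B +ᶻ + 2 -ᶻ + 2 *ᶻ c *ᶻ (A -ᶻ 1ℤ) +ᶻ + s *ᶻ (c *ᶻ c +ᶻ c))
    +ᶻ + 2 *ᶻ (R -ᶻ + s -ᶻ (A -ᶻ 1ℤ) -ᶻ c *ᶻ Δ s) -ᶻ ∑ s a′ *ᶻ (∑ s a′ -ᶻ 1ℤ)
    ≡⟨ cong (λ x → + s *ᶻ (B +ᶻ + 2 -ᶻ + 2 *ᶻ c *ᶻ (A -ᶻ 1ℤ) +ᶻ + s *ᶻ (c *ᶻ c +ᶻ c))
    +ᶻ + 2 *ᶻ (R -ᶻ + s -ᶻ (A -ᶻ 1ℤ) -ᶻ c *ᶻ Δ s) -ᶻ x *ᶻ (x -ᶻ 1ℤ)) eqA ⟩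
  + s *ᶻ (B +ᶻ + 2 -ᶻ + 2 *ᶻ c *ᶻ (A -ᶻ 1ℤ) +ᶻ + s *ᶻ (c *ᶻ c +ᶻ c))
    +ᶻ + 2 *ᶻ (R -ᶻ + s -ᶻ (A -ᶻ 1ℤ) -ᶻ c *ᶻ Δ s) -ᶻ (A -ᶻ 1ℤ -ᶻ + s *ᶻ c) *ᶻ (A -ᶻ 1ℤ -ᶻ + s *ᶻ c -ᶻ 1ℤ)
    -- The terms quadratic in `c` cancel. Those linear in `c` carry the factor `s (s - 1) - 2 Δ s`,
    -- which vanishes because `Δ s` is the sum of the residues.
    ≡⟨ lem₁ (+ s) A B R c (Δ s) ⟩
  + s *ᶻ B +ᶻ + 2 *ᶻ R -ᶻ A *ᶻ (A -ᶻ 1ℤ) +ᶻ c *ᶻ (+ s *ᶻ (+ s -ᶻ 1ℤ) -ᶻ + 2 *ᶻ Δ s)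
    ≡⟨ cong (λ x → + s *ᶻ B +ᶻ + 2 *ᶻ R -ᶻ A *ᶻ (A -ᶻ 1ℤ) +ᶻ c *ᶻ (+ s *ᶻ (+ s -ᶻ 1ℤ) -ᶻ x)) (2Δ s) ⟩
  + s *ᶻ B +ᶻ + 2 *ᶻ R -ᶻ A *ᶻ (A -ᶻ 1ℤ) +ᶻ c *ᶻ (+ s *ᶻ (+ s -ᶻ 1ℤ) -ᶻ + s *ᶻ (+ s -ᶻ 1ℤ))
    ≡⟨ lem₂ (+ s *ᶻ B +ᶻ + 2 *ᶻ R -ᶻ A *ᶻ (A -ᶻ 1ℤ)) c (+ s *ᶻ (+ s -ᶻ 1ℤ)) ⟩
  + s *ᶻ B +ᶻ + 2 *ᶻ R -ᶻ A *ᶻ (A -ᶻ 1ℤ) ∎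
  where
  open ≡-Reasoning
  a′ : ℕ → ℤ
  a′ r = a (suc r) -ᶻ c
  q : ℕ → ℤ
  q r = a r *ᶻ a r -ᶻ a r
  A = ∑ s a
  B = ∑ s q
  R = ∑ s (λ r → + r *ᶻ a r)
  shiftA : ∑ s (λ r → a (suc r)) ≡ A -ᶻ 1ℤ
  shiftA = trans (∑-shift s a) (trans (cong₂ (λ x y → A -ᶻ x +ᶻ y) a0≡0 as≡-1) (lemma A))
    where
    lemma : ∀ a → a -ᶻ 0ℤ +ᶻ -1ℤ ≡ a -ᶻ 1ℤ
    lemma = solve-∀
  shiftB : ∑ s (λ r → q (suc r)) ≡ B +ᶻ + 2
  shiftB = trans (∑-shift s q)
    (trans (cong₂ (λ x y → B -ᶻ (x *ᶻ x -ᶻ x) +ᶻ (y *ᶻ y -ᶻ y)) a0≡0 as≡-1) (lemma B))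
    where
    lemma : ∀ a → a -ᶻ (0ℤ *ᶻ 0ℤ -ᶻ 0ℤ) +ᶻ (-1ℤ *ᶻ -1ℤ -ᶻ -1ℤ) ≡ a +ᶻ + 2
    lemma = solve-∀
  shiftR : ∑ s (λ r → + suc r *ᶻ a (suc r)) ≡ R -ᶻ + s
  shiftR = trans (∑-shift s (λ r → + r *ᶻ a r))
    (trans (cong₂ (λ x y → R -ᶻ 0ℤ *ᶻ x +ᶻ + s *ᶻ y) a0≡0 as≡-1) (lemma R (+ s)))
    where
    lemma : ∀ a s → a -ᶻ 0ℤ *ᶻ 0ℤ +ᶻ s *ᶻ -1ℤ ≡ a -ᶻ s
    lemma = solve-∀
  eqA : ∑ s a′ ≡ A -ᶻ 1ℤ -ᶻ + s *ᶻ c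
  eqA = trans (∑-- s (λ r → a (suc r)) (λ _ → c)) (cong₂ _-ᶻ_ shiftA (∑-const s c))
  eqB : ∑ s (λ r → a′ r *ᶻ a′ r -ᶻ a′ r)
    ≡ B +ᶻ + 2 -ᶻ + 2 *ᶻ c *ᶻ (A -ᶻ 1ℤ) +ᶻ + s *ᶻ (c *ᶻ c +ᶻ c)
  eqB = begin
    ∑ s (λ r → a′ r *ᶻ a′ r -ᶻ a′ r)
      ≡⟨ ∑-cong s (λ r _ → lemma (a (suc r)) c) ⟩
    ∑ s (λ r → q (suc r) -ᶻ + 2 *ᶻ c *ᶻ a (suc r) +ᶻ (c *ᶻ c +ᶻ c))
      ≡⟨ ∑-+ s (λ r → q (suc r) -ᶻ + 2 *ᶻ c *ᶻ a (suc r)) (λ _ → c *ᶻ c +ᶻ c) ⟩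
    ∑ s (λ r → q (suc r) -ᶻ + 2 *ᶻ c *ᶻ a (suc r)) +ᶻ ∑ s (λ _ → c *ᶻ c +ᶻ c)
      ≡⟨ cong₂ _+ᶻ_ (∑-- s (λ r → q (suc r)) (λ r → + 2 *ᶻ c *ᶻ a (suc r))) (∑-const s (c *ᶻ c +ᶻ c)) ⟩
    ∑ s (λ r → q (suc r)) -ᶻ ∑ s (λ r → + 2 *ᶻ c *ᶻ a (suc r)) +ᶻ + s *ᶻ (c *ᶻ c +ᶻ c)
      ≡⟨ cong₂ (λ x y → x -ᶻ y +ᶻ + s *ᶻ (c *ᶻ c +ᶻ c)) shiftB
           (trans (∑-*ˡ s (+ 2 *ᶻ c) (λ r → a (suc r))) (cong (+ 2 *ᶻ c *ᶻ_) shiftA)) ⟩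
    B +ᶻ + 2 -ᶻ + 2 *ᶻ c *ᶻ (A -ᶻ 1ℤ) +ᶻ + s *ᶻ (c *ᶻ c +ᶻ c) ∎
    where
    lemma : ∀ a c → (a -ᶻ c) *ᶻ (a -ᶻ c) -ᶻ (a -ᶻ c) ≡ a *ᶻ a -ᶻ a -ᶻ + 2 *ᶻ c *ᶻ a +ᶻ (c *ᶻ c +ᶻ c)
    lemma = solve-∀
  eqR : ∑ s (λ r → + r *ᶻ a′ r) ≡ R -ᶻ + s -ᶻ (A -ᶻ 1ℤ) -ᶻ c *ᶻ Δ s
  eqR = begin
    ∑ s (λ r → + r *ᶻ a′ r)
      ≡⟨ ∑-cong s (λ r _ → lemma (+ r) (a (suc r)) c) ⟩
    ∑ s (λ r → + suc r *ᶻ a (suc r) -ᶻ a (suc r) -ᶻ c *ᶻ + r)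
      ≡⟨ ∑-- s (λ r → + suc r *ᶻ a (suc r) -ᶻ a (suc r)) (λ r → c *ᶻ + r) ⟩
    ∑ s (λ r → + suc r *ᶻ a (suc r) -ᶻ a (suc r)) -ᶻ ∑ s (λ r → c *ᶻ + r)
      ≡⟨ cong₂ _-ᶻ_ (trans (∑-- s (λ r → + suc r *ᶻ a (suc r)) (λ r → a (suc r))) (cong₂ _-ᶻ_ shiftR shiftA))
           (∑-*ˡ s c (λ r → + r)) ⟩
    R -ᶻ + s -ᶻ (A -ᶻ 1ℤ) -ᶻ c *ᶻ Δ s ∎
    where
    lemma : ∀ r a c → r *ᶻ (a -ᶻ c) ≡ (1ℤ +ᶻ r) *ᶻ a -ᶻ a -ᶻ c *ᶻ r
    lemma = solve-∀
  lem₁ : ∀ s A B R c d →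
    s *ᶻ (B +ᶻ + 2 -ᶻ + 2 *ᶻ c *ᶻ (A -ᶻ 1ℤ) +ᶻ s *ᶻ (c *ᶻ c +ᶻ c))
      +ᶻ + 2 *ᶻ (R -ᶻ s -ᶻ (A -ᶻ 1ℤ) -ᶻ c *ᶻ d) -ᶻ (A -ᶻ 1ℤ -ᶻ s *ᶻ c) *ᶻ (A -ᶻ 1ℤ -ᶻ s *ᶻ c -ᶻ 1ℤ)
    ≡ s *ᶻ B +ᶻ + 2 *ᶻ R -ᶻ A *ᶻ (A -ᶻ 1ℤ) +ᶻ c *ᶻ (s *ᶻ (s -ᶻ 1ℤ) -ᶻ + 2 *ᶻ d)
  lem₁ = solve-∀
  lem₂ : ∀ a c d → a +ᶻ c *ᶻ (d -ᶻ d) ≡ a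
  lem₂ = solve-∀

partialSum-++ˡ : ∀ u v r → r ≤ length u → partialSum (u ++ v) r ≡ partialSum u r
partialSum-++ˡ u       v zero    _         = refl
partialSum-++ˡ (x ∷ u) v (suc r) (s≤s r≤u) = cong (_+_ x) (partialSum-++ˡ u v r r≤u)

partialSum-++ʳ : ∀ u v r → partialSum (u ++ v) (length u + r) ≡ sum u + partialSum v r
partialSum-++ʳ []      v r = refl
partialSum-++ʳ (x ∷ u) v r =
  trans (cong (_+_ x) (partialSum-++ʳ u v r)) (sym (ℕₚ.+-assoc x (sum u) _))

partialSum-length : ∀ z → partialSum z (length z) ≡ sum z
partialSum-length z = cong sum (take-all (length z) z ℕₚ.≤-refl)

rotate : List ℕ → List ℕ
rotate []       = []
rotate (x ∷ xs) = xs ++ x ∷ []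

rotate-injective : ∀ {y z} → rotate y ≡ rotate z → y ≡ z
rotate-injective {[]}     {[]}         eq = refl
rotate-injective {[]}     {_ ∷ []}     ()
rotate-injective {[]}     {_ ∷ _ ∷ _}  ()
rotate-injective {_ ∷ []}     {[]}     ()
rotate-injective {_ ∷ _ ∷ _}  {[]}     ()
rotate-injective {x ∷ xs} {y ∷ ys}     eq with ∷ʳ-injective xs ys eq
... | refl , refl = refl

length-rotate : ∀ z → length (rotate z) ≡ length z
length-rotate []       = refl
length-rotate (x ∷ xs) = trans (length-++ xs) (ℕₚ.+-comm (length xs) 1)

sum-rotate : ∀ z → sum (rotate z) ≡ sum z
sum-rotate []       = refl
sum-rotate (x ∷ xs) =
  trans (sum-++ xs (x ∷ []))
    (trans (cong (_+_ (sum xs)) (ℕₚ.+-identityʳ x)) (ℕₚ.+-comm (sum xs) x))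

rotate-surjective : ∀ z → ∃ λ y → rotate y ≡ z
rotate-surjective z with initLast z
... | []       = [] , refl
... | xs ∷ʳ′ x = x ∷ xs , refl

twiceSize-cong : ∀ s {a b : ℕ → ℤ} → (∀ r → r < s → a r ≡ b r) → twiceSize s a ≡ twiceSize s b
twiceSize-cong s {a} {b} eq = cong₂ _-ᶻ_
  (cong₂ (λ x y → + s *ᶻ x +ᶻ + 2 *ᶻ y)
    (∑-cong s (λ r r<s → cong (λ x → x *ᶻ x -ᶻ x) (eq r r<s)))
    (∑-cong s (λ r r<s → cong (+ r *ᶻ_) (eq r r<s))))
  (cong (λ x → x *ᶻ (x -ᶻ 1ℤ)) (∑-cong s eq))

-- The hypothesis on the sum brings the height to `-1` after a full turn. The constant `c` of the
-- shift is the height after the first part, where the rotated sequence begins.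
twiceSize-rotate : ∀ z → sum z ≡ suc (length z) →
  twiceSize (length z) (height (rotate z)) ≡ twiceSize (length z) (height z)
twiceSize-rotate []       _  = refl
twiceSize-rotate (x ∷ xs) Σz = trans
  (twiceSize-cong s rotated)
  (twiceSize-shift s (height z 1) (height z) refl bottom)
  where
  z = x ∷ xs
  s = length z
  rotated : ∀ r → r < s → height (rotate z) r ≡ height z (suc r) -ᶻ height z 1
  rotated r (s≤s r≤xs) =
    trans (cong (λ p → + r -ᶻ + p) (partialSum-++ˡ xs (x ∷ []) r r≤xs))
          (lemma (+ r) (+ x) (+ partialSum xs r))
    where
    lemma : ∀ r x p → r -ᶻ p ≡ 1ℤ +ᶻ r -ᶻ (x +ᶻ p) -ᶻ (1ℤ -ᶻ (x +ᶻ 0ℤ))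
    lemma = solve-∀
  bottom : height z s ≡ -1ℤ
  bottom = trans (cong (λ p → + s -ᶻ + p) (trans (partialSum-length z) Σz)) (lemma (+ s))
    where
    lemma : ∀ s → s -ᶻ (1ℤ +ᶻ s) ≡ -1ℤ
    lemma = solve-∀

-- The cycle lemma

Dyck : List ℕ → Set
Dyck z = ∀ r → r < length z → partialSum z r ≤ r

Dyck? : Decidable Dyck
Dyck? z = map′ (λ d r r<z → d r<z) (λ d {r} r<z → d r r<z)
               (ℕₚ.allUpTo? (λ r → partialSum z r ≤? r) (length z))

rotateBy : ℕ → List ℕ → List ℕ
rotateBy zero    z = z
rotateBy (suc i) z = rotateBy i (rotate z)

rotateBy-++ : ∀ u v → rotateBy (length u) (u ++ v) ≡ v ++ u
rotateBy-++ []      v = sym (++-identityʳ v)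
rotateBy-++ (x ∷ u) v = begin
  rotateBy (length u) ((u ++ v) ++ x ∷ []) ≡⟨ cong (rotateBy (length u)) (++-assoc u v (x ∷ [])) ⟩
  rotateBy (length u) (u ++ v ++ x ∷ [])   ≡⟨ rotateBy-++ u (v ++ x ∷ []) ⟩
  (v ++ x ∷ []) ++ u                       ≡⟨ ++-assoc v (x ∷ []) u ⟩
  v ++ x ∷ u                               ∎
  where open ≡-Reasoning

rotateBy-+ : ∀ i j z → rotateBy (i + j) z ≡ rotateBy j (rotateBy i z)
rotateBy-+ zero    j z = refl
rotateBy-+ (suc i) j z = rotateBy-+ i j (rotate z)

length-rotateBy : ∀ i z → length (rotateBy i z) ≡ length z
length-rotateBy zero    z = refl
length-rotateBy (suc i) z = trans (length-rotateBy i (rotate z)) (length-rotate z)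

sum-rotateBy : ∀ i z → sum (rotateBy i z) ≡ sum z
sum-rotateBy zero    z = refl
sum-rotateBy (suc i) z = trans (sum-rotateBy i (rotate z)) (sum-rotate z)

-- The heights r - partialSum z r attain their minimum for the first time at r = length u.
splitAtMinimum : ∀ z → ∃₂ λ u v → z ≡ u ++ v
  × (∀ r → r ≤ length v → partialSum v r ≤ r)
  × (∀ r → r < length u → partialSum u r + length u < sum u + r)
splitAtMinimum []      = [] , [] , refl , (λ { zero _ → z≤n }) , (λ _ ())
splitAtMinimum (x ∷ z) with splitAtMinimum z
-- Prepending `x` moves all heights of the tail by `1 - x` and puts a new height 0 in front. The old
-- minimum survives exactly if it is now negative; otherwise the empty prefix is the first minimum.
... | u , v , refl , after , before with x + sum u ≤? suc (length u)
...   | no  x+u≰ = x ∷ u , v , refl , after , before′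
  where
  open ℕₚ.≤-Reasoning
  before′ : ∀ r → r < suc (length u) → partialSum (x ∷ u) r + suc (length u) < x + sum u + r
  before′ zero    _         = subst (suc (length u) <_) (sym (ℕₚ.+-identityʳ (x + sum u))) (ℕₚ.≰⇒> x+u≰)
  before′ (suc r) (s≤s r<u) = begin-strict
    x + partialSum u r + suc (length u)   ≡⟨ lem₁ x (partialSum u r) (length u) ⟩
    suc x + (partialSum u r + length u)   <⟨ ℕₚ.+-monoʳ-< (suc x) (before r r<u) ⟩
    suc x + (sum u + r)                   ≡⟨ lem₂ x (sum u) r ⟩
    x + sum u + suc r                     ∎
    where
    lem₁ : ∀ x p l → x + p + suc l ≡ suc x + (p + l)
    lem₁ = solveℕ
    lem₂ : ∀ x p l → suc x + (p + l) ≡ x + p + suc l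
    lem₂ = solveℕ
...   | yes x+u≤ = [] , x ∷ u ++ v , refl , after′ , (λ _ ())
  where
  open ℕₚ.≤-Reasoning
  after′ : ∀ r → r ≤ suc (length (u ++ v)) → partialSum (x ∷ u ++ v) r ≤ r
  after′ zero    _          = z≤n
  after′ (suc r) (s≤s r≤uv) with ℕₚ.<-≤-connex r (length u)
  ... | inj₁ r<u = ℕₚ.+-cancelʳ-≤ (length u) (x + partialSum (u ++ v) r) (suc r) (begin
    x + partialSum (u ++ v) r + length u  ≡⟨ cong (λ p → x + p + length u) (partialSum-++ˡ u v r (ℕₚ.<⇒≤ r<u)) ⟩
    x + partialSum u r + length u         ≡⟨ ℕₚ.+-assoc x (partialSum u r) (length u) ⟩
    x + (partialSum u r + length u)       ≤⟨ ℕₚ.+-monoʳ-≤ x (ℕₚ.<⇒≤ (before r r<u)) ⟩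
    x + (sum u + r)                       ≡⟨ sym (ℕₚ.+-assoc x (sum u) r) ⟩
    x + sum u + r                         ≤⟨ ℕₚ.+-monoˡ-≤ r x+u≤ ⟩
    suc (length u) + r                    ≡⟨ cong suc (ℕₚ.+-comm (length u) r) ⟩
    suc r + length u                      ∎)
  ... | inj₂ u≤r = begin
    x + partialSum (u ++ v) r             ≡⟨ cong (λ i → x + partialSum (u ++ v) i) (sym u+q≡r) ⟩
    x + partialSum (u ++ v) (length u + q) ≡⟨ cong (_+_ x) (partialSum-++ʳ u v q) ⟩
    x + (sum u + partialSum v q)          ≡⟨ sym (ℕₚ.+-assoc x (sum u) _) ⟩
    x + sum u + partialSum v q            ≤⟨ ℕₚ.+-mono-≤ x+u≤ (after q q≤v) ⟩
    suc (length u) + q                    ≡⟨ cong suc u+q≡r ⟩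
    suc r                                 ∎
    where
    q = r ∸ length u
    u+q≡r : length u + q ≡ r
    u+q≡r = ℕₚ.m+[n∸m]≡n u≤r
    q≤v : q ≤ length v
    q≤v = ℕₚ.+-cancelˡ-≤ (length u) q (length v) (subst₂ _≤_ (sym u+q≡r) (length-++ u) r≤uv)

-- Starting at the minimum keeps the heights along `v` nonnegative. A full turn lowers the height by
-- 1, and along `u` this loss is absorbed by the strict inequality, that is, by the minimum being
-- the first one.
splitAtMinimum-Dyck : ∀ u v → sum (u ++ v) ≡ suc (length (u ++ v)) →
  (∀ r → r ≤ length v → partialSum v r ≤ r) →
  (∀ r → r < length u → partialSum u r + length u < sum u + r) → Dyck (v ++ u)
splitAtMinimum-Dyck u v Σ≡ after before r r<vu with ℕₚ.≤-<-connex r (length v)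
... | inj₁ r≤v = subst (_≤ r) (sym (partialSum-++ˡ v u r r≤v)) (after r r≤v)
... | inj₂ v<r = ℕₚ.≤-pred (ℕₚ.+-cancelʳ-< (length u) _ (suc r) (begin-strict
    partialSum (v ++ u) r + length u          ≡⟨ cong (λ i → partialSum (v ++ u) i + length u) (sym v+q≡r) ⟩
    partialSum (v ++ u) (length v + q) + length u ≡⟨ cong (_+ length u) (partialSum-++ʳ v u q) ⟩
    sum v + partialSum u q + length u         ≡⟨ ℕₚ.+-assoc (sum v) _ _ ⟩
    sum v + (partialSum u q + length u)       <⟨ ℕₚ.+-monoʳ-< (sum v) (before q q<u) ⟩
    sum v + (sum u + q)                       ≡⟨ lem₁ (sum v) (sum u) q ⟩
    sum u + sum v + q                         ≡⟨ cong (_+ q) (trans (sym (sum-++ u v)) (trans Σ≡ (cong suc (length-++ u)))) ⟩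
    suc (length u + length v) + q             ≡⟨ lem₂ (length u) (length v) q ⟩
    suc (length v + q) + length u             ≡⟨ cong (λ i → suc i + length u) v+q≡r ⟩
    suc r + length u                          ∎))
  where
  open ℕₚ.≤-Reasoning
  q = r ∸ length v
  v+q≡r : length v + q ≡ r
  v+q≡r = ℕₚ.m+[n∸m]≡n (ℕₚ.<⇒≤ v<r)
  q<u : q < length u
  q<u = ℕₚ.+-cancelˡ-< (length v) q (length u) (subst₂ _<_ (sym v+q≡r) (length-++ v) r<vu)
  lem₁ : ∀ a b c → a + (b + c) ≡ b + a + c
  lem₁ = solveℕ
  lem₂ : ∀ a b c → suc (a + b) + c ≡ suc (b + c) + a
  lem₂ = solveℕ

rotation-exists : ∀ z → 0 < length z → sum z ≡ suc (length z) →
  ∃ λ i → i < length z × Dyck (rotateBy i z)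
rotation-exists z 0<z Σz with splitAtMinimum z
-- Rotation by `length u` would be a full turn here, outside the range of `i`; offset 0 gives the
-- same list.
... | u , [] , refl , after , before =
  0 , 0<z , subst Dyck (sym (++-identityʳ u)) (splitAtMinimum-Dyck u [] Σz after before)
... | u , v@(_ ∷ v′) , refl , after , before =
  length u
  , subst (length u <_) (sym (length-++ u)) (ℕₚ.m<m+n (length u) (s≤s z≤n))
  , subst Dyck (sym (rotateBy-++ u v)) (splitAtMinimum-Dyck u v Σz after before)

-- Each of `u` and `v` would be a proper prefix of a Dyck composition, so neither sum could exceed
-- the length; but together they exceed it by 1.
Dyck-++-unique : ∀ u v → 0 < length u → 0 < length v → sum (u ++ v) ≡ suc (length (u ++ v)) →
  Dyck (u ++ v) → ¬ Dyck (v ++ u)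
Dyck-++-unique u v 0<u 0<v Σ≡ duv dvu = ℕₚ.<-irrefl refl (begin-strict
  length (u ++ v)          <⟨ ℕₚ.n<1+n _ ⟩
  suc (length (u ++ v))    ≡⟨ sym Σ≡ ⟩
  sum (u ++ v)             ≡⟨ sum-++ u v ⟩
  sum u + sum v            ≤⟨ ℕₚ.+-mono-≤ (Σ≤ u v 0<v duv) (Σ≤ v u 0<u dvu) ⟩
  length u + length v      ≡⟨ sym (length-++ u) ⟩
  length (u ++ v)          ∎)
  where
  open ℕₚ.≤-Reasoning
  Σ≤ : ∀ u v → 0 < length v → Dyck (u ++ v) → sum u ≤ length u
  Σ≤ u v 0<v d = subst (_≤ length u)
    (trans (partialSum-++ˡ u v (length u) ℕₚ.≤-refl) (partialSum-length u))
    (d (length u) (subst (length u <_) (sym (length-++ u)) (ℕₚ.m<m+n (length u) 0<v)))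

rotation-unique : ∀ z → sum z ≡ suc (length z) → ∀ i j → i < j → j < length z →
  Dyck (rotateBy i z) → ¬ Dyck (rotateBy j z)
rotation-unique z Σz i j i<j j<z di dj = Dyck-++-unique u v
  (subst (0 <_) (sym lu) (ℕₚ.m<n⇒0<n∸m i<j))
  (subst (0 <_) (sym lv) (ℕₚ.m<n⇒0<n∸m d<z))
  (trans (cong sum u++v) (trans (sum-rotateBy i z)
    (trans Σz (cong suc (trans (sym (length-rotateBy i z)) (sym (cong length u++v)))))))
  (subst Dyck (sym u++v) di)
  (subst Dyck j≡ dj)
  where
  d = j ∸ i
  w = rotateBy i z
  u = take d w
  v = drop d w
  u++v : u ++ v ≡ w
  u++v = take++drop≡id d w
  d<z : d < length z
  d<z = ℕₚ.≤-<-trans (ℕₚ.m∸n≤m j i) j<z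
  lu : length u ≡ d
  lu = trans (length-take d w)
    (ℕₚ.m≤n⇒m⊓n≡m (subst (d ≤_) (sym (length-rotateBy i z)) (ℕₚ.<⇒≤ d<z)))
  lv : length v ≡ length z ∸ d
  lv = trans (length-drop d w) (cong (_∸ d) (length-rotateBy i z))
  j≡ : rotateBy j z ≡ v ++ u
  j≡ = begin
    rotateBy j z                    ≡⟨ cong (λ k → rotateBy k z) (sym (ℕₚ.m+[n∸m]≡n (ℕₚ.<⇒≤ i<j))) ⟩
    rotateBy (i + d) z              ≡⟨ rotateBy-+ i d z ⟩
    rotateBy d w                    ≡⟨ cong₂ rotateBy (sym lu) (sym u++v) ⟩
    rotateBy (length u) (u ++ v)    ≡⟨ rotateBy-++ u v ⟩
    v ++ u                          ∎
    where open ≡-Reasoning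

indicator : ∀ {P : Set} → Dec P → ℤ
indicator P? = if does P? then 1ℤ else 0ℤ

∑-indicator-none : ∀ n {P : ℕ → Set} (P? : ∀ i → Dec (P i)) → (∀ i → i < n → ¬ P i) →
  ∑ n (λ i → indicator (P? i)) ≡ 0ℤ
∑-indicator-none zero    P? none = refl
∑-indicator-none (suc n) P? none with P? 0
... | yes p = contradiction p (none 0 (s≤s z≤n))
... | no  _ = trans (ℤₚ.+-identityˡ _)
  (∑-indicator-none n (P? ∘ suc) (λ i i<n → none (suc i) (s≤s i<n)))

∑-indicator-one : ∀ n {P : ℕ → Set} (P? : ∀ i → Dec (P i)) → (∃ λ i → i < n × P i) →
  (∀ i j → i < j → j < n → P i → ¬ P j) → ∑ n (λ i → indicator (P? i)) ≡ 1ℤ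
∑-indicator-one zero    P? (_ , () , _) one
∑-indicator-one (suc n) P? (i , i<n , pi) one with P? 0
... | yes p = cong (1ℤ +ᶻ_)
  (∑-indicator-none n (P? ∘ suc) (λ i i<n → one 0 (suc i) (s≤s z≤n) (s≤s i<n) p))
∑-indicator-one (suc n) P? (zero , _ , p0) one | no ¬p = contradiction p0 ¬p
∑-indicator-one (suc n) P? (suc i , s≤s i<n , pi) one | no ¬p = trans (ℤₚ.+-identityˡ _)
  (∑-indicator-one n (P? ∘ suc) (i , i<n , pi) (λ i j i<j j<n → one (suc i) (suc j) (s≤s i<j) (s≤s j<n)))

∑∈-↭ : ∀ {A : Set} {xs ys : List A} (f : A → ℤ) → xs ↭ ys → ∑∈ xs f ≡ ∑∈ ys f
∑∈-↭ f Perm.refl       = refl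
∑∈-↭ f (Perm.prep x p)   = cong (f x +ᶻ_) (∑∈-↭ f p)
∑∈-↭ f (Perm.swap {xs} {ys} x y p) = begin
  f x +ᶻ (f y +ᶻ ∑∈ xs f) ≡⟨ sym (ℤₚ.+-assoc (f x) (f y) _) ⟩
  f x +ᶻ f y +ᶻ ∑∈ xs f   ≡⟨ cong₂ _+ᶻ_ (ℤₚ.+-comm (f x) (f y)) (∑∈-↭ f p) ⟩
  f y +ᶻ f x +ᶻ ∑∈ ys f   ≡⟨ ℤₚ.+-assoc (f y) (f x) _ ⟩
  f y +ᶻ (f x +ᶻ ∑∈ ys f) ∎
  where open ≡-Reasoning
∑∈-↭ f (Perm.trans p q)  = trans (∑∈-↭ f p) (∑∈-↭ f q)

∑∈-filter : ∀ {A : Set} {P : A → Set} (P? : Decidable P) (xs : List A) (f : A → ℤ) →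
  ∑∈ (filter P? xs) f ≡ ∑∈ xs (λ x → indicator (P? x) *ᶻ f x)
∑∈-filter P? []       f = refl
∑∈-filter P? (x ∷ xs) f with P? x
... | yes _ = cong₂ _+ᶻ_ (sym (ℤₚ.*-identityˡ (f x))) (∑∈-filter P? xs f)
... | no  _ = trans (∑∈-filter P? xs f) (sym (ℤₚ.+-identityˡ _))

∑∈-∑-swap : ∀ {A : Set} (xs : List A) n (f : A → ℕ → ℤ) →
  ∑∈ xs (λ x → ∑ n (f x)) ≡ ∑ n (λ i → ∑∈ xs (λ x → f x i))
∑∈-∑-swap []       n f = sym (trans (∑-const n 0ℤ) (ℤₚ.*-zeroʳ (+ n)))
∑∈-∑-swap (x ∷ xs) n f =
  trans (cong (∑ n (f x) +ᶻ_) (∑∈-∑-swap xs n f))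
          (sym (∑-+ n (f x) (λ i → ∑∈ xs (λ x → f x i))))

-- Two duplicate-free lists with the same members are permutations of each other, so the way
-- rotation reorders the list need not be described.
rotate-compositions : ∀ k t → map rotate (compositions k t) ↭ compositions k t
rotate-compositions k t = ∼bag⇒↭ (unique∧set⇒bag
  (Unique.map⁺ rotate-injective (compositions-unique k t)) (compositions-unique k t)
  (mk⇔ to from))
  where
  to : ∀ {z} → z ∈ map rotate (compositions k t) → z ∈ compositions k t
  to z∈ with ∈-map⁻ rotate z∈
  ... | y , y∈ , refl with ∈-compositions⁻ k t y∈
  ...   | ly , sy = ∈-compositions⁺ k t (trans (length-rotate y) ly) (trans (sum-rotate y) sy)
  from : ∀ {z} → z ∈ compositions k t → z ∈ map rotate (compositions k t)
  from {z} z∈ with rotate-surjective z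
  ... | y , refl with ∈-compositions⁻ k t z∈
  ...   | lz , sz = ∈-map⁺ rotate
    (∈-compositions⁺ k t {y} (trans (sym (length-rotate y)) lz) (trans (sym (sum-rotate y)) sz))

∑∈-rotateBy : ∀ k t i (f : List ℕ → ℤ) →
  ∑∈ (compositions k t) (f ∘ rotateBy i) ≡ ∑∈ (compositions k t) f
∑∈-rotateBy k t zero    f = refl
∑∈-rotateBy k t (suc i) f = begin
  ∑∈ (compositions k t) (f ∘ rotateBy i ∘ rotate)       ≡⟨ sym (∑∈-map rotate (compositions k t) (f ∘ rotateBy i)) ⟩
  ∑∈ (map rotate (compositions k t)) (f ∘ rotateBy i)   ≡⟨ ∑∈-↭ (f ∘ rotateBy i) (rotate-compositions k t) ⟩
  ∑∈ (compositions k t) (f ∘ rotateBy i)                ≡⟨ ∑∈-rotateBy k t i f ⟩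
  ∑∈ (compositions k t) f                               ∎
  where open ≡-Reasoning

dyckCompositions : ℕ → List (List ℕ)
dyckCompositions s = filter Dyck? (compositions s (suc s))

-- Each `f z` is spread over the `s` offsets with the weight 1 at the only offset whose rotation is
-- Dyck. After exchanging the sums, every offset contributes the same amount, since rotation
-- permutes the compositions.
cycle-lemma : ∀ s → 0 < s → (f : List ℕ → ℤ) →
  (∀ z → length z ≡ s → sum z ≡ suc s → f (rotate z) ≡ f z) →
  ∑∈ (compositions s (suc s)) f ≡ + s *ᶻ ∑∈ (dyckCompositions s) f
cycle-lemma s 0<s f f-rotate = begin
  ∑∈ comps f
    ≡⟨ ∑∈-cong comps expand ⟩
  ∑∈ comps (λ z → ∑ s (λ i → g (rotateBy i z)))
    ≡⟨ ∑∈-∑-swap comps s (λ z i → g (rotateBy i z)) ⟩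
  ∑ s (λ i → ∑∈ comps (g ∘ rotateBy i))
    ≡⟨ ∑-cong s (λ i _ → ∑∈-rotateBy s (suc s) i g) ⟩
  ∑ s (λ i → ∑∈ comps g)
    ≡⟨ ∑-const s (∑∈ comps g) ⟩
  + s *ᶻ ∑∈ comps g
    ≡⟨ cong (+ s *ᶻ_) (sym (∑∈-filter Dyck? comps f)) ⟩
  + s *ᶻ ∑∈ (dyckCompositions s) f ∎
  where
  open ≡-Reasoning
  comps = compositions s (suc s)
  g : List ℕ → ℤ
  g z = indicator (Dyck? z) *ᶻ f z
  f-rotateBy : ∀ i z → length z ≡ s → sum z ≡ suc s → f (rotateBy i z) ≡ f z
  f-rotateBy zero    z lz sz = refl
  f-rotateBy (suc i) z lz sz = trans
    (f-rotateBy i (rotate z) (trans (length-rotate z) lz) (trans (sum-rotate z) sz))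
    (f-rotate z lz sz)
  expand : ∀ {z} → z ∈ comps → f z ≡ ∑ s (λ i → g (rotateBy i z))
  expand {z} z∈ with ∈-compositions⁻ s (suc s) z∈
  ... | refl , sz = begin
    f z                                                   ≡⟨ sym (ℤₚ.*-identityʳ (f z)) ⟩
    f z *ᶻ 1ℤ                                             ≡⟨ cong (f z *ᶻ_) (sym
      (∑-indicator-one s (λ i → Dyck? (rotateBy i z)) (rotation-exists z 0<s sz) (rotation-unique z sz))) ⟩
    f z *ᶻ ∑ s (λ i → indicator (Dyck? (rotateBy i z)))   ≡⟨ sym (∑-*ˡ s (f z) _) ⟩
    ∑ s (λ i → f z *ᶻ indicator (Dyck? (rotateBy i z)))
      ≡⟨ ∑-cong s (λ i _ → trans (ℤₚ.*-comm (f z) _)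
           (cong (indicator (Dyck? (rotateBy i z)) *ᶻ_) (sym (f-rotateBy i z refl sz)))) ⟩
    ∑ s (λ i → g (rotateBy i z))                          ∎

-- Evaluation of the sum over all weak compositions

-- Coefficients of 12 twiceSize as a polynomial in the power sums.
2D 12K cS : ℕ → ℤ
2D s = + 2 *ᶻ Δ s +ᶻ + 2 *ᶻ (+ s +ᶻ 1ℤ)
cS s = + s +ᶻ 2D s -ᶻ 1ℤ
12K s = + s *ᶻ (+ 2 *ᶻ (+ 6 *ᶻ □ s) +ᶻ + 24 *ᶻ + s *ᶻ (+ s +ᶻ 1ℤ) -ᶻ + 12 *ᶻ (+ s +ᶻ 1ℤ) *ᶻ (+ s +ᶻ 1ℤ)
    -ᶻ + 6 *ᶻ (+ 2 *ᶻ Δ s) -ᶻ + 12 *ᶻ (+ s +ᶻ 1ℤ))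
  +ᶻ + 4 *ᶻ (+ 6 *ᶻ □ s) +ᶻ + 24 *ᶻ + s *ᶻ (+ s +ᶻ 1ℤ) -ᶻ + 3 *ᶻ 2D s *ᶻ (2D s -ᶻ + 2)

12twiceSize : ∀ s z → length z ≡ s → sum z ≡ suc s → + 12 *ᶻ twiceSize s (height z)
  ≡ 12K s *ᶻ 1ℤ +ᶻ (+ 12 *ᶻ cS s *ᶻ S s z +ᶻ (+ 12 *ᶻ + s *ᶻ S² s z
    +ᶻ (-1ℤ *ᶻ (+ 24 *ᶻ (+ s +ᶻ 1ℤ)) *ᶻ Sʷ s z +ᶻ -1ℤ *ᶻ + 12 *ᶻ SS s z)))
12twiceSize s z refl Σz = begin
  + 12 *ᶻ (+ s *ᶻ ∑ s (λ r → a r *ᶻ a r -ᶻ a r) +ᶻ + 2 *ᶻ ∑ s (λ r → + r *ᶻ a r) -ᶻ ∑ s a *ᶻ (∑ s a -ᶻ 1ℤ))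
    ≡⟨ cong₂ (λ x y → + 12 *ᶻ (+ s *ᶻ x +ᶻ + 2 *ᶻ y -ᶻ ∑ s a *ᶻ (∑ s a -ᶻ 1ℤ))) eqB eqR ⟩
  + 12 *ᶻ (+ s *ᶻ B +ᶻ + 2 *ᶻ R -ᶻ ∑ s a *ᶻ (∑ s a -ᶻ 1ℤ))
    ≡⟨ cong (λ x → + 12 *ᶻ (+ s *ᶻ B +ᶻ + 2 *ᶻ R -ᶻ x *ᶻ (x -ᶻ 1ℤ))) eqA ⟩
  + 12 *ᶻ (+ s *ᶻ B +ᶻ + 2 *ᶻ R -ᶻ A *ᶻ (A -ᶻ 1ℤ))
    -- `Δ s` and `□ s` remain variables, grouped as `2 Δ s` and `6 □ s`, the multiples for which
    -- `2Δ` and `6□` give closed forms.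
    ≡⟨ lemma (+ s) (S s z) (S² s z) (Sʷ s z) (Δ s) (□ s) ⟩
  12K s *ᶻ 1ℤ +ᶻ (+ 12 *ᶻ cS s *ᶻ S s z +ᶻ (+ 12 *ᶻ + s *ᶻ S² s z
    +ᶻ (-1ℤ *ᶻ (+ 24 *ᶻ (+ s +ᶻ 1ℤ)) *ᶻ Sʷ s z +ᶻ -1ℤ *ᶻ + 12 *ᶻ SS s z))) ∎
  where
  open ≡-Reasoning
  a = height z
  p : ℕ → ℤ
  p r = + partialSum z r
  t = + s +ᶻ 1ℤ
  pₛ : p s ≡ t
  pₛ = trans (cong +_ (trans (partialSum-length z) Σz)) (ℤₚ.+-comm 1ℤ (+ s))
  -- Passes from the partial sums at `0, …, s - 1` that occur in heights to those at `1, …, s` that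
  -- occur in `σ`: the term at 0 vanishes, and the term at `s`, where the full sum is `s + 1`, is
  -- taken off.
  unshift : ∀ (f : ℕ → ℤ → ℤ) → f 0 0ℤ ≡ 0ℤ →
    ∑ s (λ r → f r (p r)) ≡ ∑ s (λ r → f (suc r) (σ z r)) -ᶻ f s t
  unshift f f0 = begin
    ∑ s (λ r → f r (p r))
      ≡⟨ solve₁ (∑ s (λ r → f r (p r))) (f s (p s)) ⟩
    (∑ s (λ r → f r (p r)) -ᶻ 0ℤ +ᶻ f s (p s)) -ᶻ f s (p s)
      ≡⟨ cong (λ x → (∑ s (λ r → f r (p r)) -ᶻ x +ᶻ f s (p s)) -ᶻ f s (p s)) (sym f0) ⟩
    (∑ s (λ r → f r (p r)) -ᶻ f 0 (p 0) +ᶻ f s (p s)) -ᶻ f s (p s)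
      ≡⟨ cong₂ _-ᶻ_ (sym (∑-shift s (λ r → f r (p r)))) (cong (f s) pₛ) ⟩
    ∑ s (λ r → f (suc r) (σ z r)) -ᶻ f s t ∎
    where
    solve₁ : ∀ a b → a ≡ (a -ᶻ 0ℤ +ᶻ b) -ᶻ b
    solve₁ = solve-∀
  ∑p : ∑ s p ≡ S s z -ᶻ t
  ∑p = unshift (λ _ x → x) refl
  ∑p² : ∑ s (λ r → p r *ᶻ p r) ≡ S² s z -ᶻ t *ᶻ t
  ∑p² = unshift (λ _ x → x *ᶻ x) refl
  ∑rp : ∑ s (λ r → + r *ᶻ p r) ≡ Sʷ s z -ᶻ + s *ᶻ t
  ∑rp = unshift (λ r x → + r *ᶻ x) refl
  A B R : ℤ
  A = Δ s -ᶻ (S s z -ᶻ t)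
  B = □ s -ᶻ + 2 *ᶻ (Sʷ s z -ᶻ + s *ᶻ t) +ᶻ (S² s z -ᶻ t *ᶻ t) -ᶻ A
  R = □ s -ᶻ (Sʷ s z -ᶻ + s *ᶻ t)
  eqA : ∑ s a ≡ A
  eqA = trans (∑-- s (λ r → + r) p) (cong (Δ s -ᶻ_) ∑p)
  eqR : ∑ s (λ r → + r *ᶻ a r) ≡ R
  eqR = begin
    ∑ s (λ r → + r *ᶻ (+ r -ᶻ p r))                ≡⟨ ∑-cong s (λ r _ → solve₁ (+ r) (p r)) ⟩
    ∑ s (λ r → + r *ᶻ + r -ᶻ + r *ᶻ p r)           ≡⟨ ∑-- s (λ r → + r *ᶻ + r) (λ r → + r *ᶻ p r) ⟩
    □ s -ᶻ ∑ s (λ r → + r *ᶻ p r)                  ≡⟨ cong (□ s -ᶻ_) ∑rp ⟩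
    R                                              ∎
    where
    solve₁ : ∀ r p → r *ᶻ (r -ᶻ p) ≡ r *ᶻ r -ᶻ r *ᶻ p
    solve₁ = solve-∀
  eqB : ∑ s (λ r → a r *ᶻ a r -ᶻ a r) ≡ B
  eqB = begin
    ∑ s (λ r → a r *ᶻ a r -ᶻ a r)
      ≡⟨ ∑-- s (λ r → a r *ᶻ a r) a ⟩
    ∑ s (λ r → a r *ᶻ a r) -ᶻ ∑ s a
      ≡⟨ cong (_-ᶻ ∑ s a) (∑-cong s (λ r _ → solve₁ (+ r) (p r))) ⟩
    ∑ s (λ r → + r *ᶻ + r -ᶻ + 2 *ᶻ (+ r *ᶻ p r) +ᶻ p r *ᶻ p r) -ᶻ ∑ s a
      ≡⟨ cong (_-ᶻ ∑ s a) (∑-+ s (λ r → + r *ᶻ + r -ᶻ + 2 *ᶻ (+ r *ᶻ p r)) (λ r → p r *ᶻ p r)) ⟩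
    ∑ s (λ r → + r *ᶻ + r -ᶻ + 2 *ᶻ (+ r *ᶻ p r)) +ᶻ ∑ s (λ r → p r *ᶻ p r) -ᶻ ∑ s a
      ≡⟨ cong₂ (λ x y → x +ᶻ y -ᶻ ∑ s a)
           (trans (∑-- s (λ r → + r *ᶻ + r) (λ r → + 2 *ᶻ (+ r *ᶻ p r)))
                    (cong (□ s -ᶻ_) (trans (∑-*ˡ s (+ 2) (λ r → + r *ᶻ p r)) (cong (+ 2 *ᶻ_) ∑rp))))
           ∑p² ⟩
    □ s -ᶻ + 2 *ᶻ (Sʷ s z -ᶻ + s *ᶻ t) +ᶻ (S² s z -ᶻ t *ᶻ t) -ᶻ ∑ s a
      ≡⟨ cong (λ x → □ s -ᶻ + 2 *ᶻ (Sʷ s z -ᶻ + s *ᶻ t) +ᶻ (S² s z -ᶻ t *ᶻ t) -ᶻ x) eqA ⟩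
    B ∎
    where
    solve₁ : ∀ r p → (r -ᶻ p) *ᶻ (r -ᶻ p) ≡ r *ᶻ r -ᶻ + 2 *ᶻ (r *ᶻ p) +ᶻ p *ᶻ p
    solve₁ = solve-∀
  lemma : ∀ s S S² Sʷ d q →
    + 12 *ᶻ (s *ᶻ (q -ᶻ + 2 *ᶻ (Sʷ -ᶻ s *ᶻ (s +ᶻ 1ℤ)) +ᶻ (S² -ᶻ (s +ᶻ 1ℤ) *ᶻ (s +ᶻ 1ℤ)) -ᶻ (d -ᶻ (S -ᶻ (s +ᶻ 1ℤ))))
      +ᶻ + 2 *ᶻ (q -ᶻ (Sʷ -ᶻ s *ᶻ (s +ᶻ 1ℤ)))
      -ᶻ (d -ᶻ (S -ᶻ (s +ᶻ 1ℤ))) *ᶻ (d -ᶻ (S -ᶻ (s +ᶻ 1ℤ)) -ᶻ 1ℤ))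
    ≡ (s *ᶻ (+ 2 *ᶻ (+ 6 *ᶻ q) +ᶻ + 24 *ᶻ s *ᶻ (s +ᶻ 1ℤ) -ᶻ + 12 *ᶻ (s +ᶻ 1ℤ) *ᶻ (s +ᶻ 1ℤ)
          -ᶻ + 6 *ᶻ (+ 2 *ᶻ d) -ᶻ + 12 *ᶻ (s +ᶻ 1ℤ))
        +ᶻ + 4 *ᶻ (+ 6 *ᶻ q) +ᶻ + 24 *ᶻ s *ᶻ (s +ᶻ 1ℤ)
        -ᶻ + 3 *ᶻ (+ 2 *ᶻ d +ᶻ + 2 *ᶻ (s +ᶻ 1ℤ)) *ᶻ (+ 2 *ᶻ d +ᶻ + 2 *ᶻ (s +ᶻ 1ℤ) -ᶻ + 2)) *ᶻ 1ℤ
      +ᶻ (+ 12 *ᶻ (s +ᶻ (+ 2 *ᶻ d +ᶻ + 2 *ᶻ (s +ᶻ 1ℤ)) -ᶻ 1ℤ) *ᶻ S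
      +ᶻ (+ 12 *ᶻ s *ᶻ S² +ᶻ (-1ℤ *ᶻ (+ 24 *ᶻ (s +ᶻ 1ℤ)) *ᶻ Sʷ +ᶻ -1ℤ *ᶻ + 12 *ᶻ (S *ᶻ S))))
  lemma = solve-∀

∑∈-linear : ∀ {A : Set} (xs : List A) c d e f g (F G H I J : A → ℤ) →
  ∑∈ xs (λ x → c *ᶻ F x +ᶻ (d *ᶻ G x +ᶻ (e *ᶻ H x +ᶻ (f *ᶻ I x +ᶻ g *ᶻ J x))))
    ≡ c *ᶻ ∑∈ xs F +ᶻ (d *ᶻ ∑∈ xs G +ᶻ (e *ᶻ ∑∈ xs H +ᶻ (f *ᶻ ∑∈ xs I +ᶻ g *ᶻ ∑∈ xs J)))
∑∈-linear xs c d e f g F G H I J =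
  step c F _ (step d G _ (step e H _ (step f I _ (∑∈-*ˡ xs g J))))
  where
  step : ∀ c F K {k} → ∑∈ xs K ≡ k → ∑∈ xs (λ x → c *ᶻ F x +ᶻ K x) ≡ c *ᶻ ∑∈ xs F +ᶻ k
  step c F K eq = trans (∑∈-+ xs (λ x → c *ᶻ F x) K) (cong₂ _+ᶻ_ (∑∈-*ˡ xs c F) eq)

-- All moments carry the common factor `N s (suc s)`, which leaves a polynomial in `s`. Its terms of
-- degree four cancel and the cubic remainder factors.
total-twiceSize : ∀ s → + 12 *ᶻ ∑∈ (compositions s (suc s)) (λ z → twiceSize s (height z))
  ≡ N s (suc s) *ᶻ ((+ 2 *ᶻ + s +ᶻ + 2) *ᶻ (+ s -ᶻ 1ℤ) *ᶻ + s)
total-twiceSize s = begin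
  + 12 *ᶻ ∑∈ comps (λ z → twiceSize s (height z))
    ≡⟨ sym (∑∈-*ˡ comps (+ 12) (λ z → twiceSize s (height z))) ⟩
  ∑∈ comps (λ z → + 12 *ᶻ twiceSize s (height z))
    ≡⟨ ∑∈-cong comps expand ⟩
  ∑∈ comps (λ z → 12K s *ᶻ 1ℤ +ᶻ (+ 12 *ᶻ cS s *ᶻ S s z +ᶻ (+ 12 *ᶻ + s *ᶻ S² s z
    +ᶻ (-1ℤ *ᶻ (+ 24 *ᶻ (+ s +ᶻ 1ℤ)) *ᶻ Sʷ s z +ᶻ -1ℤ *ᶻ + 12 *ᶻ SS s z))))
    ≡⟨ ∑∈-linear comps (12K s) (+ 12 *ᶻ cS s) (+ 12 *ᶻ + s) (-1ℤ *ᶻ (+ 24 *ᶻ (+ s +ᶻ 1ℤ))) (-1ℤ *ᶻ + 12)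
         (ones s) (S s) (S² s) (Sʷ s) (SS s) ⟩
  12K s *ᶻ n +ᶻ (+ 12 *ᶻ cS s *ᶻ total S s t +ᶻ (+ 12 *ᶻ + s *ᶻ total S² s t
    +ᶻ (-1ℤ *ᶻ (+ 24 *ᶻ (+ s +ᶻ 1ℤ)) *ᶻ total Sʷ s t +ᶻ -1ℤ *ᶻ + 12 *ᶻ total SS s t)))
    ≡⟨ regroup (12K s) (cS s) (+ s) n (total S s t) (total S² s t) (total Sʷ s t) (total SS s t) ⟩
  12K s *ᶻ n +ᶻ + 6 *ᶻ cS s *ᶻ (+ 2 *ᶻ total S s t) +ᶻ + 2 *ᶻ + s *ᶻ (+ 6 *ᶻ total S² s t)
    -ᶻ + 4 *ᶻ (+ s +ᶻ 1ℤ) *ᶻ (+ 6 *ᶻ total Sʷ s t) -ᶻ + 12 *ᶻ total SS s t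
    ≡⟨ cong₂ (λ (x , y) (v , w) → 12K s *ᶻ n +ᶻ + 6 *ᶻ cS s *ᶻ x +ᶻ + 2 *ᶻ + s *ᶻ y
                -ᶻ + 4 *ᶻ (+ s +ᶻ 1ℤ) *ᶻ v -ᶻ w)
         (cong₂ _,_ (moment-S s t) (moment-S² s t)) (cong₂ _,_ (moment-Sʷ s t) (moment-SS s t)) ⟩
  rhs (+ 2 *ᶻ Δ s) (+ 6 *ᶻ □ s)
    ≡⟨ cong₂ rhs (2Δ s) (6□ s) ⟩
  rhs (+ s *ᶻ (+ s -ᶻ 1ℤ)) (+ s *ᶻ (+ s -ᶻ 1ℤ) *ᶻ (+ 2 *ᶻ + s -ᶻ 1ℤ))
    ≡⟨ final (+ s) n ⟩
  n *ᶻ ((+ 2 *ᶻ + s +ᶻ + 2) *ᶻ (+ s -ᶻ 1ℤ) *ᶻ + s) ∎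
  where
  open ≡-Reasoning
  t = suc s
  comps = compositions s t
  n = N s t
  rhs : ℤ → ℤ → ℤ
  rhs d q = (+ s *ᶻ (+ 2 *ᶻ q +ᶻ + 24 *ᶻ + s *ᶻ (+ s +ᶻ 1ℤ) -ᶻ + 12 *ᶻ (+ s +ᶻ 1ℤ) *ᶻ (+ s +ᶻ 1ℤ)
          -ᶻ + 6 *ᶻ d -ᶻ + 12 *ᶻ (+ s +ᶻ 1ℤ))
        +ᶻ + 4 *ᶻ q +ᶻ + 24 *ᶻ + s *ᶻ (+ s +ᶻ 1ℤ)
        -ᶻ + 3 *ᶻ (d +ᶻ + 2 *ᶻ (+ s +ᶻ 1ℤ)) *ᶻ (d +ᶻ + 2 *ᶻ (+ s +ᶻ 1ℤ) -ᶻ + 2)) *ᶻ n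
      +ᶻ + 6 *ᶻ (+ s +ᶻ (d +ᶻ + 2 *ᶻ (+ s +ᶻ 1ℤ)) -ᶻ 1ℤ) *ᶻ (n *ᶻ polyS (+ s) (+ t))
      +ᶻ + 2 *ᶻ + s *ᶻ (n *ᶻ polyS² (+ s) (+ t))
      -ᶻ + 4 *ᶻ (+ s +ᶻ 1ℤ) *ᶻ (n *ᶻ polySʷ (+ s) (+ t)) -ᶻ n *ᶻ polySS (+ s) (+ t)
  expand : ∀ {z} → _ → _
  expand {z} z∈ with ∈-compositions⁻ s t z∈
  ... | lz , sz = 12twiceSize s z lz sz
  regroup : ∀ k c s n a b w e →
    k *ᶻ n +ᶻ (+ 12 *ᶻ c *ᶻ a +ᶻ (+ 12 *ᶻ s *ᶻ b +ᶻ (-1ℤ *ᶻ (+ 24 *ᶻ (s +ᶻ 1ℤ)) *ᶻ w +ᶻ -1ℤ *ᶻ + 12 *ᶻ e)))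
    ≡ k *ᶻ n +ᶻ + 6 *ᶻ c *ᶻ (+ 2 *ᶻ a) +ᶻ + 2 *ᶻ s *ᶻ (+ 6 *ᶻ b)
      -ᶻ + 4 *ᶻ (s +ᶻ 1ℤ) *ᶻ (+ 6 *ᶻ w) -ᶻ + 12 *ᶻ e
  regroup = solve-∀
  final : ∀ s n →
    (s *ᶻ (+ 2 *ᶻ (s *ᶻ (s -ᶻ 1ℤ) *ᶻ (+ 2 *ᶻ s -ᶻ 1ℤ)) +ᶻ + 24 *ᶻ s *ᶻ (s +ᶻ 1ℤ)
          -ᶻ + 12 *ᶻ (s +ᶻ 1ℤ) *ᶻ (s +ᶻ 1ℤ) -ᶻ + 6 *ᶻ (s *ᶻ (s -ᶻ 1ℤ)) -ᶻ + 12 *ᶻ (s +ᶻ 1ℤ))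
        +ᶻ + 4 *ᶻ (s *ᶻ (s -ᶻ 1ℤ) *ᶻ (+ 2 *ᶻ s -ᶻ 1ℤ)) +ᶻ + 24 *ᶻ s *ᶻ (s +ᶻ 1ℤ)
        -ᶻ + 3 *ᶻ (s *ᶻ (s -ᶻ 1ℤ) +ᶻ + 2 *ᶻ (s +ᶻ 1ℤ)) *ᶻ (s *ᶻ (s -ᶻ 1ℤ) +ᶻ + 2 *ᶻ (s +ᶻ 1ℤ) -ᶻ + 2)) *ᶻ n
      +ᶻ + 6 *ᶻ (s +ᶻ (s *ᶻ (s -ᶻ 1ℤ) +ᶻ + 2 *ᶻ (s +ᶻ 1ℤ)) -ᶻ 1ℤ) *ᶻ (n *ᶻ ((1ℤ +ᶻ s) *ᶻ (s +ᶻ 1ℤ)))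
      +ᶻ + 2 *ᶻ s *ᶻ (n *ᶻ ((1ℤ +ᶻ s) *ᶻ (+ 2 *ᶻ ((1ℤ +ᶻ s) -ᶻ 1ℤ) *ᶻ (s +ᶻ + 2) +ᶻ + 3 *ᶻ (s +ᶻ 1ℤ))))
      -ᶻ + 4 *ᶻ (s +ᶻ 1ℤ) *ᶻ (n *ᶻ ((1ℤ +ᶻ s) *ᶻ ((s +ᶻ 1ℤ) *ᶻ (+ 2 *ᶻ s +ᶻ 1ℤ))))
      -ᶻ n *ᶻ ((1ℤ +ᶻ s) *ᶻ (+ 3 *ᶻ ((1ℤ +ᶻ s) -ᶻ 1ℤ) *ᶻ s *ᶻ (s +ᶻ 1ℤ)
           +ᶻ + 2 *ᶻ ((1ℤ +ᶻ s) -ᶻ 1ℤ) *ᶻ (+ 2 *ᶻ s +ᶻ 1ℤ) +ᶻ + 2 *ᶻ (s +ᶻ 1ℤ) *ᶻ (+ 2 *ᶻ s +ᶻ 1ℤ)))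
    ≡ n *ᶻ ((+ 2 *ᶻ s +ᶻ + 2) *ᶻ (s -ᶻ 1ℤ) *ᶻ s)
  final = solve-∀

-- First-column hook lengths

count : ∀ {A : Set} {P : A → Set} → Decidable P → List A → ℕ
count P? xs = length (filter P? xs)

module _ {A : Set} {P : A → Set} (P? : Decidable P) where

  count-++ : ∀ xs ys → count P? (xs ++ ys) ≡ count P? xs + count P? ys
  count-++ xs ys = trans (cong length (filter-++ P? xs ys)) (length-++ (filter P? xs))

  count-map : ∀ {B : Set} (f : B → A) xs → count P? (map f xs) ≡ count (P? ∘ f) xs
  count-map f []       = refl
  count-map f (x ∷ xs) with P? (f x)
  ... | yes _ = cong suc (count-map f xs)
  ... | no  _ = count-map f xs

  count-none : (∀ x → ¬ P x) → ∀ xs → count P? xs ≡ 0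
  count-none ¬P xs = cong length (filter-none P? (All.universal ¬P xs))

  count-cong : {Q : A → Set} (Q? : Decidable Q) → (∀ x → P x → Q x) → (∀ x → Q x → P x) →
    ∀ xs → count P? xs ≡ count Q? xs
  count-cong Q? to from xs = cong length (filter-≐ P? Q? ((λ {x} → to x) , (λ {x} → from x)) xs)

  count-yes : ∀ {x} xs → P x → count P? (x ∷ xs) ≡ suc (count P? xs)
  count-yes xs px = cong length (filter-accept P? px)

  count-no : ∀ {x} xs → ¬ P x → count P? (x ∷ xs) ≡ count P? xs
  count-no xs ¬px = cong length (filter-reject P? ¬px)

module _ {P : ℕ → Set} (P? : Decidable P) where

  count-upTo-suc : ∀ n → count P? (upTo (suc n)) ≡ count P? (upTo n) + count P? (n ∷ [])
  count-upTo-suc n =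
    trans (cong (count P?) (sym (applyUpTo-∷ʳ id n))) (count-++ P? (upTo n) (n ∷ []))

count-≥-upTo : ∀ j n → count (j ≤?_) (upTo n) ≡ n ∸ j
count-≥-upTo j zero    = sym (ℕₚ.0∸n≡0 j)
count-≥-upTo j (suc n) with j ≤? n
... | yes j≤n = begin
  count (j ≤?_) (upTo (suc n))               ≡⟨ count-upTo-suc (j ≤?_) n ⟩
  count (j ≤?_) (upTo n) + count (j ≤?_) (n ∷ [])
    ≡⟨ cong₂ _+_ (count-≥-upTo j n) (count-yes (j ≤?_) [] j≤n) ⟩
  n ∸ j + 1                                  ≡⟨ ℕₚ.+-comm (n ∸ j) 1 ⟩
  suc (n ∸ j)                                ≡⟨ sym (ℕₚ.+-∸-assoc 1 j≤n) ⟩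
  suc n ∸ j                                  ∎
  where open ≡-Reasoning
... | no j≰n = begin
  count (j ≤?_) (upTo (suc n))               ≡⟨ count-upTo-suc (j ≤?_) n ⟩
  count (j ≤?_) (upTo n) + count (j ≤?_) (n ∷ [])
    ≡⟨ cong₂ _+_ (count-≥-upTo j n) (count-no (j ≤?_) [] j≰n) ⟩
  n ∸ j + 0                                  ≡⟨ cong (_+ 0) (ℕₚ.m≤n⇒m∸n≡0 (ℕₚ.≤-trans (ℕₚ.n≤1+n n) n<j)) ⟩
  0                                          ≡⟨ sym (ℕₚ.m≤n⇒m∸n≡0 n<j) ⟩
  suc n ∸ j                                  ∎
  where
  open ≡-Reasoning
  n<j = ℕₚ.≰⇒> j≰n

count-≟-upTo-no : ∀ j n → n ≤ j → count (_≟ j) (upTo n) ≡ 0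
count-≟-upTo-no j zero    _   = refl
count-≟-upTo-no j (suc n) n<j = trans (count-upTo-suc (_≟ j) n)
  (cong₂ _+_ (count-≟-upTo-no j n (ℕₚ.<⇒≤ n<j)) (count-no (_≟ j) [] (ℕₚ.<⇒≢ n<j)))

count-≟-upTo-yes : ∀ j n → j < n → count (_≟ j) (upTo n) ≡ 1
count-≟-upTo-yes j (suc n) (s≤s j≤n) with n ≟ j
... | yes refl = trans (count-upTo-suc (_≟ j) n)
  (cong₂ _+_ (count-≟-upTo-no j n ℕₚ.≤-refl) (count-yes (_≟ j) [] refl))
... | no  n≢j  = trans (count-upTo-suc (_≟ j) n)
  (cong₂ _+_ (count-≟-upTo-yes j n (ℕₚ.≤∧≢⇒< j≤n (n≢j ∘ sym))) (count-no (_≟ j) [] n≢j))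

columnLength : ℕ → List ℕ → ℕ
columnLength j = count (j <?_)

count-column : ∀ j rs → count (λ c → proj₂ c ≟ j) (cells rs) ≡ columnLength j rs
count-column j []       = refl
count-column j (r ∷ rs) = begin
  count (λ c → proj₂ c ≟ j) (cells (r ∷ rs))
    ≡⟨ count-++ (λ c → proj₂ c ≟ j) (map (0 ,_) (upTo r)) _ ⟩
  count (λ c → proj₂ c ≟ j) (map (0 ,_) (upTo r)) + count (λ c → proj₂ c ≟ j) (map (map₁ suc) (cells rs))
    ≡⟨ cong₂ _+_ (count-map (λ c → proj₂ c ≟ j) (0 ,_) (upTo r)) (count-map (λ c → proj₂ c ≟ j) (map₁ suc) (cells rs)) ⟩
  count (_≟ j) (upTo r) + count (λ c → proj₂ c ≟ j) (cells rs)
    ≡⟨ cong (λ x → count (_≟ j) (upTo r) + x) (count-column j rs) ⟩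
  count (_≟ j) (upTo r) + columnLength j rs
    ≡⟨ row (j <? r) ⟩
  columnLength j (r ∷ rs) ∎
  where
  open ≡-Reasoning
  row : Dec (j < r) → count (_≟ j) (upTo r) + columnLength j rs ≡ columnLength j (r ∷ rs)
  row (yes j<r) = trans (cong (_+ columnLength j rs) (count-≟-upTo-yes j r j<r)) (sym (count-yes (j <?_) rs j<r))
  row (no  j≮r) = trans (cong (_+ columnLength j rs) (count-≟-upTo-no j r (ℕₚ.≮⇒≥ j≮r))) (sym (count-no (j <?_) rs j≮r))

-- The arm together with the cell itself is counted in the first row; the lower rows meet the hook
-- only in column `j`, once for each row longer than `j`.
hookLength-first : ∀ r rs j → hookLength (r ∷ rs) (0 , j) ≡ (r ∸ j) + columnLength j rs
hookLength-first r rs j = begin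
  hookLength (r ∷ rs) (0 , j)
    ≡⟨ count-++ (inHook? (0 , j)) (map (0 ,_) (upTo r)) _ ⟩
  count (inHook? (0 , j)) (map (0 ,_) (upTo r)) + count (inHook? (0 , j)) (map (map₁ suc) (cells rs))
    ≡⟨ cong₂ _+_ (count-map (inHook? (0 , j)) (0 ,_) (upTo r)) (count-map (inHook? (0 , j)) (map₁ suc) (cells rs)) ⟩
  count (λ j′ → inHook? (0 , j) (0 , j′)) (upTo r) + count (λ c → inHook? (0 , j) (map₁ suc c)) (cells rs)
    ≡⟨ cong₂ _+_
         (count-cong (λ j′ → inHook? (0 , j) (0 , j′)) (j ≤?_)
           (λ { _ (inj₁ (_ , j≤)) → j≤ ; _ (inj₂ (refl , _)) → ℕₚ.≤-refl }) (λ _ j≤ → inj₁ (refl , j≤)) (upTo r))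
         (count-cong (λ c → inHook? (0 , j) (map₁ suc c)) (λ c → proj₂ c ≟ j)
           (λ { _ (inj₁ (() , _)) ; _ (inj₂ (eq , _)) → eq }) (λ _ eq → inj₂ (eq , z≤n)) (cells rs)) ⟩
  count (j ≤?_) (upTo r) + count (λ c → proj₂ c ≟ j) (cells rs)
    ≡⟨ cong₂ _+_ (count-≥-upTo j r) (count-column j rs) ⟩
  (r ∸ j) + columnLength j rs ∎
  where open ≡-Reasoning

hookLength-suc : ∀ r rs c → hookLength (r ∷ rs) (map₁ suc c) ≡ hookLength rs c
hookLength-suc r rs c@(i , j) = begin
  hookLength (r ∷ rs) (suc i , j)
    ≡⟨ count-++ (inHook? (suc i , j)) (map (0 ,_) (upTo r)) _ ⟩
  count (inHook? (suc i , j)) (map (0 ,_) (upTo r)) + count (inHook? (suc i , j)) (map (map₁ suc) (cells rs))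
    ≡⟨ cong₂ _+_ (count-map (inHook? (suc i , j)) (0 ,_) (upTo r)) (count-map (inHook? (suc i , j)) (map₁ suc) (cells rs)) ⟩
  count (λ j′ → inHook? (suc i , j) (0 , j′)) (upTo r) + count (λ c → inHook? (suc i , j) (map₁ suc c)) (cells rs)
    ≡⟨ cong₂ _+_
         (count-none (λ j′ → inHook? (suc i , j) (0 , j′)) (λ { _ (inj₁ (() , _)) ; _ (inj₂ (_ , ())) }) (upTo r))
         (count-cong (λ c → inHook? (suc i , j) (map₁ suc c)) (inHook? (i , j))
           (λ { _ (inj₁ (refl , le)) → inj₁ (refl , le) ; _ (inj₂ (eq , s≤s le)) → inj₂ (eq , le) })
           (λ { _ (inj₁ (refl , le)) → inj₁ (refl , le) ; _ (inj₂ (eq , le)) → inj₂ (eq , s≤s le) }) (cells rs)) ⟩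
  hookLength rs c ∎
  where open ≡-Reasoning

NoHookInFirstRow : ℕ → ℕ → List ℕ → Set
NoHookInFirstRow s r rs = ∀ j → j < r → (r ∸ j) + columnLength j rs ≢ s

HasNoHook-∷ : ∀ s r rs → HasNoHook s (r ∷ rs) ⇔ (NoHookInFirstRow s r rs × HasNoHook s rs)
HasNoHook-∷ s r rs = mk⇔ to from
  where
  to : HasNoHook s (r ∷ rs) → NoHookInFirstRow s r rs × HasNoHook s rs
  to all with All.++⁻ (map (0 ,_) (upTo r)) all
  ... | first , rest =
    (λ j j<r eq → All.applyUpTo⁻ id r (All.map⁻ first) j<r (trans (hookLength-first r rs j) eq))
    , All.map (λ {c} ≢s eq → ≢s (trans (hookLength-suc r rs c) eq)) (All.map⁻ rest)
  from : NoHookInFirstRow s r rs × HasNoHook s rs → HasNoHook s (r ∷ rs)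
  from (first , rest) = All.++⁺
    (All.map⁺ (All.applyUpTo⁺₁ id r λ {j} j<r eq → first j j<r (trans (sym (hookLength-first r rs j)) eq)))
    (All.map⁺ (All.map (λ {c} ≢s eq → ≢s (trans (sym (hookLength-suc r rs c)) eq)) rest))

-- The beta-set of the partition. As parts are positive, every later row meets the first column, so
-- the leg of the first cell is `length rs`.
firstHooks : List ℕ → List ℕ
firstHooks []       = []
firstHooks (r ∷ rs) = r + length rs ∷ firstHooks rs

firstHooks-< : ∀ {r} rs → All (r ≥_) rs → ∀ {k} → k ∈ firstHooks rs → k < r + length rs
firstHooks-< {r} (x ∷ rs) (r≥x ∷ _)    (here refl) =
  ℕₚ.≤-trans (s≤s (ℕₚ.+-monoˡ-≤ (length rs) r≥x)) (ℕₚ.≤-reflexive (sym (ℕₚ.+-suc r (length rs))))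
firstHooks-< {r} (x ∷ rs) (_   ∷ r≥rs) (there k∈)  =
  ℕₚ.<-trans (firstHooks-< rs r≥rs k∈) (ℕₚ.+-monoʳ-< r (ℕₚ.n<1+n (length rs)))

-- j ↦ j + #{parts ≤ j} enumerates the complement of the set of first-column hook lengths.
gap : ℕ → List ℕ → ℕ
gap j rs = j + count (_≤? j) rs

gap-≥ : ∀ {r} rs j → All (r ≥_) rs → r ≤ j → gap j rs ≡ j + length rs
gap-≥ rs j r≥rs r≤j = cong (λ l → j + length l)
  (filter-all (_≤? j) (All.map (λ r≥x → ℕₚ.≤-trans r≥x r≤j) r≥rs))

gap≤ : ∀ rs j → gap j rs ≤ j + length rs
gap≤ rs j = ℕₚ.+-monoʳ-≤ j (length-filter (_≤? j) rs)

-- If `r ≤ j`, all parts count and the gap lies above every hook length. Otherwise `r` does not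
-- count, the gap stays below the head, and the tail decides.
gap-∉ : ∀ rs j → AllPairs _≥_ rs → gap j rs ∉ firstHooks rs
gap-∉ (r ∷ rs) j (r≥rs ∷ sorted) = split (r ≤? j)
  where
  split : Dec (r ≤ j) → gap j (r ∷ rs) ∉ firstHooks (r ∷ rs)
  split (yes r≤j) g∈ = ℕₚ.<-irrefl refl (ℕₚ.<-≤-trans
    (firstHooks-< (r ∷ rs) (ℕₚ.≤-refl ∷ r≥rs)
      (subst (_∈ firstHooks (r ∷ rs)) (gap-≥ (r ∷ rs) j (ℕₚ.≤-refl ∷ r≥rs) r≤j) g∈))
    (ℕₚ.+-monoˡ-≤ (suc (length rs)) r≤j))
  split (no r≰j) g∈ with subst (_∈ firstHooks (r ∷ rs)) (cong (_+_ j) (count-no (_≤? j) rs r≰j)) g∈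
  ... | here eq   = ℕₚ.<-irrefl eq (ℕₚ.≤-<-trans (gap≤ rs j) (ℕₚ.+-monoˡ-< (length rs) (ℕₚ.≰⇒> r≰j)))
  ... | there g∈′ = gap-∉ rs j sorted g∈′

-- A new first part `r` raises the gaps with index at least `r` by one and leaves the others alone,
-- so exactly the value `r + length rs` is skipped, which is the new hook length. Above it, the
-- index moves down by one.
gap-surjective : ∀ rs k → AllPairs _≥_ rs → k ∉ firstHooks rs → ∃ λ j → gap j rs ≡ k
gap-surjective []       k _               _  = k , ℕₚ.+-identityʳ k
gap-surjective (r ∷ rs) k (r≥rs ∷ sorted) k∉ with gap-surjective rs k sorted (k∉ ∘ there)
... | j , refl with r ≤? j
...   | no  r≰j = j , cong (_+_ j) (count-no (_≤? j) rs r≰j)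
...   | yes r≤j with ℕₚ.m≤n⇒m<n∨m≡n r≤j
...     | inj₂ refl = contradiction (here (gap-≥ rs j r≥rs r≤j)) k∉
...     | inj₁ (s≤s {n = i} r≤i) = i , (begin
  i + count (_≤? i) (r ∷ rs)     ≡⟨ cong (_+_ i) (count-yes (_≤? i) rs r≤i) ⟩
  i + suc (count (_≤? i) rs)     ≡⟨ ℕₚ.+-suc i _ ⟩
  suc (gap i rs)                 ≡⟨ cong suc (gap-≥ rs i r≥rs r≤i) ⟩
  suc i + length rs              ≡⟨ sym (gap-≥ rs (suc i) r≥rs r≤j) ⟩
  gap (suc i) rs                 ∎)
  where open ≡-Reasoning

column+count : ∀ j rs → columnLength j rs + count (_≤? j) rs ≡ length rs
column+count j []       = refl
column+count j (r ∷ rs) = split (j <? r)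
  where
  split : Dec (j < r) → columnLength j (r ∷ rs) + count (_≤? j) (r ∷ rs) ≡ suc (length rs)
  split (yes j<r) = trans
    (cong₂ _+_ (count-yes (j <?_) rs j<r) (count-no (_≤? j) rs (ℕₚ.<⇒≱ j<r)))
    (cong suc (column+count j rs))
  split (no j≮r) = trans
    (cong₂ _+_ (count-no (j <?_) rs j≮r) (count-yes (_≤? j) rs (ℕₚ.≮⇒≥ j≮r)))
    (trans (ℕₚ.+-suc (columnLength j rs) _) (cong suc (column+count j rs)))

-- Hook lengths in the first row are the differences between the head of the beta-set and the gaps
-- below it. This turns a condition on cells into one on the beta-set.
hook+gap : ∀ r rs j → j < r → (r ∸ j) + columnLength j rs + gap j rs ≡ r + length rs
hook+gap r rs j j<r = begin
  (r ∸ j) + columnLength j rs + (j + count (_≤? j) rs)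
    ≡⟨ lemma (r ∸ j) (columnLength j rs) j (count (_≤? j) rs) ⟩
  (r ∸ j + j) + (columnLength j rs + count (_≤? j) rs)
    ≡⟨ cong₂ _+_ (ℕₚ.m∸n+n≡m (ℕₚ.<⇒≤ j<r)) (column+count j rs) ⟩
  r + length rs ∎
  where
  open ≡-Reasoning
  lemma : ∀ a b c d → a + b + (c + d) ≡ (a + c) + (b + d)
  lemma = solveℕ

-- Stated with addition, so elements below `s` impose nothing. In a set of positive numbers the case
-- `k = 0` excludes `s` itself.
ClosedUnder : ℕ → List ℕ → Set
ClosedUnder s hs = ∀ k → k + s ∈ hs → k ∈ hs

noHookInFirstRow⇔ : ∀ s r rs → 0 < s → All (r ≥_) rs → AllPairs _≥_ rs →
  NoHookInFirstRow s r rs ⇔ (∀ k → k + s ≡ r + length rs → k ∈ firstHooks rs)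
noHookInFirstRow⇔ s r rs 0<s r≥rs sorted = mk⇔ to from
  where
  from : (∀ k → k + s ≡ r + length rs → k ∈ firstHooks rs) → NoHookInFirstRow s r rs
  from closed j j<r refl = gap-∉ rs j sorted
    (closed (gap j rs) (trans (ℕₚ.+-comm (gap j rs) _) (hook+gap r rs j j<r)))
  to : NoHookInFirstRow s r rs → ∀ k → k + s ≡ r + length rs → k ∈ firstHooks rs
  to noHook k k+s≡h with k ∈? firstHooks rs
  ... | yes k∈ = k∈
  ... | no  k∉ with gap-surjective rs k sorted k∉
  ...   | j , refl = contradiction
    (ℕₚ.+-cancelʳ-≡ (gap j rs) _ s (trans (hook+gap r rs j j<r) (trans (sym k+s≡h) (ℕₚ.+-comm (gap j rs) s))))
    (noHook j j<r)
    where
    -- For `r ≤ j` the gap would be at least the head `r + length rs`, but it lies `s > 0` below the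
    -- head; so `j` is the column of an actual cell.
    j<r : j < r
    j<r = ℕₚ.≰⇒> λ r≤j → ℕₚ.<-irrefl refl (begin-strict
      r + length rs      ≤⟨ ℕₚ.+-monoˡ-≤ (length rs) r≤j ⟩
      j + length rs      ≡⟨ sym (gap-≥ rs j r≥rs r≤j) ⟩
      gap j rs           <⟨ ℕₚ.m<m+n (gap j rs) 0<s ⟩
      gap j rs + s       ≡⟨ k+s≡h ⟩
      r + length rs      ∎)
      where open ℕₚ.≤-Reasoning

HasNoHook⇔ClosedUnder : ∀ s rs → 0 < s → AllPairs _≥_ rs →
  HasNoHook s rs ⇔ ClosedUnder s (firstHooks rs)
HasNoHook⇔ClosedUnder s []       0<s _ = mk⇔ (λ _ _ ()) (λ _ → [])
HasNoHook⇔ClosedUnder s (r ∷ rs) 0<s (r≥rs ∷ sorted) = mk⇔ to from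
  where
  module First = Equivalence (noHookInFirstRow⇔ s r rs 0<s r≥rs sorted)
  module Rest  = Equivalence (HasNoHook⇔ClosedUnder s rs 0<s sorted)
  module Cons  = Equivalence (HasNoHook-∷ s r rs)
  to : HasNoHook s (r ∷ rs) → ClosedUnder s (firstHooks (r ∷ rs))
  to noHook k (here eq)  = there (First.to (proj₁ (Cons.to noHook)) k eq)
  to noHook k (there k∈) = there (Rest.to (proj₂ (Cons.to noHook)) k k∈)
  descend : ∀ {k} → k < r + length rs → k ∈ firstHooks (r ∷ rs) → k ∈ firstHooks rs
  descend k<h (here refl) = contradiction k<h (ℕₚ.<-irrefl refl)
  descend k<h (there k∈)  = k∈
  from : ClosedUnder s (firstHooks (r ∷ rs)) → HasNoHook s (r ∷ rs)
  from closed = Cons.from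
    ( First.from (λ k eq → descend (subst (k <_) eq (ℕₚ.m<m+n k 0<s)) (closed k (here eq)))
    , Rest.from (λ k k∈ → descend (ℕₚ.<-trans (ℕₚ.m<m+n k 0<s) (firstHooks-< rs r≥rs k∈)) (closed k (there k∈))))

firstHooks-descending : ∀ rs → AllPairs _≥_ rs → AllPairs _>_ (firstHooks rs)
firstHooks-descending []       _               = []
firstHooks-descending (r ∷ rs) (r≥rs ∷ sorted) =
  All.tabulate (firstHooks-< rs r≥rs) ∷ firstHooks-descending rs sorted

firstHooks-positive : ∀ rs → All (0 <_) rs → All (0 <_) (firstHooks rs)
firstHooks-positive []       _            = []
firstHooks-positive (r ∷ rs) (0<r ∷ 0<rs) =
  ℕₚ.<-≤-trans 0<r (ℕₚ.m≤m+n r (length rs)) ∷ firstHooks-positive rs 0<rs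

fromHooks : List ℕ → List ℕ
fromHooks []       = []
fromHooks (h ∷ hs) = h ∸ length hs ∷ fromHooks hs

length-firstHooks : ∀ rs → length (firstHooks rs) ≡ length rs
length-firstHooks []       = refl
length-firstHooks (r ∷ rs) = cong suc (length-firstHooks rs)

length-fromHooks : ∀ hs → length (fromHooks hs) ≡ length hs
length-fromHooks []       = refl
length-fromHooks (h ∷ hs) = cong suc (length-fromHooks hs)

fromHooks-firstHooks : ∀ rs → fromHooks (firstHooks rs) ≡ rs
fromHooks-firstHooks []       = refl
fromHooks-firstHooks (r ∷ rs) = cong₂ _∷_
  (trans (cong (r + length rs ∸_) (length-firstHooks rs)) (ℕₚ.m+n∸n≡m r (length rs)))
  (fromHooks-firstHooks rs)

-- Distinct positive numbers below `h` are fewer than `h`. Hence the subtraction in `fromHooks`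
-- never truncates and yields positive parts.
length<head : ∀ h hs → AllPairs _>_ (h ∷ hs) → All (0 <_) (h ∷ hs) → length hs < h
length<head h []       _                       (0<h ∷ _)   = 0<h
length<head h (x ∷ hs) ((h>x ∷ _) ∷ descending) (_ ∷ 0<xs) =
  ℕₚ.≤-<-trans (length<head x hs descending 0<xs) h>x

firstHooks-fromHooks : ∀ hs → AllPairs _>_ hs → All (0 <_) hs → firstHooks (fromHooks hs) ≡ hs
firstHooks-fromHooks []       _                     _              = refl
firstHooks-fromHooks (h ∷ hs) d@(_ ∷ descending) p@(_ ∷ positive) = cong₂ _∷_
  (trans (cong (_+_ (h ∸ length hs)) (length-fromHooks hs)) (ℕₚ.m∸n+n≡m (ℕₚ.<⇒≤ (length<head h hs d p))))
  (firstHooks-fromHooks hs descending positive)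

fromHooks-IsPartition : ∀ hs → AllPairs _>_ hs → All (0 <_) hs → IsPartition (fromHooks hs)
fromHooks-IsPartition hs descending positive = isPartition (pos hs descending positive) (dec hs descending)
  where
  pos : ∀ hs → AllPairs _>_ hs → All (0 <_) hs → All (0 <_) (fromHooks hs)
  pos []       _               _           = []
  pos (h ∷ hs) d@(_ ∷ ds) p@(_ ∷ ps) = ℕₚ.m<n⇒0<n∸m (length<head h hs d p) ∷ pos hs ds ps
  dec : ∀ hs → AllPairs _>_ hs → Linked _≥_ (fromHooks hs)
  dec []           _                     = []
  dec (h ∷ [])     _                     = [-]
  dec (h ∷ x ∷ hs) ((h>x ∷ _) ∷ descending) =
    ℕₚ.∸-monoˡ-≤ (suc (length hs)) h>x ∷ dec (x ∷ hs) descending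

-- Each hook length exceeds its part by the number of later parts, and these numbers add up to
-- `m (m - 1) / 2`.
twice-size : ∀ rs → let m = + length rs in
  + 2 *ᶻ + size rs ≡ + 2 *ᶻ ∑∈ (firstHooks rs) (λ h → + h) -ᶻ m *ᶻ (m -ᶻ 1ℤ)
twice-size []       = refl
twice-size (r ∷ rs) = begin
  + 2 *ᶻ (+ r +ᶻ + size rs)                ≡⟨ ℤₚ.*-distribˡ-+ (+ 2) (+ r) (+ size rs) ⟩
  + 2 *ᶻ + r +ᶻ + 2 *ᶻ + size rs           ≡⟨ cong (+ 2 *ᶻ + r +ᶻ_) (twice-size rs) ⟩
  + 2 *ᶻ + r +ᶻ (+ 2 *ᶻ H -ᶻ m *ᶻ (m -ᶻ 1ℤ)) ≡⟨ lemma (+ r) H m ⟩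
  + 2 *ᶻ (+ r +ᶻ m +ᶻ H) -ᶻ (1ℤ +ᶻ m) *ᶻ (1ℤ +ᶻ m -ᶻ 1ℤ) ∎
  where
  open ≡-Reasoning
  H = ∑∈ (firstHooks rs) (λ h → + h)
  m = + length rs
  lemma : ∀ r H m → + 2 *ᶻ r +ᶻ (+ 2 *ᶻ H -ᶻ m *ᶻ (m -ᶻ 1ℤ))
    ≡ + 2 *ᶻ (r +ᶻ m +ᶻ H) -ᶻ (1ℤ +ᶻ m) *ᶻ (1ℤ +ᶻ m -ᶻ 1ℤ)
  lemma = solve-∀

-- Sets of hook lengths of simultaneous cores

descending-ext : ∀ xs ys → AllPairs _>_ xs → AllPairs _>_ ys →
  (∀ {k} → k ∈ xs → k ∈ ys) → (∀ {k} → k ∈ ys → k ∈ xs) → xs ≡ ys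
descending-ext []       []       _          _          _    _    = refl
descending-ext []       (y ∷ ys) _          _          _    back with () ← back (here refl)
descending-ext (x ∷ xs) []       _          _          forth _   with () ← forth (here refl)
descending-ext (x ∷ xs) (y ∷ ys) (x> ∷ xs>) (y> ∷ ys>) forth back with heads (forth (here refl)) (back (here refl))
  where
  heads : x ∈ y ∷ ys → y ∈ x ∷ xs → x ≡ y
  heads (here eq)   _          = eq
  heads (there _)   (here eq)  = sym eq
  heads (there x∈)  (there y∈) = contradiction (All.lookup x> y∈) (ℕₚ.<-asym (All.lookup y> x∈))
... | refl = cong (x ∷_) (descending-ext xs ys xs> ys> (tails x> forth) (tails y> back))
  where
  tails : ∀ {us vs} → All (x >_) us → (∀ {k} → k ∈ x ∷ us → k ∈ x ∷ vs) → ∀ {k} → k ∈ us → k ∈ vs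
  tails x> f k∈ with f (there k∈)
  ... | here refl = contradiction (All.lookup x> k∈) (ℕₚ.<-irrefl refl)
  ... | there k∈′ = k∈′

∈⇒≤sum : ∀ {k} xs → k ∈ xs → k ≤ sum xs
∈⇒≤sum (x ∷ xs) (here refl) = ℕₚ.m≤m+n x (sum xs)
∈⇒≤sum (x ∷ xs) (there k∈)  = ℕₚ.≤-trans (∈⇒≤sum xs k∈) (ℕₚ.m≤n+m (sum xs) x)

threshold : ∀ K {P : ℕ → Set} → Decidable P → (∀ q → P (suc q) → P q) → (∀ q → P q → q < K) →
  ∃ λ a → ∀ q → P q ⇔ q < a
threshold zero    P? down bound = 0 , λ q → mk⇔ (bound q) (λ ())
threshold (suc K) {P} P? down bound with P? 0
... | no ¬P0 = 0 , λ q → mk⇔ (λ p → contradiction (toZero q p) ¬P0) (λ ())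
  where
  toZero : ∀ q → P q → P 0
  toZero zero    p = p
  toZero (suc q) p = toZero q (down q p)
... | yes P0 with threshold K (P? ∘ suc) (down ∘ suc) (λ q p → ℕₚ.≤-pred (bound (suc q) p))
...   | a , P⇔ = suc a , λ where
  zero    → mk⇔ (λ _ → s≤s z≤n) (λ _ → P0)
  (suc q) → mk⇔ (s≤s ∘ Equivalence.to (P⇔ q)) (Equivalence.from (P⇔ q) ∘ ℕₚ.≤-pred)

∑∈-downFrom : ∀ n (f : ℕ → ℤ) → ∑∈ (downFrom n) f ≡ ∑ n f
∑∈-downFrom zero    f = refl
∑∈-downFrom (suc n) f =
  trans (cong (f n +ᶻ_) (∑∈-downFrom n f)) (trans (ℤₚ.+-comm (f n) (∑ n f)) (sym (∑-snoc n f)))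

∑-rectangle : ∀ m n (f : ℕ → ℤ) → ∑ (m * n) f ≡ ∑ m (λ q → ∑ n (λ r → f (r + q * n)))
∑-rectangle zero    n f = refl
∑-rectangle (suc m) n f = trans (∑-split n (m * n) f) (cong₂ _+ᶻ_
  (∑-cong n (λ r _ → cong f (sym (ℕₚ.+-identityʳ r))))
  (trans (∑-rectangle m n (λ i → f (n + i)))
    (∑-cong m (λ q _ → ∑-cong n (λ r _ → cong f (lemma n r (q * n)))))))
  where
  lemma : ∀ n r x → n + (r + x) ≡ r + (n + x)
  lemma = solveℕ

∑-indicator-< : ∀ n a (f : ℕ → ℤ) → a ≤ n → ∑ n (λ q → indicator (q <? a) *ᶻ f q) ≡ ∑ a f
∑-indicator-< zero    zero    f _         = refl
∑-indicator-< (suc n) zero    f _         = trans (ℤₚ.+-identityˡ _) (∑-indicator-< n zero (f ∘ suc) z≤n)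
∑-indicator-< (suc n) (suc a) f (s≤s a≤n) =
  cong₂ _+ᶻ_ (ℤₚ.*-identityˡ (f 0)) (∑-indicator-< n a (f ∘ suc) a≤n)

module _ (s : ℕ) .{{_ : NonZero s}} where

  [r+qs]%s : ∀ {r} q → r < s → (r + q * s) % s ≡ r
  [r+qs]%s {r} q r<s = trans ([m+kn]%n≡m%n r q s) (m<n⇒m%n≡m r<s)

  [r+qs]/s : ∀ {r} q → r < s → (r + q * s) /ℕ s ≡ q
  [r+qs]/s {r} q r<s = trans (+-distrib-/-∣ʳ r (n∣m*n q)) (cong₂ _+_ (m<n⇒m/n≡0 r<s) (m*n/n≡m q s))

  -- The first-column hook lengths congruent to r modulo s are to be r, r + s, …, r + (a r - 1) s.
  hooksBelow : (ℕ → ℕ) → List ℕ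
  hooksBelow a = filter (λ n → n /ℕ s <? a (n % s)) (downFrom (s * s))

  -- `start` says that the multiples of `s` are absent, as 0 is. `step` is closure under subtracting
  -- `s + 1`, because `(r + 1) + (q + 1) s - (s + 1) = r + q s`.
  record Admissible (a : ℕ → ℕ) : Set where
    field
      start : a 0 ≡ 0
      step  : ∀ r → suc r < s → a (suc r) ≤ suc (a r)

    bound : ∀ r → r < s → a r ≤ r
    bound zero    _     = ℕₚ.≤-reflexive start
    bound (suc r) 1+r<s = ℕₚ.≤-trans (step r 1+r<s) (s≤s (bound r (ℕₚ.<⇒≤ 1+r<s)))

  open Admissible

  hooksBelow-descending : ∀ a → AllPairs _>_ (hooksBelow a)
  hooksBelow-descending a = AllPairs.filter⁺ (λ n → n /ℕ s <? a (n % s))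
    (AllPairs.applyDownFrom⁺₁ id (s * s) (λ j<i _ → j<i))

  hooksBelow-cong : ∀ {a b} → (∀ r → r < s → a r ≡ b r) → hooksBelow a ≡ hooksBelow b
  hooksBelow-cong eq = filter-≐ _ _
    ( (λ {n} → subst (n /ℕ s <_) (eq (n % s) (m%n<n n s)))
    , (λ {n} → subst (n /ℕ s <_) (sym (eq (n % s) (m%n<n n s))))) (downFrom (s * s))

  ∈-hooksBelow⁻ : ∀ a {r} q → r < s → r + q * s ∈ hooksBelow a → q < a r
  ∈-hooksBelow⁻ a {r} q r<s n∈ = subst₂ (λ i j → i < a j) ([r+qs]/s q r<s) ([r+qs]%s q r<s)
    (proj₂ (∈-filter⁻ (λ n → n /ℕ s <? a (n % s)) {xs = downFrom (s * s)} n∈))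

  module _ {a : ℕ → ℕ} (adm : Admissible a) where

    ∈-hooksBelow⁺ : ∀ {r} q → r < s → q < a r → r + q * s ∈ hooksBelow a
    ∈-hooksBelow⁺ {r} q r<s q<a = ∈-filter⁺ (λ n → n /ℕ s <? a (n % s)) (∈-downFrom⁺ n<ss)
      (subst₂ (λ i j → i < a j) (sym ([r+qs]/s q r<s)) (sym ([r+qs]%s q r<s)) q<a)
      where
      -- The bound `a r ≤ r` is what makes the cut-off `s * s` in `hooksBelow` large enough.
      n<ss : r + q * s < s * s
      n<ss = ℕₚ.<-≤-trans (ℕₚ.+-monoˡ-< (q * s) r<s)
        (ℕₚ.*-monoˡ-≤ s (ℕₚ.≤-trans q<a (ℕₚ.≤-trans (bound adm r r<s) (ℕₚ.<⇒≤ r<s))))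

    hooksBelow-positive : All (0 <_) (hooksBelow a)
    hooksBelow-positive = All.tabulate λ
      { {zero}  0∈ → contradiction (subst (0 <_) (start adm) (∈-hooksBelow⁻ a {0} 0 (ℕₚ.≤-<-trans z≤n (m%n<n 0 s)) 0∈)) λ ()
      ; {suc k} _  → s≤s z≤n }

    hooksBelow-closed : ClosedUnder s (hooksBelow a)
    hooksBelow-closed k k+s∈ = subst (_∈ hooksBelow a) (sym k≡) (∈-hooksBelow⁺ q (m%n<n k s)
      (ℕₚ.<-trans (ℕₚ.n<1+n q) (∈-hooksBelow⁻ a (suc q) (m%n<n k s)
        (subst (_∈ hooksBelow a) (trans (cong (_+ s) k≡) (lemma (k % s) (q * s) s)) k+s∈))))
      where
      q = k /ℕ s
      k≡ : k ≡ k % s + q * s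
      k≡ = m≡m%n+[m/n]*n k s
      lemma : ∀ a b c → a + b + c ≡ a + (c + b)
      lemma = solveℕ

    hooksBelow-closed-suc : ClosedUnder (suc s) (hooksBelow a)
    hooksBelow-closed-suc k n∈ =
      go ((k + suc s) % s) ((k + suc s) /ℕ s) (m%n<n (k + suc s) s) (m≡m%n+[m/n]*n (k + suc s) s)
      where
      go : ∀ r q → r < s → k + suc s ≡ r + q * s → k ∈ hooksBelow a
      go r q r<s eq with ∈-hooksBelow⁻ a q r<s (subst (_∈ hooksBelow a) eq n∈)
      go zero    q       r<s eq | q<a = contradiction (subst (q <_) (start adm) q<a) λ ()
      go (suc r) zero    r<s eq | q<a = contradiction r<s (ℕₚ.<⇒≯ (ℕₚ.≤-trans (ℕₚ.m≤n+m (suc s) k)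
        (ℕₚ.≤-reflexive (trans eq (ℕₚ.+-identityʳ (suc r))))))
      go (suc r) (suc q) r<s eq | q<a = subst (_∈ hooksBelow a) (sym k≡)
        (∈-hooksBelow⁺ q (ℕₚ.<⇒≤ r<s) (ℕₚ.≤-pred (ℕₚ.<-≤-trans q<a (step adm r r<s))))
        where
        k≡ : k ≡ r + q * s
        k≡ = ℕₚ.+-cancelʳ-≡ (suc s) k _ (trans eq (lemma r s (q * s)))
          where
          lemma : ∀ r s x → suc r + (s + x) ≡ r + x + suc s
          lemma = solveℕ

    ∑∈-hooksBelow : ∀ (f : ℕ → ℤ) →
      ∑∈ (hooksBelow a) f ≡ ∑ s (λ r → ∑ (a r) (λ q → f (r + q * s)))
    ∑∈-hooksBelow f = begin
      ∑∈ (hooksBelow a) f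
        ≡⟨ ∑∈-filter (λ n → n /ℕ s <? a (n % s)) (downFrom (s * s)) f ⟩
      ∑∈ (downFrom (s * s)) (λ n → indicator (n /ℕ s <? a (n % s)) *ᶻ f n)
        ≡⟨ ∑∈-downFrom (s * s) _ ⟩
      ∑ (s * s) (λ n → indicator (n /ℕ s <? a (n % s)) *ᶻ f n)
        ≡⟨ ∑-rectangle s s _ ⟩
      ∑ s (λ q → ∑ s (λ r → indicator ((r + q * s) /ℕ s <? a ((r + q * s) % s)) *ᶻ f (r + q * s)))
        ≡⟨ ∑-cong s (λ q _ → ∑-cong s (λ r r<s → cong₂ (λ i j → indicator (i <? a j) *ᶻ f (r + q * s))
             ([r+qs]/s q r<s) ([r+qs]%s q r<s))) ⟩
      ∑ s (λ q → ∑ s (λ r → indicator (q <? a r) *ᶻ f (r + q * s)))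
        ≡⟨ ∑-swap s s _ ⟩
      ∑ s (λ r → ∑ s (λ q → indicator (q <? a r) *ᶻ f (r + q * s)))
        ≡⟨ ∑-cong s (λ r r<s → ∑-indicator-< s (a r) (λ q → f (r + q * s))
             (ℕₚ.≤-trans (bound adm r r<s) (ℕₚ.<⇒≤ r<s))) ⟩
      ∑ s (λ r → ∑ (a r) (λ q → f (r + q * s))) ∎
      where open ≡-Reasoning

  hooksBelow-surjective : ∀ hs → AllPairs _>_ hs → All (0 <_) hs →
    ClosedUnder s hs → ClosedUnder (suc s) hs → ∃ λ a → Admissible a × hs ≡ hooksBelow a
  hooksBelow-surjective hs descending positive closed closed-suc =
    a , adm , descending-ext hs (hooksBelow a) descending (hooksBelow-descending a) forth back
    where
    profile : ∀ r → ∃ λ a → ∀ q → (r + q * s ∈ hs) ⇔ q < a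
    profile r = threshold (suc (sum hs)) (λ q → r + q * s ∈? hs)
      (λ q n∈ → closed (r + q * s) (subst (_∈ hs) (lemma r s (q * s)) n∈))
      (λ q n∈ → s≤s (ℕₚ.≤-trans (ℕₚ.≤-trans (ℕₚ.m≤m*n q s) (ℕₚ.m≤n+m (q * s) r)) (∈⇒≤sum hs n∈)))
      where
      lemma : ∀ a b c → a + (b + c) ≡ a + c + b
      lemma = solveℕ
    a : ℕ → ℕ
    a r = proj₁ (profile r)
    to : ∀ r q → r + q * s ∈ hs → q < a r
    to r q = Equivalence.to (proj₂ (profile r) q)
    from : ∀ r q → q < a r → r + q * s ∈ hs
    from r q = Equivalence.from (proj₂ (profile r) q)
    step′ : ∀ r → a (suc r) ≤ suc (a r)
    step′ r with a (suc r) in eq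
    ... | zero        = z≤n
    ... | suc zero    = s≤s z≤n
    -- The topmost element of the class of `r + 1` is `(r + 1) + (q + 1) s`; subtracting `s + 1`
    -- puts `r + q s` into the set.
    ... | suc (suc q) = s≤s (to r q (closed-suc (r + q * s) (subst (_∈ hs) (lemma r s (q * s))
      (from (suc r) (suc q) (subst (suc q <_) (sym eq) (ℕₚ.n<1+n (suc q)))))))
      where
      lemma : ∀ r s x → suc r + (s + x) ≡ r + x + suc s
      lemma = solveℕ
    adm : Admissible a
    adm = record
      { start = ℕₚ.n≤0⇒n≡0 (ℕₚ.≮⇒≥ λ 0<a0 → ℕₚ.<-irrefl refl (All.lookup positive (from 0 0 0<a0)))
      ; step  = λ r _ → step′ r }
    forth : ∀ {k} → k ∈ hs → k ∈ hooksBelow a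
    forth {k} k∈ = subst (_∈ hooksBelow a) (sym k≡) (∈-hooksBelow⁺ adm (k /ℕ s) (m%n<n k s)
      (to (k % s) (k /ℕ s) (subst (_∈ hs) k≡ k∈)))
      where k≡ = m≡m%n+[m/n]*n k s
    back : ∀ {k} → k ∈ hooksBelow a → k ∈ hs
    back {k} k∈ = subst (_∈ hs) (sym k≡) (from (k % s) (k /ℕ s)
      (∈-hooksBelow⁻ a (k /ℕ s) (m%n<n k s) (subst (_∈ hooksBelow a) k≡ k∈)))
      where k≡ = m≡m%n+[m/n]*n k s

-- Dyck compositions and cores

-- The natural-number version of `height`; the Dyck condition prevents truncation at the indices
-- below `s`.
depth : List ℕ → ℕ → ℕ
depth z r = r ∸ partialSum z r

partialSum-mono : ∀ z r → partialSum z r ≤ partialSum z (suc r)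
partialSum-mono z       zero    = z≤n
partialSum-mono []      (suc r) = z≤n
partialSum-mono (x ∷ z) (suc r) = ℕₚ.+-monoʳ-≤ x (partialSum-mono z r)

partialSum-injective : ∀ y z → length y ≡ length z →
  (∀ r → r ≤ length y → partialSum y r ≡ partialSum z r) → y ≡ z
partialSum-injective []      []      _  _  = refl
partialSum-injective (x ∷ y) (w ∷ z) ly eq with trans (sym (ℕₚ.+-identityʳ x)) (trans (eq 1 (s≤s z≤n)) (ℕₚ.+-identityʳ w))
... | refl = cong (x ∷_) (partialSum-injective y z (ℕₚ.suc-injective ly)
  (λ r r≤y → ℕₚ.+-cancelˡ-≡ x _ _ (eq (suc r) (s≤s r≤y))))

-- Inverts the passage from `z` to its heights by reading each part off as `a r + 1 - a (r + 1)`.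
-- The value `a 0` is left arbitrary so that the induction can drop the first step.
fromDepth : ∀ n (a : ℕ → ℕ) → (∀ r → r < n → a (suc r) ≤ suc (a r)) → ∃ λ z →
  length z ≡ suc n × sum z ≡ suc (suc n) + a 0 × (∀ r → r ≤ n → partialSum z r + a r ≡ r + a 0)
-- The last part has to bring the height from `a 0` down to `-1`, hence its value `a 0 + 2`.
fromDepth zero    a step = (2 + a 0) ∷ [] , refl , ℕₚ.+-identityʳ (2 + a 0) , λ { zero _ → refl }
fromDepth (suc n) a step with fromDepth n (a ∘ suc) (λ r r<n → step (suc r) (s≤s r<n))
... | z , lz , sz , pz = x ∷ z , cong suc lz , sz′ , pz′
  where
  x = suc (a 0) ∸ a 1
  x+a₁ : x + a 1 ≡ suc (a 0)
  x+a₁ = ℕₚ.m∸n+n≡m (step 0 (s≤s z≤n))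
  exchange : ∀ x m a → x + (m + a) ≡ m + (x + a)
  exchange = solveℕ
  sz′ : x + sum z ≡ suc (suc (suc n)) + a 0
  sz′ = trans (cong (_+_ x) sz) (trans (exchange x (suc (suc n)) (a 1))
    (trans (cong (_+_ (suc (suc n))) x+a₁) (ℕₚ.+-suc (suc (suc n)) (a 0))))
  pz′ : ∀ r → r ≤ suc n → partialSum (x ∷ z) r + a r ≡ r + a 0
  pz′ zero    _         = refl
  pz′ (suc r) (s≤s r≤n) = trans (ℕₚ.+-assoc x (partialSum z r) (a (suc r)))
    (trans (cong (_+_ x) (pz r r≤n)) (trans (exchange x r (a 1))
    (trans (cong (_+_ r) x+a₁) (ℕₚ.+-suc r (a 0)))))

-- Injectivity is asked on members only, because that of `core` is established for Dyck
-- compositions.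
Unique-map-∈ : ∀ {A B : Set} (f : A → B) xs → (∀ {x y} → x ∈ xs → y ∈ xs → f x ≡ f y → x ≡ y) →
  Unique xs → Unique (map f xs)
Unique-map-∈ f []       inj []              = []
Unique-map-∈ f (x ∷ xs) inj (x∉ ∷ unique) =
  All.map⁺ (All.tabulate λ y∈ eq → All.lookup x∉ y∈ (inj (here refl) (there y∈) eq))
  ∷ Unique-map-∈ f xs (λ x∈ y∈ → inj (there x∈) (there y∈)) unique

module _ (n : ℕ) where

  private s = suc n

  open Admissible

  ∈-dyck⁻ : ∀ {z} → z ∈ dyckCompositions s → length z ≡ s × sum z ≡ suc s × Dyck z
  ∈-dyck⁻ z∈ with ∈-filter⁻ Dyck? {xs = compositions s (suc s)} z∈
  ... | z∈C , d with ∈-compositions⁻ s (suc s) z∈C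
  ...   | lz , sz = lz , sz , d

  depth-admissible : ∀ z → length z ≡ s → Dyck z → Admissible s (depth z)
  depth-admissible z lz d = record { start = refl ; step = step′ }
    where
    step′ : ∀ r → suc r < s → depth z (suc r) ≤ suc (depth z r)
    step′ r 1+r<s = ℕₚ.≤-trans (ℕₚ.∸-monoʳ-≤ (suc r) (partialSum-mono z r))
      (ℕₚ.≤-reflexive (ℕₚ.+-∸-assoc 1 (d r (subst (r <_) (sym lz) (ℕₚ.<⇒≤ 1+r<s)))))

  core : List ℕ → List ℕ
  core z = fromHooks (hooksBelow s (depth z))

  module _ {z} (z∈ : z ∈ dyckCompositions s) where

    private
      lz = proj₁ (∈-dyck⁻ z∈)
      sz = proj₁ (proj₂ (∈-dyck⁻ z∈))
      dyck = proj₂ (proj₂ (∈-dyck⁻ z∈))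
      adm = depth-admissible z lz dyck
      desc = hooksBelow-descending s (depth z)
      pos = hooksBelow-positive s adm

    firstHooks-core : firstHooks (core z) ≡ hooksBelow s (depth z)
    firstHooks-core = firstHooks-fromHooks (hooksBelow s (depth z)) desc pos

    core-IsCore₂ : IsCore₂ s (suc s) (core z)
    core-IsCore₂ = (isP , hasNoHook s (s≤s z≤n) (hooksBelow-closed s adm))
                 , (isP , hasNoHook (suc s) (s≤s z≤n) (hooksBelow-closed-suc s adm))
      where
      isP = fromHooks-IsPartition (hooksBelow s (depth z)) desc pos
      hasNoHook : ∀ t → 0 < t → ClosedUnder t (hooksBelow s (depth z)) → HasNoHook t (core z)
      hasNoHook t 0<t closed = Equivalence.from
        (HasNoHook⇔ClosedUnder t (core z) 0<t
          (Linked⇒AllPairs (λ x≥y y≥z → ℕₚ.≤-trans y≥z x≥y) (IsPartition.weaklyDecreasing isP)))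
        (subst (ClosedUnder t) (sym firstHooks-core) closed)

    -- Summing the beta-set by residue classes gives `twiceSize` with `depth` in place of `height`;
    -- the two agree since `z` is Dyck.
    core-size : + 2 *ᶻ + size (core z) ≡ twiceSize s (height z)
    core-size = begin
      + 2 *ᶻ + size (core z)
        ≡⟨ twice-size (core z) ⟩
      + 2 *ᶻ ∑∈ (firstHooks (core z)) (λ h → + h) -ᶻ m *ᶻ (m -ᶻ 1ℤ)
        ≡⟨ cong₂ (λ hs m → + 2 *ᶻ ∑∈ hs (λ h → + h) -ᶻ m *ᶻ (m -ᶻ 1ℤ)) firstHooks-core m≡ ⟩
      + 2 *ᶻ ∑∈ (hooksBelow s a) (λ h → + h) -ᶻ ∑ s h *ᶻ (∑ s h -ᶻ 1ℤ)
        ≡⟨ cong (λ x → + 2 *ᶻ x -ᶻ ∑ s h *ᶻ (∑ s h -ᶻ 1ℤ)) (∑∈-hooksBelow s adm (λ h → + h)) ⟩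
      + 2 *ᶻ ∑ s (λ r → ∑ (a r) (λ q → + (r + q * s))) -ᶻ ∑ s h *ᶻ (∑ s h -ᶻ 1ℤ)
        ≡⟨ cong (_-ᶻ ∑ s h *ᶻ (∑ s h -ᶻ 1ℤ)) hooks≡ ⟩
      + s *ᶻ ∑ s (λ r → h r *ᶻ h r -ᶻ h r) +ᶻ + 2 *ᶻ ∑ s (λ r → + r *ᶻ h r) -ᶻ ∑ s h *ᶻ (∑ s h -ᶻ 1ℤ) ∎
      where
      open ≡-Reasoning
      a = depth z
      h = height z
      m = + length (core z)
      a≡h : ∀ r → r < s → + a r ≡ h r
      a≡h r r<s = sym (trans (ℤₚ.m-n≡m⊖n r (partialSum z r)) (ℤₚ.⊖-≥ (dyck r (subst (r <_) (sym lz) r<s))))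
      m≡ : m ≡ ∑ s h
      m≡ = begin
        + length (core z)                       ≡⟨ cong +_ (length-fromHooks (hooksBelow s a)) ⟩
        + length (hooksBelow s a)               ≡⟨ length-∑∈ (hooksBelow s a) ⟩
        ∑∈ (hooksBelow s a) (λ _ → 1ℤ)          ≡⟨ ∑∈-hooksBelow s adm (λ _ → 1ℤ) ⟩
        ∑ s (λ r → ∑ (a r) (λ _ → 1ℤ))          ≡⟨ ∑-cong s (λ r r<s → trans (∑-const (a r) 1ℤ) (trans (ℤₚ.*-identityʳ (+ a r)) (a≡h r r<s))) ⟩
        ∑ s h                                   ∎
      column : ∀ r → + 2 *ᶻ ∑ (a r) (λ q → + (r + q * s))
        ≡ + s *ᶻ (+ a r *ᶻ + a r -ᶻ + a r) +ᶻ + 2 *ᶻ (+ r *ᶻ + a r)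
      column r = begin
        + 2 *ᶻ ∑ (a r) (λ q → + (r + q * s))
          ≡⟨ cong (+ 2 *ᶻ_) (∑-cong (a r) (λ q _ → cong (+ r +ᶻ_) (trans (ℤₚ.pos-* q s) (ℤₚ.*-comm (+ q) (+ s))))) ⟩
        + 2 *ᶻ ∑ (a r) (λ q → + r +ᶻ + s *ᶻ + q)
          ≡⟨ cong (+ 2 *ᶻ_) (trans (∑-+ (a r) (λ _ → + r) (λ q → + s *ᶻ + q))
               (cong₂ _+ᶻ_ (∑-const (a r) (+ r)) (∑-*ˡ (a r) (+ s) (λ q → + q)))) ⟩
        + 2 *ᶻ (+ a r *ᶻ + r +ᶻ + s *ᶻ Δ (a r))
          ≡⟨ lem₁ (+ a r) (+ r) (+ s) (Δ (a r)) ⟩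
        + s *ᶻ (+ 2 *ᶻ Δ (a r)) +ᶻ + 2 *ᶻ (+ r *ᶻ + a r)
          ≡⟨ cong (λ x → + s *ᶻ x +ᶻ + 2 *ᶻ (+ r *ᶻ + a r)) (trans (2Δ (a r)) (lem₂ (+ a r))) ⟩
        + s *ᶻ (+ a r *ᶻ + a r -ᶻ + a r) +ᶻ + 2 *ᶻ (+ r *ᶻ + a r) ∎
        where
        lem₁ : ∀ a r s d → + 2 *ᶻ (a *ᶻ r +ᶻ s *ᶻ d) ≡ s *ᶻ (+ 2 *ᶻ d) +ᶻ + 2 *ᶻ (r *ᶻ a)
        lem₁ = solve-∀
        lem₂ : ∀ a → a *ᶻ (a -ᶻ 1ℤ) ≡ a *ᶻ a -ᶻ a
        lem₂ = solve-∀
      hooks≡ : + 2 *ᶻ ∑ s (λ r → ∑ (a r) (λ q → + (r + q * s)))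
        ≡ + s *ᶻ ∑ s (λ r → h r *ᶻ h r -ᶻ h r) +ᶻ + 2 *ᶻ ∑ s (λ r → + r *ᶻ h r)
      hooks≡ = begin
        + 2 *ᶻ ∑ s (λ r → ∑ (a r) (λ q → + (r + q * s)))
          ≡⟨ sym (∑-*ˡ s (+ 2) (λ r → ∑ (a r) (λ q → + (r + q * s)))) ⟩
        ∑ s (λ r → + 2 *ᶻ ∑ (a r) (λ q → + (r + q * s)))
          ≡⟨ ∑-cong s (λ r r<s → trans (column r)
               (cong (λ x → + s *ᶻ (x *ᶻ x -ᶻ x) +ᶻ + 2 *ᶻ (+ r *ᶻ x)) (a≡h r r<s))) ⟩
        ∑ s (λ r → + s *ᶻ (h r *ᶻ h r -ᶻ h r) +ᶻ + 2 *ᶻ (+ r *ᶻ h r))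
          ≡⟨ ∑-+ s (λ r → + s *ᶻ (h r *ᶻ h r -ᶻ h r)) (λ r → + 2 *ᶻ (+ r *ᶻ h r)) ⟩
        ∑ s (λ r → + s *ᶻ (h r *ᶻ h r -ᶻ h r)) +ᶻ ∑ s (λ r → + 2 *ᶻ (+ r *ᶻ h r))
          ≡⟨ cong₂ _+ᶻ_ (∑-*ˡ s (+ s) (λ r → h r *ᶻ h r -ᶻ h r)) (∑-*ˡ s (+ 2) (λ r → + r *ᶻ h r)) ⟩
        + s *ᶻ ∑ s (λ r → h r *ᶻ h r -ᶻ h r) +ᶻ + 2 *ᶻ ∑ s (λ r → + r *ᶻ h r) ∎

  core-injective : ∀ {y z} → y ∈ dyckCompositions s → z ∈ dyckCompositions s → core y ≡ core z → y ≡ z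
  core-injective {y} {z} y∈ z∈ eq with ∈-dyck⁻ y∈ | ∈-dyck⁻ z∈
  ... | ly , sy , dy | lz , sz , dz = partialSum-injective y z (trans ly (sym lz)) λ r r≤y →
    sums r (ℕₚ.m≤n⇒m<n∨m≡n (subst (r ≤_) ly r≤y))
    where
    open ≡-Reasoning
    hooks≡ : hooksBelow s (depth y) ≡ hooksBelow s (depth z)
    hooks≡ = trans (sym (firstHooks-core y∈)) (trans (cong firstHooks eq) (firstHooks-core z∈))
    depth≤ : ∀ {y z} → length y ≡ s → Dyck y → hooksBelow s (depth y) ≡ hooksBelow s (depth z) →
      ∀ r → r < s → depth y r ≤ depth z r
    depth≤ {y} {z} ly dy hooks≡ r r<s = ℕₚ.≮⇒≥ λ z<y → ℕₚ.<-irrefl refl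
      (∈-hooksBelow⁻ s (depth z) (depth z r) r<s
        (subst (r + depth z r * s ∈_) hooks≡
          (∈-hooksBelow⁺ s (depth-admissible y ly dy) (depth z r) r<s z<y)))
    sums : ∀ r → r < s ⊎ r ≡ s → partialSum y r ≡ partialSum z r
    sums r (inj₁ r<s) = begin
      partialSum y r                ≡⟨ sym (ℕₚ.m∸[m∸n]≡n (dy r (subst (r <_) (sym ly) r<s))) ⟩
      r ∸ depth y r                 ≡⟨ cong (r ∸_) (ℕₚ.≤-antisym (depth≤ {y} {z} ly dy hooks≡ r r<s) (depth≤ {z} {y} lz dz (sym hooks≡) r r<s)) ⟩
      r ∸ depth z r                 ≡⟨ ℕₚ.m∸[m∸n]≡n (dz r (subst (r <_) (sym lz) r<s)) ⟩
      partialSum z r                ∎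
    -- The depths below `s` do not determine the partial sum at `s`; there both equal the prescribed
    -- total.
    sums r (inj₂ r≡s) = begin
      partialSum y r                ≡⟨ cong (partialSum y) (trans r≡s (sym ly)) ⟩
      partialSum y (length y)       ≡⟨ trans (partialSum-length y) (trans sy (sym (trans (partialSum-length z) sz))) ⟩
      partialSum z (length z)       ≡⟨ cong (partialSum z) (trans lz (sym r≡s)) ⟩
      partialSum z r                ∎

  core-surjective : ∀ p → IsCore₂ s (suc s) p → ∃ λ z → z ∈ dyckCompositions s × p ≡ core z
  core-surjective p ((isP , noHook) , (_ , noHook-suc)) = z , z∈ , p≡
    where
    open IsPartition isP
    sorted : AllPairs _≥_ p
    sorted = Linked⇒AllPairs (λ x≥y y≥z → ℕₚ.≤-trans y≥z x≥y) weaklyDecreasing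
    profile = hooksBelow-surjective s (firstHooks p)
      (firstHooks-descending p sorted) (firstHooks-positive p positive)
      (Equivalence.to (HasNoHook⇔ClosedUnder s p (s≤s z≤n) sorted) noHook)
      (Equivalence.to (HasNoHook⇔ClosedUnder (suc s) p (s≤s z≤n) sorted) noHook-suc)
    a = proj₁ profile
    adm = proj₁ (proj₂ profile)
    path = fromDepth n a (λ r r<n → step adm r (s≤s r<n))
    z = proj₁ path
    lz = proj₁ (proj₂ path)
    a0 = start adm
    sz : sum z ≡ suc s
    sz = trans (proj₁ (proj₂ (proj₂ path))) (trans (cong (_+_ (suc s)) a0) (ℕₚ.+-identityʳ (suc s)))
    pz : ∀ r → r < s → partialSum z r + a r ≡ r
    pz r (s≤s r≤n) = trans (proj₂ (proj₂ (proj₂ path)) r r≤n) (trans (cong (_+_ r) a0) (ℕₚ.+-identityʳ r))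
    dyck : Dyck z
    dyck r r<z = subst (partialSum z r ≤_) (pz r (subst (r <_) lz r<z)) (ℕₚ.m≤m+n (partialSum z r) (a r))
    z∈ : z ∈ dyckCompositions s
    z∈ = ∈-filter⁺ Dyck? (∈-compositions⁺ s (suc s) lz sz) dyck
    depth≡a : ∀ r → r < s → a r ≡ depth z r
    depth≡a r r<s = sym (trans (cong (_∸ partialSum z r) (sym (pz r r<s))) (ℕₚ.m+n∸m≡n (partialSum z r) (a r)))
    p≡ : p ≡ core z
    p≡ = trans (sym (fromHooks-firstHooks p))
      (cong fromHooks (trans (proj₂ (proj₂ profile)) (hooksBelow-cong s depth≡a)))

  cores : List (List ℕ)
  cores = map core (dyckCompositions s)

  cores-enumerate : Enumerates (IsCore₂ s (suc s)) cores
  cores-enumerate = enumerates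
    (Unique-map-∈ core (dyckCompositions s) core-injective
      (Unique.filter⁺ Dyck? (compositions-unique s (suc s))))
    (λ p → mk⇔ (to p) (from p))
    where
    to : ∀ p → p ∈ cores → IsCore₂ s (suc s) p
    to p p∈ with ∈-map⁻ core p∈
    ... | z , z∈ , refl = core-IsCore₂ z∈
    from : ∀ p → IsCore₂ s (suc s) p → p ∈ cores
    from p isCore with core-surjective p isCore
    ... | z , z∈ , refl = ∈-map⁺ core z∈

-- Binomial coefficients and rational arithmetic

N-binomial : ∀ k t → N (suc k) t ≡ + ((k + t) C t)
N-binomial k       zero    = N-suc-0 k
N-binomial zero    (suc t) = begin
  N 1 (suc t)                              ≡⟨ N-suc-suc 0 t ⟩
  0ℤ +ᶻ N 1 t                              ≡⟨ ℤₚ.+-identityˡ (N 1 t) ⟩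
  N 1 t                                    ≡⟨ N-binomial 0 t ⟩
  + (t C t)                                ≡⟨ cong +_ (trans (nCn≡1 t) (sym (nCn≡1 (suc t)))) ⟩
  + (suc t C suc t)                        ∎
  where open ≡-Reasoning
N-binomial (suc k) (suc t) = begin
  N (suc (suc k)) (suc t)                  ≡⟨ N-suc-suc (suc k) t ⟩
  N (suc k) (suc t) +ᶻ N (suc (suc k)) t   ≡⟨ cong₂ _+ᶻ_ (N-binomial k (suc t)) (N-binomial (suc k) t) ⟩
  + ((k + suc t) C suc t + (suc k + t) C t) ≡⟨ cong +_ (ℕₚ.+-comm ((k + suc t) C suc t) _) ⟩
  + ((suc k + t) C t + (k + suc t) C suc t) ≡⟨ cong (λ m → + (m C t + (k + suc t) C suc t)) (sym (ℕₚ.+-suc k t)) ⟩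
  + ((k + suc t) C t + (k + suc t) C suc t) ≡⟨ cong +_ (nCk+nC[k+1]≡[n+1]C[k+1] (k + suc t) t) ⟩
  + ((suc k + suc t) C suc t)              ∎
  where open ≡-Reasoning

2*C2 : ∀ n → 2 * (suc n C 2) ≡ suc n * n
2*C2 zero    = refl
2*C2 (suc n) = begin
  2 * (suc (suc n) C 2)                    ≡⟨ cong (2 *_) (sym (nCk+nC[k+1]≡[n+1]C[k+1] (suc n) 1)) ⟩
  2 * (suc n C 1 + suc n C 2)              ≡⟨ ℕₚ.*-distribˡ-+ 2 (suc n C 1) (suc n C 2) ⟩
  2 * (suc n C 1) + 2 * (suc n C 2)        ≡⟨ cong₂ (λ x y → 2 * x + y) (nC1≡n (suc n)) (2*C2 n) ⟩
  2 * suc n + suc n * n                    ≡⟨ lemma n ⟩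
  suc (suc n) * suc n                      ∎
  where
  open ≡-Reasoning
  lemma : ∀ n → 2 * suc n + suc n * n ≡ suc (suc n) * suc n
  lemma = solveℕ

6*C3 : ∀ n → 6 * (suc (suc n) C 3) ≡ suc (suc n) * suc n * n
6*C3 zero    = refl
6*C3 (suc n) = begin
  6 * (suc (suc (suc n)) C 3)                        ≡⟨ cong (6 *_) (sym (nCk+nC[k+1]≡[n+1]C[k+1] (suc (suc n)) 2)) ⟩
  6 * (suc (suc n) C 2 + suc (suc n) C 3)            ≡⟨ lem₁ (suc (suc n) C 2) (suc (suc n) C 3) ⟩
  3 * (2 * (suc (suc n) C 2)) + 6 * (suc (suc n) C 3) ≡⟨ cong₂ (λ x y → 3 * x + y) (2*C2 (suc n)) (6*C3 n) ⟩
  3 * (suc (suc n) * suc n) + suc (suc n) * suc n * n ≡⟨ lem₂ n ⟩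
  suc (suc (suc n)) * suc (suc n) * suc n            ∎
  where
  open ≡-Reasoning
  lem₁ : ∀ x y → 6 * (x + y) ≡ 3 * (2 * x) + 6 * y
  lem₁ = solveℕ
  lem₂ : ∀ n → 3 * (suc (suc n) * suc n) + suc (suc n) * suc n * n ≡ suc (suc (suc n)) * suc (suc n) * suc n
  lem₂ = solveℕ

/-toℚᵘ : ∀ i d .{{_ : NonZero d}} → toℚᵘ (i / d) ℚᵘ.≃ i ℚᵘ./ d
/-toℚᵘ i (suc d) = ℚₚ.toℚᵘ-fromℚᵘ (mkℚᵘ i d)

-- `_/_` normalises its result, so the comparison is made on unnormalised rationals, whose equality
-- is cross-multiplication.
/-cross : ∀ a b c d .{{_ : NonZero b}} .{{_ : NonZero d}} → a * d ≡ c * b → + a / b ≡ + c / d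
/-cross a b@(suc _) c d@(suc _) eq = ℚₚ.toℚᵘ-injective
  (ℚᵘₚ.≃-trans (/-toℚᵘ (+ a) b)
    (ℚᵘₚ.≃-trans (*≡* (trans (sym (ℤₚ.pos-* a d)) (trans (cong +_ eq) (ℤₚ.pos-* c b))))
      (ℚᵘₚ.≃-sym (/-toℚᵘ (+ c) d))))

/-*-fromℕ : ∀ a b c .{{_ : NonZero b}} → (+ a / b) *ℚ fromℕ c ≡ + (a * c) / b
/-*-fromℕ a b@(suc _) c = ℚₚ.toℚᵘ-injective
  (ℚᵘₚ.≃-trans (ℚₚ.toℚᵘ-homo-* (+ a / b) (fromℕ c))
    (ℚᵘₚ.≃-trans (ℚᵘₚ.*-cong (/-toℚᵘ (+ a) b) (/-toℚᵘ (+ c) 1))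
      (ℚᵘₚ.≃-trans (*≡* (cong₂ _*ᶻ_ (sym (ℤₚ.pos-* a c)) (sym (cong +_ (ℕₚ.*-identityʳ b)))))
        (ℚᵘₚ.≃-sym (/-toℚᵘ (+ (a * c)) b)))))

-- The number of cores and the sum of their sizes

module _ (n : ℕ) where

  private
    s = suc n
    D = dyckCompositions s

  totalSize-∑∈ : ∀ (ps : List (List ℕ)) → + totalSize ps ≡ ∑∈ ps (λ p → + size p)
  totalSize-∑∈ []       = refl
  totalSize-∑∈ (p ∷ ps) = cong (+ size p +ᶻ_) (totalSize-∑∈ ps)

  s*length-cores : + s *ᶻ + length (cores n) ≡ N s (suc s)
  s*length-cores = begin
    + s *ᶻ + length (cores n)          ≡⟨ cong (λ l → + s *ᶻ + l) (length-map (core n) D) ⟩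
    + s *ᶻ + length D                  ≡⟨ cong (+ s *ᶻ_) (length-∑∈ D) ⟩
    + s *ᶻ ∑∈ D (λ _ → 1ℤ)             ≡⟨ sym (cycle-lemma s (s≤s z≤n) (λ _ → 1ℤ) (λ _ _ _ → refl)) ⟩
    N s (suc s)                        ∎
    where open ≡-Reasoning

  -- The cycle lemma for the constant 1 gives `s` times the number of cores as `N s (suc s)`.
  -- `N-ratio` at `k = t = s` turns this into the central binomial coefficient, and `s` cancels.
  length-cores : suc s * length (cores n) ≡ (2 * s) C s
  length-cores = ℤₚ.+-injective (ℤₚ.*-cancelˡ-≡ (+ s) _ _ (begin
    + s *ᶻ + (suc s * length (cores n))      ≡⟨ cong (+ s *ᶻ_) (ℤₚ.pos-* (suc s) (length (cores n))) ⟩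
    + s *ᶻ (+ suc s *ᶻ + length (cores n))   ≡⟨ lemma (+ s) (+ suc s) (+ length (cores n)) ⟩
    + suc s *ᶻ (+ s *ᶻ + length (cores n))   ≡⟨ cong (+ suc s *ᶻ_) s*length-cores ⟩
    + suc s *ᶻ N s (suc s)                   ≡⟨ N-ratio s s ⟩
    + s *ᶻ N (suc s) s                       ≡⟨ cong (+ s *ᶻ_) (N-binomial s s) ⟩
    + s *ᶻ + ((s + s) C s)                   ≡⟨ cong (λ m → + s *ᶻ + ((s + m) C s)) (sym (ℕₚ.+-identityʳ s)) ⟩
    + s *ᶻ + ((2 * s) C s)                   ∎))
    where
    open ≡-Reasoning
    lemma : ∀ a b c → a *ᶻ (b *ᶻ c) ≡ b *ᶻ (a *ᶻ c)
    lemma = solve-∀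

  2*totalSize : + 2 *ᶻ + totalSize (cores n) ≡ ∑∈ D (λ z → twiceSize s (height z))
  2*totalSize = begin
    + 2 *ᶻ + totalSize (cores n)                  ≡⟨ cong (+ 2 *ᶻ_) (trans (totalSize-∑∈ (cores n)) (∑∈-map (core n) D (λ p → + size p))) ⟩
    + 2 *ᶻ ∑∈ D (λ z → + size (core n z))         ≡⟨ sym (∑∈-*ˡ D (+ 2) (λ z → + size (core n z))) ⟩
    ∑∈ D (λ z → + 2 *ᶻ + size (core n z))         ≡⟨ ∑∈-cong D (core-size n) ⟩
    ∑∈ D (λ z → twiceSize s (height z))           ∎
    where open ≡-Reasoning

  -- The 24 is the 12 that clears the moment denominators times the 2 in `twiceSize`. The cycle
  -- lemma is used for sizes and for the count, so a factor `s` arises on both sides and cancels.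
  24*totalSize : 24 * totalSize (cores n) ≡ (2 * s + 2) * n * s * length (cores n)
  24*totalSize = ℤₚ.+-injective (ℤₚ.*-cancelˡ-≡ (+ s) _ _ (begin
    + s *ᶻ + (24 * T)                             ≡⟨ cong (+ s *ᶻ_) (ℤₚ.pos-* 24 T) ⟩
    + s *ᶻ (+ 24 *ᶻ + T)                          ≡⟨ lem₁ (+ s) (+ T) ⟩
    + 12 *ᶻ (+ s *ᶻ (+ 2 *ᶻ + T))                 ≡⟨ cong (λ x → + 12 *ᶻ (+ s *ᶻ x)) 2*totalSize ⟩
    + 12 *ᶻ (+ s *ᶻ ∑∈ D f)                       ≡⟨ cong (+ 12 *ᶻ_) (sym (cycle-lemma s (s≤s z≤n) f f-rotate)) ⟩
    + 12 *ᶻ ∑∈ (compositions s (suc s)) f         ≡⟨ total-twiceSize s ⟩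
    N s (suc s) *ᶻ ((+ 2 *ᶻ + s +ᶻ + 2) *ᶻ (+ s -ᶻ 1ℤ) *ᶻ + s)
      ≡⟨ cong (_*ᶻ ((+ 2 *ᶻ + s +ᶻ + 2) *ᶻ (+ s -ᶻ 1ℤ) *ᶻ + s)) (sym s*length-cores) ⟩
    + s *ᶻ + L *ᶻ ((+ 2 *ᶻ + s +ᶻ + 2) *ᶻ (+ s -ᶻ 1ℤ) *ᶻ + s)
      ≡⟨ lem₂ (+ n) (+ L) ⟩
    + s *ᶻ ((+ 2 *ᶻ + s +ᶻ + 2) *ᶻ + n *ᶻ + s *ᶻ + L)
      ≡⟨ cong (+ s *ᶻ_) (sym cast) ⟩
    + s *ᶻ + ((2 * s + 2) * n * s * L)            ∎))
    where
    open ≡-Reasoning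
    T = totalSize (cores n)
    L = length (cores n)
    f : List ℕ → ℤ
    f z = twiceSize s (height z)
    f-rotate : ∀ z → length z ≡ s → _ → f (rotate z) ≡ f z
    f-rotate z lz sz = subst (λ l → twiceSize l (height (rotate z)) ≡ twiceSize l (height z)) lz
      (twiceSize-rotate z (trans sz (cong suc (sym lz))))
    cast : + ((2 * s + 2) * n * s * L) ≡ (+ 2 *ᶻ + s +ᶻ + 2) *ᶻ + n *ᶻ + s *ᶻ + L
    cast = trans (ℤₚ.pos-* ((2 * s + 2) * n * s) L) (cong (_*ᶻ + L)
      (trans (ℤₚ.pos-* ((2 * s + 2) * n) s) (cong (_*ᶻ + s)
        (trans (ℤₚ.pos-* (2 * s + 2) n) (cong (λ x → (x +ᶻ + 2) *ᶻ + n) (ℤₚ.pos-* 2 s))))))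
    lem₁ : ∀ s t → s *ᶻ (+ 24 *ᶻ t) ≡ + 12 *ᶻ (s *ᶻ (+ 2 *ᶻ t))
    lem₁ = solve-∀
    lem₂ : ∀ n l →
      (1ℤ +ᶻ n) *ᶻ l *ᶻ ((+ 2 *ᶻ (1ℤ +ᶻ n) +ᶻ + 2) *ᶻ (1ℤ +ᶻ n -ᶻ 1ℤ) *ᶻ (1ℤ +ᶻ n))
      ≡ (1ℤ +ᶻ n) *ᶻ ((+ 2 *ᶻ (1ℤ +ᶻ n) +ᶻ + 2) *ᶻ n *ᶻ (1ℤ +ᶻ n) *ᶻ l)
    lem₂ = solve-∀

  12*totalSize : 12 * totalSize (cores n) ≡ s * n * ((2 * s) C s)
  12*totalSize = ℕₚ.*-cancelˡ-≡ _ _ 2 (begin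
    2 * (12 * totalSize (cores n))               ≡⟨ sym (ℕₚ.*-assoc 2 12 (totalSize (cores n))) ⟩
    24 * totalSize (cores n)                     ≡⟨ 24*totalSize ⟩
    (2 * s + 2) * n * s * length (cores n)       ≡⟨ lemma s n (length (cores n)) ⟩
    2 * (s * n * (suc s * length (cores n)))     ≡⟨ cong (λ x → 2 * (s * n * x)) length-cores ⟩
    2 * (s * n * ((2 * s) C s))                  ∎)
    where
    open ≡-Reasoning
    lemma : ∀ s n l → (2 * s + 2) * n * s * l ≡ 2 * (s * n * (suc s * l))
    lemma = solveℕ

  2*totalSize-C3 : 2 * totalSize (cores n) ≡ (suc s C 3) * length (cores n)
  2*totalSize-C3 = ℕₚ.*-cancelˡ-≡ _ _ 12 (begin
    12 * (2 * totalSize (cores n))               ≡⟨ sym (ℕₚ.*-assoc 12 2 (totalSize (cores n))) ⟩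
    24 * totalSize (cores n)                     ≡⟨ 24*totalSize ⟩
    (2 * s + 2) * n * s * length (cores n)       ≡⟨ lem₁ n (length (cores n)) ⟩
    2 * (suc s * s * n * length (cores n))       ≡⟨ cong (λ x → 2 * (x * length (cores n))) (sym (6*C3 n)) ⟩
    2 * (6 * (suc s C 3) * length (cores n))     ≡⟨ lem₂ (suc s C 3) (length (cores n)) ⟩
    12 * ((suc s C 3) * length (cores n))        ∎)
    where
    open ≡-Reasoning
    lem₁ : ∀ n l → (2 * suc n + 2) * n * suc n * l ≡ 2 * (suc (suc n) * suc n * n * l)
    lem₁ = solveℕ
    lem₂ : ∀ c l → 2 * (6 * c * l) ≡ 12 * (c * l)
    lem₂ = solveℕ

  cores-nonempty : NonZero (length (cores n))
  cores-nonempty = nonempty (Equivalence.from (Enumerates.members (cores-enumerate n) [])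
    ((isPartition [] [] , []) , (isPartition [] [] , [])))
    where
    nonempty : ∀ {A : Set} {x : A} {xs} → x ∈ xs → NonZero (length xs)
    nonempty (here _)  = _
    nonempty (there _) = _

theorem2p3 : (s : ℕ) → 1 ≤ s →
    ∃ λ (cores : List (List ℕ)) →
    Enumerates (IsCore₂ s (suc s)) cores
    × fromℕ (totalSize cores) ≡ (+ (s * (s ∸ 1)) / 12) *ℚ fromℕ ((2 * s) C s)
    × fromℕ (length cores) ≡ (+ 1 / suc s) *ℚ fromℕ ((2 * s) C s)
    × Σ (NonZero (length cores)) λ nonempty →
    averageSize cores {{nonempty}} ≡ + ((2 * s + 2) * (s ∸ 1) * s) / 24
    × averageSize cores {{nonempty}} ≡ ½ *ℚ fromℕ (suc s C 3)
theorem2p3 s@(suc n) _ = cores n , cores-enumerate n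
  , trans (/-cross T 1 (s * n * B) 12 (trans (ℕₚ.*-comm T 12) (trans (12*totalSize n) (sym (ℕₚ.*-identityʳ _)))))
          (sym (/-*-fromℕ (s * n) 12 B))
  , trans (/-cross L 1 (1 * B) (suc s) (trans (ℕₚ.*-comm L (suc s)) (trans (length-cores n) (lemma B))))
          (sym (/-*-fromℕ 1 (suc s) B))
  , cores-nonempty n
  , /-cross T L ((2 * s + 2) * n * s) 24 (trans (ℕₚ.*-comm T 24) (24*totalSize n))
  , trans (/-cross T L (1 * (suc s C 3)) 2 (trans (ℕₚ.*-comm T 2) (trans (2*totalSize-C3 n)
            (cong (_* L) (sym (ℕₚ.*-identityˡ (suc s C 3)))))))
          (sym (/-*-fromℕ 1 2 (suc s C 3)))
  where
  T = totalSize (cores n)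
  L = length (cores n)
  B = (2 * s) C s
  instance
    L≢0 : NonZero L
    L≢0 = cores-nonempty n
  lemma : ∀ b → b ≡ 1 * b * 1
  lemma = solveℕ
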